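{- Let $A$ be the path matrix of a (nonnegative weighted) planar network $D$ of order $n$ and let $\lambda\vdash n$. Then $\mathrm{Imm}_{\psi^\lambda}(A)$ is equal to each of $$\sum_{\pi\in\mathcal P_e(D)}\mathrm{wgt}(\pi)\cdot\#\{\text{cyclically row-semistrict }P(\pi)\text{ -tableaux of shape }\lambda\},$$ $$\sum_{\pi\in\mathcal P_e(D)}\mathrm{wgt}(\pi)\cdot\#\{P(\pi)\text{ -record-free row-semistrict }P(\pi)\text{ -tableaux of shape }\lambda\},$$ $$\sum_{\pi\in\mathcal P(D)}\mathrm{wgt}(\pi)\cdot\#\{\text{cylindrical }\pi\text{ -tableaux of shape }\lambda\}.$$
   Context: A (nonnegative weighted) planar network of order $n$ is a directed, planar, acyclic digraph $D=(V,E)$ which can be embedded in a disc so that $2n$ distinguished vertices, labeled clockwise as $s_1,\dots,s_n,t_n,\dots,t_1$, lie on the boundary of the disc, with a nonnegative real weight assigned to each edge; the sources $s_i$ have indegree $0$ and the sinks $t_i$ have outdegree $0$. The weight of a source-to-sink path is the product of the weights of its edges. The path matrix $A=(a_{i,j})_{i,j\in[n]}$ of $D$ has $a_{i,j}$ equal to the sum of weights of all paths from $s_i$ to $t_j$. A path family $\pi=(\pi_1,\dots,\pi_n)$ has type $w=w_1\cdots w_n\in\mathfrak S_n$ if $\pi_i$ is a path from $s_i$ to $t_{w_i}$ for all $i$; $\mathrm{wgt}(\pi)=\mathrm{wgt}(\pi_1)\cdots\mathrm{wgt}(\pi_n)$. $\mathcal P(D)$ is the set of path families in $D$ of all types $w\in\mathfrak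 S_n$, and $\mathcal P_e(D)$ the subset of those whose type is the identity. For $\pi\in\mathcal P_e(D)$, $P(\pi)$ is the poset on $\{\pi_1,\dots,\pi_n\}$ with $\pi_i<\pi_j$ if and only if $i<j$ and $\pi_i$, $\pi_j$ do not intersect (share no vertex). For a class function $\theta$ on $\mathfrak S_n$, $\mathrm{Imm}_\theta(A)=\sum_{w\in\mathfrak S_n}\theta(w)a_{1,w_1}\cdots a_{n,w_n}$. $\psi^\lambda$ is the class function with $\psi^\lambda(w)=z_\lambda$ if $w$ has cycle type $\lambda$ and $0$ otherwise, where $z_\lambda=\lambda_1\cdots\lambda_\ell\,\alpha_1!\cdots\alpha_n!$ and $\alpha_i$ is the number of parts of $\lambda$ equal to $i$. For a poset $P$, a $P$-tableau of shape $\lambda\vdash|P|$ is a filling of a Young diagram of shape $\lambda$ (with $\lambda_i$ boxes in row $i$) with the elements of $P$, each used once; $U_{i,j}$ is the $j$th entry of row $i$. It is row-semistrict if $U_{i,j}\not>_PU_{i,j+1}$ always; cyclically row-semistrict if row-semistrict and $U_{i,\lambda_i}\not>_PU_{i,1}$ for all $i$; $P$-record-free if there is no position $(i,j)$ with $j\ne1$ such that all of $U_{i,1},\dots,U_{i,j-1}$ are $<_PU_{i,j}$. For $\pi\in\mathcal P(D)$, a $\pi$-tableau of shape $\lambda$ is a filling of a Young diagram of shape $\lambda$ with $\pi_1,\dots,\pi_n$, each used once. It is cylindrical if in each row $U_i=U_{i,1}\cdots U_{i,\lambda_i}$ the sequence of sink indices of $U_{i,1},\dots,U_{i,\lambda_i}$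 equals the sequence of source indices of $U_{i,2},\dots,U_{i,\lambda_i},U_{i,1}$ (each path begins at the index where the cyclically preceding path in its row terminates). -}

module Defs where

open import Algebra.Bundles using (CommutativeRing)
open import Algebra.Core using (Op₁; Op₂)
open import Algebra.Structures using (IsCommutativeRing)
import Algebra.Definitions.RawMonoid as RawMonoidOps
import Algebra.Properties.CommutativeMonoid.Sum as FiniteSum
open import Data.Bool.Base using (if_then_else_)
open import Data.Fin.Base using (Fin; zero; suc; toℕ) renaming (_<_ to _<ᶠ_)
import Data.Fin.Properties as Fin
open import Data.List.Base as List
  using (List; []; _∷_; length; lookup; map; concatMap; filter; foldr; allFin;
         upTo; iterate; deduplicate; cartesianProductWith)
import Data.List.Membership.DecPropositional as DecMembership
open import Data.List.Membership.Propositional using (_∈_)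
import Data.List.Properties as List
open import Data.List.Relation.Unary.All using (All)
open import Data.List.Relation.Unary.Linked using (Linked)
import Data.List.Sort.InsertionSort as InsertionSort
open import Data.Maybe.Base using (Maybe; just; nothing)
open import Data.Nat.Base as ℕ using (ℕ; zero; suc; _!; _≥_)
open import Data.Nat.ListAction using (sum; product)
import Data.Nat.Properties as ℕ
open import Data.Product.Base using (Σ; ∃; _×_; _,_)
import Data.Product.Properties as Product
open import Data.Sum.Base using (_⊎_)
open import Function.Base using (_∘_; id)
open import Function.Bundles using (_⇔_)
open import Function.Definitions using (Injective; Surjective)
open import Level using (Level; 0ℓ; _⊔_) renaming (suc to lsuc)
open import Relation.Binary.Construct.Closure.Equivalence using (EqClosure)
open import Relation.Binary.Construct.Closure.ReflexiveTransitive using (Star; ε; _◅_)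
open import Relation.Binary.Construct.Closure.Transitive using (TransClosure)
import Relation.Binary.Construct.Flip.EqAndOrd as Flip
open import Relation.Binary.Core using (Rel; _Preserves₂_⟶_⟶_)
open import Relation.Binary.Definitions using (Decidable)
open import Relation.Binary.PropositionalEquality.Core using (_≡_; _≢_; refl)
open import Relation.Binary.Structures using (IsPartialOrder)
open import Relation.Nullary.Decidable.Core
  using (Dec; yes; no; does; map′; ¬?; _×-dec_; _⊎-dec_; _→-dec_)
open import Relation.Nullary.Negation.Core using (¬_)
import Relation.Unary as Unary

private
  variable
    a p r c ℓ₁ ℓ₂ : Level
    k m n : ℕ

------------------------------------------------------------------------
-- Coefficients

-- The real numbers, which the standard library lacks, are an instance.
record OrderedCommutativeRing c ℓ₁ ℓ₂ : Set (lsuc (c ⊔ ℓ₁ ⊔ ℓ₂)) where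
  infix  8 -_
  infixl 7 _*_
  infixl 6 _+_
  infix  4 _≈_ _≤_
  field
    Carrier           : Set c
    _≈_               : Rel Carrier ℓ₁
    _≤_               : Rel Carrier ℓ₂
    _+_ _*_           : Op₂ Carrier
    -_                : Op₁ Carrier
    0# 1#             : Carrier
    isCommutativeRing : IsCommutativeRing _≈_ _+_ _*_ -_ 0# 1#
    isPartialOrder    : IsPartialOrder _≈_ _≤_
    +-mono-≤          : _+_ Preserves₂ _≤_ ⟶ _≤_ ⟶ _≤_
    *-nonNegative     : ∀ {x y} → 0# ≤ x → 0# ≤ y → 0# ≤ x * y
    0≤1               : 0# ≤ 1#

  commutativeRing : CommutativeRing c ℓ₁
  commutativeRing = record { isCommutativeRing = isCommutativeRing }

  open CommutativeRing commutativeRing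
    using (+-rawMonoid; *-commutativeMonoid)

  ∑ : {A : Set a} → List A → (A → Carrier) → Carrier
  ∑ xs f = foldr (λ x s → f x + s) 0# xs

  ∏ : (Fin n → Carrier) → Carrier
  ∏ = FiniteSum.sum *-commutativeMonoid

  fromℕ : ℕ → Carrier
  fromℕ k = RawMonoidOps._×_ +-rawMonoid k 1#

------------------------------------------------------------------------
-- Finite enumeration

-- All functions f with f i ∈ xs i for every i.
choices : {B : Fin n → Set a} → (∀ i → List (B i)) → List (∀ i → B i)
choices {n = zero}  xs = (λ ()) ∷ []
choices {n = suc n} xs =
  cartesianProductWith Fin.∀-cons (xs zero) (choices (xs ∘ suc))

# : {A : Set a} {P : Unary.Pred A p} → Unary.Decidable P → List A → ℕ
# P? xs = length (filter P? xs)

------------------------------------------------------------------------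
-- Permutations and partitions

injective? : (f : Fin m → Fin n) → Dec (Injective _≡_ _≡_ f)
injective? f = map′ (λ h {x} {y} → h x y) (λ h x y → h {x} {y})
  (Fin.all? λ x → Fin.all? λ y → (f x Fin.≟ f y) →-dec (x Fin.≟ y))

-- An injective self-map of the finite set Fin n is a permutation.
𝔖 : ∀ n → List (Fin n → Fin n)
𝔖 n = filter injective? (choices λ _ → allFin n)

record Partition (n : ℕ) : Set where
  field
    parts      : List ℕ
    parts-pos  : All (0 ℕ.<_) parts
    parts-decr : Linked _≥_ parts
    sum-parts  : sum parts ≡ n

  multiplicity : ℕ → ℕ
  multiplicity k = # (ℕ._≟ k) parts

  z : ℕ
  z = product parts ℕ.* product (map (λ k → multiplicity (suc k) !) (upTo n))

open InsertionSort (Flip.decTotalOrder ℕ.≤-decTotalOrder)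
  using () renaming (sort to sortDecreasingly)

module _ (w : Fin n → Fin n) where

  open DecMembership (Fin._≟_ {n}) using (_∈?_)

  -- The support of the cycle through i, in increasing order; n steps
  -- suffice to traverse a cycle.
  cycleOf : Fin n → List (Fin n)
  cycleOf i = filter (_∈? iterate w i n) (allFin n)

  cycles : List (List (Fin n))
  cycles = deduplicate (List.≡-dec Fin._≟_) (map cycleOf (allFin n))

  cycleType : List ℕ
  cycleType = sortDecreasingly (map length cycles)

------------------------------------------------------------------------
-- Digraphs

record Digraph : Set where
  field
    order size : ℕ

  Vertex = Fin order
  Edge   = Fin size

  field
    tail head : Edge → Vertex

  _⟶_ : Rel Vertex 0ℓ
  u ⟶ v = ∃ λ e → tail e ≡ u × head e ≡ v

  Path : Rel Vertex 0ℓ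
  Path = Star _⟶_

  Acyclic : Set
  Acyclic = ∀ v → ¬ TransClosure _⟶_ v v

  visited : ∀ {u v} → Path u v → List Vertex
  visited {u} ε       = u ∷ []
  visited {u} (_ ◅ p) = u ∷ visited p

  Intersect : ∀ {u v u′ v′} → Path u v → Path u′ v′ → Set
  Intersect p q = ∃ λ x → x ∈ visited p × x ∈ visited q

  intersect? : ∀ {u v u′ v′} (p : Path u v) (q : Path u′ v′) →
               Dec (Intersect p q)
  intersect? p q = Fin.any? λ x → (x ∈? visited p) ×-dec (x ∈? visited q)
    where open DecMembership (Fin._≟_ {order}) using (_∈?_)

  pathsOfLength : ℕ → ∀ u v → List (Path u v)
  pathsOfLength zero u v with u Fin.≟ v
  ... | yes refl = ε ∷ []
  ... | no  _    = []
  pathsOfLength (suc k) u v = concatMap (λ e → via e (tail e Fin.≟ u)) (allFin size)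
    where
    via : ∀ e → Dec (tail e ≡ u) → List (Path u v)
    via e (yes p) = map ((e , p , refl) ◅_) (pathsOfLength k (head e) v)
    via e (no  _) = []

  -- In an acyclic digraph no path has as many edges as there are
  -- vertices, so this lists every path from u to v exactly once.
  paths : ∀ u v → List (Path u v)
  paths u v = concatMap (λ k → pathsOfLength k u v) (upTo order)

------------------------------------------------------------------------
-- Embeddings in a disc

data Boundary (n : ℕ) : Set where
  s t : Fin n → Boundary n

-- The cyclic order s₁, …, sₙ, tₙ, …, t₁.
data _↷_ {n} : Rel (Boundary n) 0ℓ where
  s↷s : ∀ {i j} → toℕ j ≡ suc (toℕ i) → s i ↷ s j
  s↷t : ∀ {i}   → suc (toℕ i) ≡ n     → s i ↷ t i
  t↷t : ∀ {i j} → toℕ i ≡ suc (toℕ j) → t i ↷ t j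
  t↷s : ∀ {i}   → toℕ i ≡ 0           → t i ↷ s i

-- R is an equivalence relation with exactly k classes.
record Classes {A : Set a} (R : Rel A r) (k : ℕ) : Set (a ⊔ r) where
  field
    class      : A → Fin k
    surjective : Surjective _≡_ _≡_ class
    kernel     : ∀ x y → class x ≡ class y ⇔ R x y

-- Embeddings are taken up to homeomorphism, as combinatorial maps
-- (rotation systems).  Collapsing the outside of the disc to a point
-- turns an embedding in the disc, with the vertices `terminal b` on the
-- boundary circle, into an embedding in the sphere of the graph with one
-- more vertex, the hub, joined by a spoke to each `terminal b`, such that
-- the spokes leave the hub in the cyclic order of the circle.  The
-- surface underlying a combinatorial map is a union of spheres, one for
-- each connected component, exactly when its Euler characteristic is
-- twice the number of components.
module _ (G : Digraph) {n : ℕ} (terminal : Boundary n → Digraph.Vertex G) where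

  open Digraph G

  -- The half-edges of the extended graph: the two ends of each edge and
  -- the two ends of each spoke.
  data Dart : Set where
    tailEnd headEnd : Edge → Dart
    hubEnd  rimEnd  : Boundary n → Dart

  opposite : Dart → Dart
  opposite (tailEnd e) = headEnd e
  opposite (headEnd e) = tailEnd e
  opposite (hubEnd b)  = rimEnd b
  opposite (rimEnd b)  = hubEnd b

  -- `nothing` is the hub.
  origin : Dart → Maybe Vertex
  origin (tailEnd e) = just (tail e)
  origin (headEnd e) = just (head e)
  origin (hubEnd b)  = nothing
  origin (rimEnd b)  = just (terminal b)

  SameOrigin : Rel Dart 0ℓ
  SameOrigin x y = origin x ≡ origin y

  SameOrbit : (Dart → Dart) → Rel Dart 0ℓ
  SameOrbit f = Star (λ x y → f x ≡ y)

  record DiscEmbedding : Set where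
    field
      -- Successor in the cyclic order of the darts around their origin.
      -- Its orbits being the vertices forces it to be a permutation.
      rotation       : Dart → Dart
      rotation-orbit : ∀ x y → SameOrigin x y ⇔ SameOrbit rotation x y
      rotation-hub   : ∀ {b c} → b ↷ c → rotation (hubEnd b) ≡ hubEnd c

    Incident : Rel Dart 0ℓ
    Incident x y = rotation x ≡ y ⊎ opposite x ≡ y

    -- Isolated vertices carry no dart and count neither as vertices nor
    -- as components.
    field
      #vertices #faces #components : ℕ
      vertices   : Classes SameOrigin #vertices
      faces      : Classes (SameOrbit (rotation ∘ opposite)) #faces
      components : Classes (EqClosure Incident) #components
      euler      : #vertices ℕ.+ #faces ≡
                   (size ℕ.+ (n ℕ.+ n)) ℕ.+ 2 ℕ.* #components

------------------------------------------------------------------------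
-- Tableaux

module _ {n : ℕ} (shape : Partition n) where

  open Partition shape

  #rows : ℕ
  #rows = length parts

  -- A filling with the elements of a set indexed by Fin n, each entry
  -- being given by its index.
  Filling : Set
  Filling = ∀ (i : Fin #rows) → Fin (lookup parts i) → Fin n

  Box : Set
  Box = Σ (Fin #rows) λ i → Fin (lookup parts i)

  -- As there are n boxes, each index occurs exactly once as soon as none
  -- occurs twice.
  EachOnce : Filling → Set
  EachOnce U = ∀ i j i′ j′ → U i j ≡ U i′ j′ → _≡_ {A = Box} (i , j) (i′ , j′)

  eachOnce? : Unary.Decidable EachOnce
  eachOnce? U = Fin.all? λ i → Fin.all? λ j → Fin.all? λ i′ → Fin.all? λ j′ →
    (U i j Fin.≟ U i′ j′) →-dec Product.≡-dec Fin._≟_ Fin._≟_ (i , j) (i′ , j′)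

  tableaux : List Filling
  tableaux = filter eachOnce? (choices λ _ → choices λ _ → allFin n)

Consecutive : Rel (Fin k) 0ℓ
Consecutive j j′ = toℕ j′ ≡ suc (toℕ j)

consecutive? : Decidable (Consecutive {k})
consecutive? j j′ = toℕ j′ ℕ.≟ suc (toℕ j)

LastFirst : Rel (Fin k) 0ℓ
LastFirst {k} j j′ = suc (toℕ j) ≡ k × toℕ j′ ≡ 0

lastFirst? : Decidable (LastFirst {k})
lastFirst? {k} j j′ = (suc (toℕ j) ℕ.≟ k) ×-dec (toℕ j′ ℕ.≟ 0)

module PTableaux {A : Set} {_<P_ : Rel A 0ℓ} (_<P?_ : Decidable _<P_) where

  RowSemistrict : (Fin k → A) → Set
  RowSemistrict U = ∀ j j′ → Consecutive j j′ → ¬ (U j′ <P U j)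

  rowSemistrict? : Unary.Decidable (RowSemistrict {k})
  rowSemistrict? U = Fin.all? λ j → Fin.all? λ j′ →
    consecutive? j j′ →-dec ¬? (U j′ <P? U j)

  CyclicallyRowSemistrict : (Fin k → A) → Set
  CyclicallyRowSemistrict U =
    RowSemistrict U × (∀ j j′ → LastFirst j j′ → ¬ (U j′ <P U j))

  cyclicallyRowSemistrict? : Unary.Decidable (CyclicallyRowSemistrict {k})
  cyclicallyRowSemistrict? U = rowSemistrict? U ×-dec
    (Fin.all? λ j → Fin.all? λ j′ → lastFirst? j j′ →-dec ¬? (U j′ <P? U j))

  RecordFree : (Fin k → A) → Set
  RecordFree U = ∀ j → toℕ j ≢ 0 → ¬ (∀ i → i <ᶠ j → U i <P U j)

  recordFree? : Unary.Decidable (RecordFree {k})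
  recordFree? U = Fin.all? λ j → ¬? (toℕ j ℕ.≟ 0) →-dec
    ¬? (Fin.all? λ i → (i Fin.<? j) →-dec (U i <P? U j))

Cylindrical : (Fin n → Fin n) → (Fin k → Fin n) → Set
Cylindrical w U = ∀ j j′ → Consecutive j j′ ⊎ LastFirst j j′ → w (U j) ≡ U j′

cylindrical? : (w : Fin n → Fin n) → Unary.Decidable (Cylindrical {k = k} w)
cylindrical? w U = Fin.all? λ j → Fin.all? λ j′ →
  (consecutive? j j′ ⊎-dec lastFirst? j j′) →-dec (w (U j) Fin.≟ U j′)

------------------------------------------------------------------------
-- Planar networks and immanants

module _ (R : OrderedCommutativeRing c ℓ₁ ℓ₂) where

  open OrderedCommutativeRing R

  Matrix : ℕ → Set c
  Matrix n = Fin n → Fin n → Carrier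

  Imm : ((Fin n → Fin n) → Carrier) → Matrix n → Carrier
  Imm {n} θ A = ∑ (𝔖 n) λ w → θ w * ∏ (λ i → A i (w i))

  ψ : Partition n → (Fin n → Fin n) → Carrier
  ψ lam w = if does (List.≡-dec ℕ._≟_ (cycleType w) parts) then fromℕ z else 0#
    where open Partition lam

  record PlanarNetwork (n : ℕ) : Set (c ⊔ ℓ₂) where
    field
      digraph : Digraph

    open Digraph digraph public

    field
      acyclic            : Acyclic
      terminal           : Boundary n → Vertex
      terminal-injective : Injective _≡_ _≡_ terminal
      embedding          : DiscEmbedding digraph terminal
      source-indegree    : ∀ i e → head e ≢ terminal (s i)
      sink-outdegree     : ∀ i e → tail e ≢ terminal (t i)
      weight             : Edge → Carrier
      weight-nonNegative : ∀ e → 0# ≤ weight e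

    pathWeight : ∀ {u v} → Path u v → Carrier
    pathWeight ε             = 1#
    pathWeight ((e , _) ◅ p) = weight e * pathWeight p

    sourceSinkPaths : ∀ i j → List (Path (terminal (s i)) (terminal (t j)))
    sourceSinkPaths i j = paths (terminal (s i)) (terminal (t j))

    pathMatrix : Matrix n
    pathMatrix i j = ∑ (sourceSinkPaths i j) pathWeight

    -- Path families of type w.
    Family : (Fin n → Fin n) → Set
    Family w = ∀ i → Path (terminal (s i)) (terminal (t (w i)))

    families : ∀ w → List (Family w)
    families w = choices λ i → sourceSinkPaths i (w i)

    wgt : ∀ {w} → Family w → Carrier
    wgt π = ∏ (λ i → pathWeight (π i))

    -- The order of P(π), on indices.
    _⊢_<_ : Family id → Rel (Fin n) 0ℓ
    π ⊢ i < j = i <ᶠ j × ¬ Intersect (π i) (π j)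

    order? : ∀ π → Decidable (π ⊢_<_)
    order? π i j = (i Fin.<? j) ×-dec ¬? (intersect? (π i) (π j))

    #cyclicallyRowSemistrict : Partition n → Family id → ℕ
    #cyclicallyRowSemistrict lam π =
      # (λ U → Fin.all? λ i → cyclicallyRowSemistrict? (U i)) (tableaux lam)
      where open PTableaux (order? π)

    #recordFreeRowSemistrict : Partition n → Family id → ℕ
    #recordFreeRowSemistrict lam π =
      # (λ U → (Fin.all? λ i → recordFree? (U i)) ×-dec
               (Fin.all? λ i → rowSemistrict? (U i)))
        (tableaux lam)
      where open PTableaux (order? π)

    -- The path πᵢ of a family of type w has source index i and sink
    -- index w i.
    #cylindrical : Partition n → ∀ {w} → Family w → ℕ
    #cylindrical lam {w} π =
      # (λ U → Fin.all? λ i → cylindrical? w (U i)) (tableaux lam)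

module Submission where

open import Defs
open import Algebra.Bundles using (CommutativeRing)
import Algebra.Properties.CommutativeSemigroup as CommutativeSemigroupProperties
import Algebra.Properties.Ring as RingProperties
open import Data.Bool.Base using (Bool; true; false; if_then_else_; _∧_; _xor_)
import Data.Bool.Properties as Bool
open import Data.Empty using (⊥)
open import Data.Fin.Base using (Fin; zero; suc; toℕ; fromℕ<; punchIn; punchOut) renaming (_<_ to _<ᶠ_)
import Data.Fin.Properties as Fin
open import Data.List.Base as List
  using (List; []; _∷_; _++_; map; concat; concatMap; length; filter; allFin; tabulate; upTo)
open import Data.List.Membership.Propositional using (_∈_; _∉_; find)
import Data.List.Membership.Propositional.Properties as ∈
import Data.List.Properties as List
open import Data.List.Relation.Binary.Permutation.Propositional
  using (_↭_; refl; prep; swap; trans; ↭-refl; ↭-sym; ↭-reflexive)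
import Data.List.Relation.Binary.Permutation.Propositional.Properties as ↭
open import Data.List.Relation.Unary.All as All using (All; []; _∷_)
import Data.List.Relation.Unary.All.Properties as All
open import Data.List.Relation.Unary.AllPairs as AllPairs using (AllPairs; []; _∷_)
import Data.List.Relation.Unary.AllPairs.Properties as AllPairs
open import Data.List.Relation.Unary.Any as Any using (Any; here; there)
open import Data.List.Relation.Unary.Unique.Propositional using (Unique)
import Data.List.Relation.Unary.Unique.Propositional.Properties as Unique
open import Data.Maybe.Base using (just)
open import Data.Nat.Base as ℕ using (ℕ; zero; suc)
import Data.Nat.GeneralisedArithmetic as ℕ
import Data.Nat.Induction as ℕ
open import Data.Nat.ListAction using (sum; product)
import Data.Nat.ListAction.Properties as ListAction
import Data.Nat.Properties as ℕ
open import Data.Product.Base using (Σ; ∃; _×_; _,_; proj₁; proj₂; map₁; map₂)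
open import Data.Sum.Base using (_⊎_; inj₁; inj₂)
open import Data.Unit.Base using (⊤; tt)
open import Function.Base using (_∘_; id; case_of_)
open import Function.Bundles using (Equivalence)
import Induction.WellFounded as WF
open import Level using (Level; 0ℓ)
open import Relation.Binary.Construct.Closure.ReflexiveTransitive using (Star; ε; _◅_)
open import Relation.Binary.Construct.Closure.Symmetric using (SymClosure; fwd; bwd)
open import Relation.Binary.Construct.Closure.Transitive using (TransClosure; [_]; _∷_)
import Relation.Binary.Construct.Flip.EqAndOrd as Flip
import Relation.Binary.Construct.On as On
open import Relation.Binary.Core using (Rel)
open import Relation.Binary.Definitions using (Decidable; tri<; tri≈; tri>)
open import Relation.Binary.PropositionalEquality.Core as ≡ using (_≡_; _≢_)
open import Relation.Nullary.Decidable
  using (Dec; yes; no; does; dec-true; dec-false; ¬?; _×-dec_; _⊎-dec_)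
open import Relation.Nullary.Negation using (¬_; contradiction)
import Relation.Unary as Unary

-- Call the sum over the orderings u₁ … uₖ of a set of m(x,u₁) m(u₁,u₂) … m(uₖ,z)
-- the walk sum of the matrix m from x to z.  With the convolution of functions on
-- finite sets, expanding a determinant along the cycle through x reads
-- Dₓ det⁻ = - (walks x x ⋆ det⁻), so that the determinants of the principal
-- submatrices determine the walk sums.  All three counts of tableaux are
-- convolutions, over the rows, of sums of walk sums from x to x.
--
-- For the path matrix, the Lindström–Gessel–Viennot lemma expresses the determinants
-- as sums over the pairwise disjoint families of identity type, that is those for
-- which P(π) is a chain.  For every poset, the matrix with entries [x ≯ y], whose
-- closed walks are the cyclically row-semistrict rows, has determinant 1 on the
-- chains and 0 elsewhere.  Hence the walk sums of the path matrix are the sums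
-- over the path families of the walk sums of these 0-1 matrices.  Record-free
-- row-semistrict rows satisfy the same convolution equation as closed walks.
--
-- On the other side, a tableau is cylindrical for w when its rows are closed walks
-- of the permutation matrix of w, and there are z such tableaux if w has the right
-- cycle type.

-- The matrix - M is used because it makes signs uniform: the sign of a permutation of n indices
-- times (-1)^n is -1 to the number of its cycles, whatever their lengths. Hence one minus sign per
-- cycle. Determinants determine walk sums without any division: a function with value 1 at the
-- empty set can be cancelled from a convolution, over every commutative ring. The obstacle is that
-- tableaux and families do not match one by one. Record-free rows agree with closed walks only
-- after summation over the orderings of a set, and the walks of the 0-1 matrices agree with those
-- of the path matrix only after summation over families as well. What makes this sufficient is that
-- both summations respect convolution: choices over disjoint sets of indices are independent.
-- Planarity is used in one form: disjoint paths have their sources and their sinks in the same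
-- order. Since an embedding is given by rotations and an Euler characteristic, this rests on a
-- Jordan curve theorem over the field with two elements. For cylindrical tableaux the sum over
-- permutations is extended to all functions, whose values can be chosen independently.

private
  variable
    a b : Level
    A B : Set a

-- Removals, splittings and ordered selections of a list

picks : List A → List (A × List A)
picks []       = []
picks (x ∷ xs) = (x , xs) ∷ map (map₂ (x ∷_)) (picks xs)

splits : List A → List (List A × List A)
splits []       = ([] , []) ∷ []
splits (x ∷ xs) = map (map₁ (x ∷_)) (splits xs) ++ map (map₂ (x ∷_)) (splits xs)

arrangements : ℕ → List A → List (List A × List A)
arrangements zero    xs = ([] , xs) ∷ []
arrangements (suc k) xs =
  concatMap (λ (y , ys) → map (map₁ (y ∷_)) (arrangements k ys)) (picks xs)

picks-↭ : ∀ (xs : List A) {y ys} → (y , ys) ∈ picks xs → xs ↭ y ∷ ys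
picks-↭ (x ∷ xs) (here ≡.refl) = ↭-refl
picks-↭ (x ∷ xs) (there p) with ∈.∈-map⁻ _ p
... | _ , q , ≡.refl = trans (prep x (picks-↭ xs q)) (swap x _ ↭-refl)

splits-↭ : ∀ (xs : List A) {ys zs} → (ys , zs) ∈ splits xs → xs ↭ ys ++ zs
splits-↭ []       (here ≡.refl) = ↭-refl
splits-↭ (x ∷ xs) p with ∈.∈-++⁻ (map (map₁ (x ∷_)) (splits xs)) p
... | inj₁ q with ∈.∈-map⁻ _ q
...   | _ , r , ≡.refl = prep x (splits-↭ xs r)
splits-↭ (x ∷ xs) p | inj₂ q with ∈.∈-map⁻ _ q
...   | (ys , zs) , r , ≡.refl =
  trans (prep x (splits-↭ xs r)) (↭-sym (↭.shift x ys zs))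

arrangements-↭ : ∀ k (xs : List A) {ys zs} → (ys , zs) ∈ arrangements k xs → xs ↭ ys ++ zs
arrangements-↭ zero    xs (here ≡.refl) = ↭-refl
arrangements-↭ (suc k) xs p with ∈.∈-concatMap⁻ _ {xs = picks xs} p
... | q with find q
...   | (y , xs′) , r , q′ with ∈.∈-map⁻ _ q′
...     | _ , r′ , ≡.refl = trans (picks-↭ xs r) (prep y (arrangements-↭ k xs′ r′))

length-arrangement : ∀ k (xs : List A) {ys zs} → (ys , zs) ∈ arrangements k xs → length ys ≡ k
length-arrangement zero    xs (here ≡.refl) = ≡.refl
length-arrangement (suc k) xs p with ∈.∈-concatMap⁻ _ {xs = picks xs} p
... | q with find q
...   | (y , xs′) , r , q′ with ∈.∈-map⁻ _ q′
...     | _ , r′ , ≡.refl = ≡.cong suc (length-arrangement k xs′ r′)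

length-induction : ∀ {p} (P : List A → Set p) →
  (∀ xs → (∀ {ys} → length ys ℕ.< length xs → P ys) → P xs) → ∀ xs → P xs
length-induction P = WF.All.wfRec (On.wellFounded length ℕ.<-wellFounded) _ P

↭-∷⇒< : ∀ {xs ys : List A} {y} → xs ↭ y ∷ ys → length ys ℕ.< length xs
↭-∷⇒< p = ℕ.≤-reflexive (≡.sym (↭.↭-length p))

-- Finite sums and the convolution algebra

module Calculus {c ℓ₁ ℓ₂} (R : OrderedCommutativeRing c ℓ₁ ℓ₂) where

  open OrderedCommutativeRing R public using (∑; fromℕ; commutativeRing)
  open CommutativeRing commutativeRing public hiding (trans; refl; sym; reflexive; zero)
  open CommutativeRing commutativeRing public using ()
    renaming (trans to ≈-trans; refl to ≈-refl; sym to ≈-sym; reflexive to ≈-reflexive)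
  open RingProperties ring public
  open import Relation.Binary.Reasoning.Setoid setoid public hiding (start)
  module +S = CommutativeSemigroupProperties +-commutativeSemigroup
  module *S = CommutativeSemigroupProperties *-commutativeSemigroup

  ∑-cong : ∀ (xs : List A) {f g : A → Carrier} → (∀ {x} → x ∈ xs → f x ≈ g x) → ∑ xs f ≈ ∑ xs g
  ∑-cong []       h = ≈-refl
  ∑-cong (x ∷ xs) h = +-cong (h (here ≡.refl)) (∑-cong xs (h ∘ there))

  ∑-0 : ∀ (xs : List A) {f : A → Carrier} → (∀ {x} → x ∈ xs → f x ≈ 0#) → ∑ xs f ≈ 0#
  ∑-0 []       h = ≈-refl
  ∑-0 (x ∷ xs) h = ≈-trans (+-cong (h (here ≡.refl)) (∑-0 xs (h ∘ there))) (+-identityˡ 0#)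

  ∑-++ : ∀ (xs ys : List A) {f : A → Carrier} → ∑ (xs ++ ys) f ≈ ∑ xs f + ∑ ys f
  ∑-++ []       ys = ≈-sym (+-identityˡ _)
  ∑-++ (x ∷ xs) ys = ≈-trans (+-congˡ (∑-++ xs ys)) (≈-sym (+-assoc _ _ _))

  ∑-map : ∀ (xs : List A) {g : A → B} {f : B → Carrier} → ∑ (map g xs) f ≈ ∑ xs (f ∘ g)
  ∑-map []       = ≈-refl
  ∑-map (x ∷ xs) = +-congˡ (∑-map xs)

  ∑-concatMap : ∀ (xs : List A) {g : A → List B} {f : B → Carrier} →
                ∑ (concatMap g xs) f ≈ ∑ xs (λ x → ∑ (g x) f)
  ∑-concatMap []               = ≈-refl
  ∑-concatMap (x ∷ xs) {g} {f} = ≈-trans (∑-++ (g x) _) (+-congˡ (∑-concatMap xs))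

  ∑-+ : ∀ (xs : List A) {f g : A → Carrier} → ∑ xs (λ x → f x + g x) ≈ ∑ xs f + ∑ xs g
  ∑-+ []       = ≈-sym (+-identityˡ 0#)
  ∑-+ (x ∷ xs) = ≈-trans (+-congˡ (∑-+ xs)) (+S.interchange _ _ _ _)

  ∑-*ˡ : ∀ (xs : List A) {f : A → Carrier} r → ∑ xs (λ x → r * f x) ≈ r * ∑ xs f
  ∑-*ˡ []       r = ≈-sym (zeroʳ r)
  ∑-*ˡ (x ∷ xs) r = ≈-trans (+-congˡ (∑-*ˡ xs r)) (≈-sym (distribˡ r _ _))

  ∑-*ʳ : ∀ (xs : List A) {f : A → Carrier} r → ∑ xs (λ x → f x * r) ≈ ∑ xs f * r
  ∑-*ʳ []       r = ≈-sym (zeroˡ r)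
  ∑-*ʳ (x ∷ xs) r = ≈-trans (+-congˡ (∑-*ʳ xs r)) (≈-sym (distribʳ r _ _))

  ∑-neg : ∀ (xs : List A) {f : A → Carrier} → ∑ xs (λ x → - f x) ≈ - ∑ xs f
  ∑-neg []       = ≈-sym -0#≈0#
  ∑-neg (x ∷ xs) = ≈-trans (+-congˡ (∑-neg xs)) (-‿+-comm _ _)

  ∑-swap : ∀ (xs : List A) (ys : List B) {f : A → B → Carrier} →
           ∑ xs (λ x → ∑ ys (f x)) ≈ ∑ ys (λ y → ∑ xs (λ x → f x y))
  ∑-swap []       ys = ≈-sym (∑-0 ys (λ _ → ≈-refl))
  ∑-swap (x ∷ xs) ys = ≈-trans (+-congˡ (∑-swap xs ys)) (≈-sym (∑-+ ys))

  ∑-↭ : ∀ {xs ys : List A} {f : A → Carrier} → xs ↭ ys → ∑ xs f ≈ ∑ ys f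
  ∑-↭ refl         = ≈-refl
  ∑-↭ (prep x p)   = +-congˡ (∑-↭ p)
  ∑-↭ (swap x y p) = ≈-trans (+-congˡ (+-congˡ (∑-↭ p))) (+S.x∙yz≈y∙xz _ _ _)
  ∑-↭ (trans p q)  = ≈-trans (∑-↭ p) (∑-↭ q)

  ∑-picks-∷ : ∀ (x : A) xs {f : A → List A → Carrier} →
    ∑ (picks (x ∷ xs)) (λ (y , ys) → f y ys) ≈ f x xs + ∑ (picks xs) (λ (y , ys) → f y (x ∷ ys))
  ∑-picks-∷ x xs = +-congˡ (∑-map (picks xs))

  ∑-splits-∷ : ∀ (x : A) xs {f : List A → List A → Carrier} →
    ∑ (splits (x ∷ xs)) (λ (ys , zs) → f ys zs) ≈
    ∑ (splits xs) (λ (ys , zs) → f (x ∷ ys) zs) + ∑ (splits xs) (λ (ys , zs) → f ys (x ∷ zs))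
  ∑-splits-∷ x xs = ≈-trans (∑-++ (map (map₁ (x ∷_)) (splits xs)) _)
    (+-cong (∑-map (splits xs)) (∑-map (splits xs)))

  ∑-arrangements-suc : ∀ k (xs : List A) {f : List A → List A → Carrier} →
    ∑ (arrangements (suc k) xs) (λ (u , zs) → f u zs) ≈
    ∑ (picks xs) (λ (y , ys) → ∑ (arrangements k ys) (λ (u , zs) → f (y ∷ u) zs))
  ∑-arrangements-suc k xs =
    ≈-trans (∑-concatMap (picks xs)) (∑-cong (picks xs) (λ {(y , ys)} _ → ∑-map (arrangements k ys)))

  -- Both sides enumerate the ways to distribute `xs` over one distinguished element, a set `us` and
  -- a set `vs`.
  ∑-picks-splits : ∀ (xs : List A) {f : A → List A → List A → Carrier} →
    ∑ (picks xs) (λ (y , ys) → ∑ (splits ys) (λ (us , vs) → f y us vs)) ≈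
    ∑ (splits xs) (λ (us , vs) → ∑ (picks us) (λ (y , us′) → f y us′ vs))
  ∑-picks-splits []           = ≈-sym (+-identityˡ 0#)
  ∑-picks-splits (x ∷ xs) {f} = begin
    ∑ (picks (x ∷ xs)) (λ (y , ys) → ∑ (splits ys) (λ (us , vs) → f y us vs))
      ≈⟨ ∑-picks-∷ x xs ⟩
    s₀ + ∑ (picks xs) (λ (y , ys) → ∑ (splits (x ∷ ys)) (λ (us , vs) → f y us vs))
      ≈⟨ +-congˡ (≈-trans (∑-cong (picks xs) (λ {(y , ys)} _ → ∑-splits-∷ x ys)) (∑-+ (picks xs))) ⟩
    s₀ + (∑ (picks xs) (λ (y , ys) → ∑ (splits ys) (λ (us , vs) → f y (x ∷ us) vs)) +
          ∑ (picks xs) (λ (y , ys) → ∑ (splits ys) (λ (us , vs) → f y us (x ∷ vs))))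
      ≈⟨ +-congˡ (+-cong (∑-picks-splits xs) (∑-picks-splits xs)) ⟩
    s₀ + (∑ (splits xs) (λ (us , vs) → ∑ (picks us) (λ (y , us′) → f y (x ∷ us′) vs)) +
          ∑ (splits xs) (λ (us , vs) → ∑ (picks us) (λ (y , us′) → f y us′ (x ∷ vs))))
      ≈⟨ +-assoc _ _ _ ⟨
    s₀ + ∑ (splits xs) (λ (us , vs) → ∑ (picks us) (λ (y , us′) → f y (x ∷ us′) vs)) +
         ∑ (splits xs) (λ (us , vs) → ∑ (picks us) (λ (y , us′) → f y us′ (x ∷ vs)))
      ≈⟨ +-congʳ (≈-trans (≈-sym (∑-+ (splits xs)))
           (∑-cong (splits xs) (λ {(us , vs)} _ → ≈-sym (∑-picks-∷ x us)))) ⟩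
    ∑ (splits xs) (λ (us , vs) → ∑ (picks (x ∷ us)) (λ (y , us′) → f y us′ vs)) +
    ∑ (splits xs) (λ (us , vs) → ∑ (picks us) (λ (y , us′) → f y us′ (x ∷ vs)))
      ≈⟨ ∑-splits-∷ x xs ⟨
    ∑ (splits (x ∷ xs)) (λ (us , vs) → ∑ (picks us) (λ (y , us′) → f y us′ vs)) ∎
    where s₀ = ∑ (splits xs) (λ (us , vs) → f x us vs)

  -- Finite sets are represented by lists, and functions on sets by the functions on lists that are
  -- invariant under permutation.
  Symmetric : (List A → Carrier) → Set _
  Symmetric f = ∀ {xs ys} → xs ↭ ys → f xs ≈ f ys

  ∑-picks-resp-↭ : ∀ {f : A → List A → Carrier} → (∀ y → Symmetric (f y)) →
                   Symmetric (λ xs → ∑ (picks xs) (λ (y , ys) → f y ys))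
  ∑-picks-resp-↭ h refl                           = ≈-refl
  ∑-picks-resp-↭ {f = f} h (prep {xs} {ys} x p)   = ≈-trans (∑-picks-∷ x xs) (≈-trans
    (+-cong (h x p) (∑-picks-resp-↭ (λ y q → h y (prep x q)) p)) (≈-sym (∑-picks-∷ x ys)))
  ∑-picks-resp-↭ {f = f} h (swap {xs} {ys} x y p) = begin
    ∑ (picks (x ∷ y ∷ xs)) (λ (z , zs) → f z zs)
      ≈⟨ ≈-trans (∑-picks-∷ x (y ∷ xs)) (+-congˡ (∑-picks-∷ y xs)) ⟩
    f x (y ∷ xs) + (f y (x ∷ xs) + ∑ (picks xs) (λ (z , zs) → f z (x ∷ y ∷ zs)))
      ≈⟨ +-cong (h x (prep y p)) (+-cong (h y (prep x p)) (≈-trans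
           (∑-picks-resp-↭ (λ z q → h z (prep x (prep y q))) p)
           (∑-cong (picks ys) (λ {(z , zs)} _ → h z (swap x y ↭-refl))))) ⟩
    f x (y ∷ ys) + (f y (x ∷ ys) + ∑ (picks ys) (λ (z , zs) → f z (y ∷ x ∷ zs)))
      ≈⟨ +S.x∙yz≈y∙xz _ _ _ ⟩
    f y (x ∷ ys) + (f x (y ∷ ys) + ∑ (picks ys) (λ (z , zs) → f z (y ∷ x ∷ zs)))
      ≈⟨ ≈-trans (∑-picks-∷ y (x ∷ ys)) (+-congˡ (∑-picks-∷ x ys)) ⟨
    ∑ (picks (y ∷ x ∷ ys)) (λ (z , zs) → f z zs) ∎
  ∑-picks-resp-↭ h (trans p q) = ≈-trans (∑-picks-resp-↭ h p) (∑-picks-resp-↭ h q)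

  ∑-arrangements-resp-↭ : ∀ k {f : List A → List A → Carrier} → (∀ u → Symmetric (f u)) →
    Symmetric (λ xs → ∑ (arrangements k xs) (λ (u , zs) → f u zs))
  ∑-arrangements-resp-↭ zero    h p = +-congʳ (h [] p)
  ∑-arrangements-resp-↭ (suc k) h {xs} {ys} p = ≈-trans (∑-arrangements-suc k xs) (≈-trans
    (∑-picks-resp-↭ (λ y → ∑-arrangements-resp-↭ k (λ u → h (y ∷ u))) p)
    (≈-sym (∑-arrangements-suc k ys)))

  -- Convolution of functions on finite sets

  infixl 7 _⋆_
  infix  4 _≋_

  _≋_ : Rel (List A → Carrier) _
  f ≋ g = ∀ xs → f xs ≈ g xs

  _⋆_ : (List A → Carrier) → (List A → Carrier) → List A → Carrier
  (f ⋆ g) xs = ∑ (splits xs) (λ (ys , zs) → f ys * g zs)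

  δ : List A → Carrier
  δ []      = 1#
  δ (_ ∷ _) = 0#

  private
    variable
      f f′ g g′ h : List A → Carrier

  -- Adjoining an element is a derivation.
  ⋆-∷ : ∀ f g (x : A) xs → (f ⋆ g) (x ∷ xs) ≈ ((f ∘ (x ∷_)) ⋆ g) xs + (f ⋆ (g ∘ (x ∷_))) xs
  ⋆-∷ f g x xs = ∑-splits-∷ x xs

  ⋆-[] : ∀ (f g : List A → Carrier) → (f ⋆ g) [] ≈ f [] * g []
  ⋆-[] f g = +-identityʳ _

  ⋆-cong : f ≋ f′ → g ≋ g′ → f ⋆ g ≋ f′ ⋆ g′
  ⋆-cong p q xs = ∑-cong (splits xs) (λ {(ys , zs)} _ → *-cong (p ys) (q zs))

  ⋆-congˡ : g ≋ g′ → f ⋆ g ≋ f ⋆ g′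
  ⋆-congˡ = ⋆-cong (λ _ → ≈-refl)

  ⋆-congʳ : f ≋ f′ → f ⋆ g ≋ f′ ⋆ g
  ⋆-congʳ p = ⋆-cong p (λ _ → ≈-refl)

  ⋆-distribˡ : ∀ (f g h : List A → Carrier) → f ⋆ (λ xs → g xs + h xs) ≋ λ xs → (f ⋆ g) xs + (f ⋆ h) xs
  ⋆-distribˡ f g h xs = ≈-trans (∑-cong (splits xs) (λ _ → distribˡ _ _ _)) (∑-+ (splits xs))

  ⋆-distribʳ : ∀ (h f g : List A → Carrier) → (λ xs → f xs + g xs) ⋆ h ≋ λ xs → (f ⋆ h) xs + (g ⋆ h) xs
  ⋆-distribʳ h f g xs = ≈-trans (∑-cong (splits xs) (λ _ → distribʳ _ _ _)) (∑-+ (splits xs))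

  ⋆-negˡ : ∀ (f g : List A → Carrier) → (-_ ∘ f) ⋆ g ≋ -_ ∘ (f ⋆ g)
  ⋆-negˡ f g xs = ≈-trans (∑-cong (splits xs) (λ _ → ≈-sym (-‿distribˡ-* _ _))) (∑-neg (splits xs))

  ⋆-negʳ : ∀ (f g : List A → Carrier) → f ⋆ (-_ ∘ g) ≋ -_ ∘ (f ⋆ g)
  ⋆-negʳ f g xs = ≈-trans (∑-cong (splits xs) (λ _ → ≈-sym (-‿distribʳ-* _ _))) (∑-neg (splits xs))

  ⋆-scaleˡ : ∀ r (f g : List A → Carrier) → ((λ xs → r * f xs) ⋆ g) ≋ λ xs → r * (f ⋆ g) xs
  ⋆-scaleˡ r f g xs = ≈-trans (∑-cong (splits xs) (λ _ → *-assoc _ _ _)) (∑-*ˡ (splits xs) r)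

  ⋆-∑ˡ : ∀ (ys : List B) (f : B → List A → Carrier) g →
         (λ xs → ∑ ys (λ y → f y xs)) ⋆ g ≋ λ xs → ∑ ys (λ y → (f y ⋆ g) xs)
  ⋆-∑ˡ ys f g xs = ≈-trans (∑-cong (splits xs) (λ _ → ≈-sym (∑-*ʳ ys _))) (∑-swap (splits xs) ys)

  ⋆-comm : ∀ (f g : List A → Carrier) → f ⋆ g ≋ g ⋆ f
  ⋆-comm f g []       = +-congʳ (*-comm _ _)
  ⋆-comm f g (x ∷ xs) = begin
    (f ⋆ g) (x ∷ xs)                                 ≈⟨ ⋆-∷ f g x xs ⟩
    ((f ∘ (x ∷_)) ⋆ g) xs + (f ⋆ (g ∘ (x ∷_))) xs    ≈⟨ +-cong (⋆-comm _ g xs) (⋆-comm f _ xs) ⟩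
    (g ⋆ (f ∘ (x ∷_))) xs + ((g ∘ (x ∷_)) ⋆ f) xs    ≈⟨ +-comm _ _ ⟩
    ((g ∘ (x ∷_)) ⋆ f) xs + (g ⋆ (f ∘ (x ∷_))) xs    ≈⟨ ⋆-∷ g f x xs ⟨
    (g ⋆ f) (x ∷ xs)                                 ∎

  -- By the Leibniz rule, adjoining `x` to either side gives the same three terms, one for each
  -- factor that receives `x`. The induction runs over the set while the functions vary.
  ⋆-assoc : ∀ (f g h : List A → Carrier) → (f ⋆ g) ⋆ h ≋ f ⋆ (g ⋆ h)
  ⋆-assoc f g h []       = begin
    ((f ⋆ g) ⋆ h) []        ≈⟨ ≈-trans (⋆-[] (f ⋆ g) h) (*-congʳ (⋆-[] f g)) ⟩
    f [] * g [] * h []      ≈⟨ *-assoc _ _ _ ⟩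
    f [] * (g [] * h [])    ≈⟨ ≈-trans (⋆-[] f (g ⋆ h)) (*-congˡ (⋆-[] g h)) ⟨
    (f ⋆ (g ⋆ h)) []        ∎
  ⋆-assoc f g h (x ∷ xs) = begin
    ((f ⋆ g) ⋆ h) (x ∷ xs)
      ≈⟨ ⋆-∷ (f ⋆ g) h x xs ⟩
    (((f ⋆ g) ∘ (x ∷_)) ⋆ h) xs + ((f ⋆ g) ⋆ Dh) xs
      ≈⟨ +-congʳ (≈-trans (⋆-congʳ (⋆-∷ f g x) xs) (⋆-distribʳ h (Df ⋆ g) (f ⋆ Dg) xs)) ⟩
    ((Df ⋆ g) ⋆ h) xs + ((f ⋆ Dg) ⋆ h) xs + ((f ⋆ g) ⋆ Dh) xs
      ≈⟨ +-cong (+-cong (⋆-assoc Df g h xs) (⋆-assoc f Dg h xs)) (⋆-assoc f g Dh xs) ⟩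
    (Df ⋆ (g ⋆ h)) xs + (f ⋆ (Dg ⋆ h)) xs + (f ⋆ (g ⋆ Dh)) xs
      ≈⟨ +-assoc _ _ _ ⟩
    (Df ⋆ (g ⋆ h)) xs + ((f ⋆ (Dg ⋆ h)) xs + (f ⋆ (g ⋆ Dh)) xs)
      ≈⟨ +-congˡ (≈-trans (⋆-congˡ (⋆-∷ g h x) xs) (⋆-distribˡ f (Dg ⋆ h) (g ⋆ Dh) xs)) ⟨
    (Df ⋆ (g ⋆ h)) xs + (f ⋆ ((g ⋆ h) ∘ (x ∷_))) xs
      ≈⟨ ⋆-∷ f (g ⋆ h) x xs ⟨
    (f ⋆ (g ⋆ h)) (x ∷ xs) ∎
    where Df = f ∘ (x ∷_)
          Dg = g ∘ (x ∷_)
          Dh = h ∘ (x ∷_)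

  ⋆-identityˡ : ∀ (f : List A → Carrier) → δ ⋆ f ≋ f
  ⋆-identityˡ f []       = ≈-trans (⋆-[] δ f) (*-identityˡ _)
  ⋆-identityˡ f (x ∷ xs) = begin
    (δ ⋆ f) (x ∷ xs)                                          ≈⟨ ⋆-∷ δ f x xs ⟩
    ((λ _ → 0#) ⋆ f) xs + (δ ⋆ (f ∘ (x ∷_))) xs               ≈⟨ +-cong (∑-0 (splits xs) (λ _ → zeroˡ _)) (⋆-identityˡ _ xs) ⟩
    0# + f (x ∷ xs)                                           ≈⟨ +-identityˡ _ ⟩
    f (x ∷ xs)                                                ∎

  -- In every splitting other than `(xs , [])` the first part is shorter than `xs`.
  ⋆-top : ∀ (f g : List A → Carrier) xs → (∀ ys → length ys ℕ.< length xs → f ys ≈ 0#) →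
          (f ⋆ g) xs ≈ f xs * g []
  ⋆-top f g []       f≈0 = ⋆-[] f g
  ⋆-top f g (x ∷ xs) f≈0 = begin
    (f ⋆ g) (x ∷ xs)                                 ≈⟨ ⋆-∷ f g x xs ⟩
    ((f ∘ (x ∷_)) ⋆ g) xs + (f ⋆ (g ∘ (x ∷_))) xs    ≈⟨ +-cong
      (⋆-top (f ∘ (x ∷_)) g xs (λ ys ys<xs → f≈0 (x ∷ ys) (ℕ.s<s ys<xs)))
      (∑-0 (splits xs) (λ {(ys , zs)} p → ≈-trans (*-congʳ (f≈0 ys (bound {ys} {zs} (splits-↭ xs p)))) (zeroˡ _))) ⟩
    f (x ∷ xs) * g [] + 0#                           ≈⟨ +-identityʳ _ ⟩
    f (x ∷ xs) * g []                                ∎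
    where
    bound : ∀ {ys zs} → xs ↭ ys ++ zs → length ys ℕ.< suc (length xs)
    bound {ys} {zs} p = ℕ.s≤s (≡.subst (length ys ℕ.≤_)
      (≡.sym (≡.trans (↭.↭-length p) (List.length-++ ys))) (ℕ.m≤m+n _ _))

  -- On a smallest set where `f` and `f′` differ, the convolution of the difference with `g` would,
  -- by `⋆-top`, be the difference itself.
  ⋆-cancelʳ : ∀ (f f′ g : List A → Carrier) → g [] ≈ 1# → f ⋆ g ≋ f′ ⋆ g → f ≋ f′
  ⋆-cancelʳ f f′ g g[]≈1 p xs = x∙y⁻¹≈ε⇒x≈y (f xs) (f′ xs) (length-induction (λ ys → d ys ≈ 0#) vanishes xs)
    where
    d : List _ → Carrier
    d ys = f ys + - f′ ys
    d⋆g≈0 : ∀ ys → (d ⋆ g) ys ≈ 0#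
    d⋆g≈0 ys = ≈-trans (⋆-distribʳ g f (-_ ∘ f′) ys)
      (≈-trans (+-cong (p ys) (⋆-negˡ f′ g ys)) (-‿inverseʳ _))
    vanishes : ∀ ys → (∀ {zs} → length zs ℕ.< length ys → d zs ≈ 0#) → d ys ≈ 0#
    vanishes ys ih = begin
      d ys           ≈⟨ ≈-trans (*-congˡ g[]≈1) (*-identityʳ _) ⟨
      d ys * g []    ≈⟨ ⋆-top d g ys (λ _ → ih) ⟨
      (d ⋆ g) ys     ≈⟨ d⋆g≈0 ys ⟩
      0#             ∎

  δ-symmetric : Symmetric (δ {A = A})
  δ-symmetric {xs = []} {ys = []} p = ≈-refl
  δ-symmetric {xs = []} {ys = x ∷ ys} p = contradiction (↭-sym p) ↭.¬x∷xs↭[]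
  δ-symmetric {xs = x ∷ xs} {ys = []} p = contradiction p ↭.¬x∷xs↭[]
  δ-symmetric {xs = x ∷ xs} {ys = y ∷ ys} p = ≈-refl

  ⋆-symmetric : ∀ {f g : List A → Carrier} → Symmetric f → Symmetric g → Symmetric (f ⋆ g)
  ⋆-symmetric F G refl = ≈-refl
  ⋆-symmetric {f = f} {g} F G (prep {xs} {ys} x p) = ≈-trans (⋆-∷ f g x xs) (≈-trans
    (+-cong (⋆-symmetric (F ∘ prep x) G p) (⋆-symmetric F (G ∘ prep x) p)) (≈-sym (⋆-∷ f g x ys)))
  ⋆-symmetric {f = f} {g} F G (swap {xs} {ys} x y p) = begin
    (f ⋆ g) (x ∷ y ∷ xs)
      ≈⟨ ≈-trans (⋆-∷ f g x (y ∷ xs)) (+-cong (⋆-∷ fx g y xs) (⋆-∷ f gx y xs)) ⟩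
    (fxy ⋆ g) xs + (fx ⋆ gy) xs + ((fy ⋆ gx) xs + (f ⋆ gxy) xs)
      ≈⟨ +-cong (+-cong (≈-trans (⋆-symmetric (F ∘ prep x ∘ prep y) G p) (⋆-congʳ (λ _ → F (swap x y refl)) ys))
                        (⋆-symmetric (F ∘ prep x) (G ∘ prep y) p))
                (+-cong (⋆-symmetric (F ∘ prep y) (G ∘ prep x) p)
                        (≈-trans (⋆-symmetric F (G ∘ prep x ∘ prep y) p) (⋆-congˡ (λ _ → G (swap x y refl)) ys))) ⟩
    (fyx ⋆ g) ys + (fx ⋆ gy) ys + ((fy ⋆ gx) ys + (f ⋆ gyx) ys)
      ≈⟨ +S.interchange _ _ _ _ ⟩
    (fyx ⋆ g) ys + (fy ⋆ gx) ys + ((fx ⋆ gy) ys + (f ⋆ gyx) ys)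
      ≈⟨ ≈-trans (⋆-∷ f g y (x ∷ ys)) (+-cong (⋆-∷ fy g x ys) (⋆-∷ f gy x ys)) ⟨
    (f ⋆ g) (y ∷ x ∷ ys) ∎
    where fx  = f ∘ (x ∷_)
          fy  = f ∘ (y ∷_)
          gx  = g ∘ (x ∷_)
          gy  = g ∘ (y ∷_)
          fxy = fx ∘ (y ∷_)
          fyx = fy ∘ (x ∷_)
          gxy = gx ∘ (y ∷_)
          gyx = gy ∘ (x ∷_)
  ⋆-symmetric F G (trans p q) = ≈-trans (⋆-symmetric F G p) (⋆-symmetric F G q)

-- Sums over orderings, walk sums and determinants

module PermutationSums {c ℓ₁ ℓ₂} (R : OrderedCommutativeRing c ℓ₁ ℓ₂) where

  open Calculus R

  ∑perm : List A → (List A → Carrier) → Carrier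
  ∑perm xs ω = ∑ (arrangements (length xs) xs) (λ (u , _) → ω u)

  ∑perm-cong : ∀ (xs : List A) {ω ω′ : List A → Carrier} →
               (∀ {u} → xs ↭ u → ω u ≈ ω′ u) → ∑perm xs ω ≈ ∑perm xs ω′
  ∑perm-cong xs h = ∑-cong (arrangements (length xs) xs) λ {(u , zs)} p →
    h (complete (length-arrangement (length xs) xs p) (arrangements-↭ (length xs) xs p))
    where
    complete : ∀ {u zs} → length u ≡ length xs → xs ↭ u ++ zs → xs ↭ u
    complete {u} {[]}     |u| p = trans p (↭-reflexive (List.++-identityʳ u))
    complete {u} {z ∷ zs} |u| p = contradiction (ℕ.+-cancelˡ-≡ (length u) _ 0
      (≡.trans (≡.sym (≡.trans (↭.↭-length p) (List.length-++ u))) (≡.trans (≡.sym |u|) (≡.sym (ℕ.+-identityʳ _))))) λ ()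

  ∑perm-symmetric : ∀ (ω : List A → Carrier) → Symmetric (λ xs → ∑perm xs ω)
  ∑perm-symmetric ω {xs} {ys} p = ≈-trans
    (∑-arrangements-resp-↭ (length xs) (λ _ _ → ≈-refl) p)
    (≈-reflexive (≡.cong (λ k → ∑ (arrangements k ys) (λ (u , _) → ω u)) (↭.↭-length p)))

  -- The words are sorted by their first letter; the term with `δ` accounts for the empty word.
  ∑perm-step : ∀ (xs : List A) (ω : List A → Carrier) →
    ∑perm xs ω ≈ δ xs * ω [] + ∑ (picks xs) (λ (y , ys) → ∑perm ys (ω ∘ (y ∷_)))
  ∑perm-step []       ω = +-congʳ (≈-sym (*-identityˡ _))
  ∑perm-step (x ∷ xs) ω = begin
    ∑perm (x ∷ xs) ω
      ≈⟨ ∑-arrangements-suc (length xs) (x ∷ xs) ⟩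
    ∑ (picks (x ∷ xs)) (λ (y , ys) → ∑ (arrangements (length xs) ys) (λ (u , _) → ω (y ∷ u)))
      ≈⟨ ∑-cong (picks (x ∷ xs)) (λ {(y , ys)} p → ≈-reflexive (≡.cong
           (λ k → ∑ (arrangements k ys) (λ (u , _) → ω (y ∷ u)))
           (ℕ.suc-injective (↭.↭-length (picks-↭ (x ∷ xs) p))))) ⟩
    ∑ (picks (x ∷ xs)) (λ (y , ys) → ∑perm ys (ω ∘ (y ∷_)))
      ≈⟨ ≈-trans (+-congʳ (zeroˡ _)) (+-identityˡ _) ⟨
    0# * ω [] + ∑ (picks (x ∷ xs)) (λ (y , ys) → ∑perm ys (ω ∘ (y ∷_))) ∎

  ∑perm-* : ∀ (xs ys : List A) (φ χ : List A → Carrier) →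
            ∑perm xs (λ u → ∑perm ys (λ v → φ u * χ v)) ≈ ∑perm xs φ * ∑perm ys χ
  ∑perm-* xs ys φ χ = ≈-trans
    (∑-cong (arrangements (length xs) xs) (λ _ → ∑-*ˡ (arrangements (length ys) ys) _))
    (∑-*ʳ (arrangements (length xs) xs) _)

  -- The first letter of the word may be picked from the whole set before the rest is split between
  -- the word and `g`.
  ∑perm-⋆-step : ∀ (ω g : List A → Carrier) xs →
    ((λ us → ∑perm us ω) ⋆ g) xs ≈
    ω [] * g xs + ∑ (picks xs) (λ (y , ys) → ((λ us → ∑perm us (ω ∘ (y ∷_))) ⋆ g) ys)
  ∑perm-⋆-step ω g xs = begin
    ((λ us → ∑perm us ω) ⋆ g) xs
      ≈⟨ ⋆-congʳ (λ us → ∑perm-step us ω) xs ⟩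
    ((λ us → δ us * ω [] + rest us) ⋆ g) xs
      ≈⟨ ⋆-distribʳ g (λ us → δ us * ω []) rest xs ⟩
    ((λ us → δ us * ω []) ⋆ g) xs + (rest ⋆ g) xs
      ≈⟨ +-cong (≈-trans (⋆-congʳ (λ _ → *-comm _ _) xs) (≈-trans (⋆-scaleˡ (ω []) δ g xs) (*-congˡ (⋆-identityˡ g xs))))
                (≈-trans (∑-cong (splits xs) (λ {(us , _)} _ → ≈-sym (∑-*ʳ (picks us) _))) (≈-sym (∑-picks-splits xs))) ⟩
    ω [] * g xs + ∑ (picks xs) (λ (y , ys) → ((λ us → ∑perm us (ω ∘ (y ∷_))) ⋆ g) ys) ∎
    where rest = λ us → ∑ (picks us) (λ (y , ys) → ∑perm ys (ω ∘ (y ∷_)))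

  -- The words of x ∷ xs are cut at the letter x.
  ∑perm-∷ : ∀ (x : A) xs (ω : List A → Carrier) →
    ∑perm (x ∷ xs) ω ≈
    ∑ (splits xs) (λ (ys , zs) → ∑perm ys (λ u → ∑perm zs (λ v → ω (u ++ x ∷ v))))
  ∑perm-∷ {A = A} x = length-induction Cut cut
    where
    Cut : List A → Set _
    Cut xs = ∀ ω → ∑perm (x ∷ xs) ω ≈
      ∑ (splits xs) (λ (ys , zs) → ∑perm ys (λ u → ∑perm zs (λ v → ω (u ++ x ∷ v))))
    cut : ∀ xs → (∀ {ys} → length ys ℕ.< length xs → Cut ys) → Cut xs
    cut xs ih ω = begin
      ∑perm (x ∷ xs) ω
        ≈⟨ ≈-trans (∑perm-step (x ∷ xs) ω) (≈-trans (+-congʳ (zeroˡ _)) (+-identityˡ _)) ⟩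
      ∑ (picks (x ∷ xs)) (λ (y , ys) → ∑perm ys (ω ∘ (y ∷_)))
        ≈⟨ ∑-picks-∷ x xs ⟩
      first xs + ∑ (picks xs) (λ (y , ys) → ∑perm (x ∷ ys) (ω ∘ (y ∷_)))
        -- Writing `first` as a convolution with `δ` makes the words that begin with `x` the case of
        -- an empty left part, so that both summands become sums over splittings.
        ≈⟨ +-cong (≈-sym (⋆-identityˡ first xs)) (∑-cong (picks xs) (λ {(y , ys)} p → ih {ys} (↭-∷⇒< (picks-↭ xs p)) (ω ∘ (y ∷_)))) ⟩
      (δ ⋆ first) xs + ∑ (picks xs) (λ (y , ys) → ∑ (splits ys) (λ (us , vs) → cutAfter y us vs))
        ≈⟨ +-congˡ (∑-picks-splits xs) ⟩
      (δ ⋆ first) xs + ∑ (splits xs) (λ (us , vs) → ∑ (picks us) (λ (y , us′) → cutAfter y us′ vs))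
        ≈⟨ ∑-+ (splits xs) ⟨
      ∑ (splits xs) (λ (us , vs) → δ us * first vs + ∑ (picks us) (λ (y , us′) → cutAfter y us′ vs))
        ≈⟨ ∑-cong (splits xs) (λ {(us , vs)} _ → ∑perm-step us _) ⟨
      ∑ (splits xs) (λ (us , vs) → ∑perm us (λ u → ∑perm vs (λ v → ω (u ++ x ∷ v)))) ∎
      where
      first : List A → Carrier
      first vs = ∑perm vs (ω ∘ (x ∷_))
      cutAfter : A → List A → List A → Carrier
      cutAfter y us vs = ∑perm us (λ u → ∑perm vs (λ v → ω (y ∷ u ++ x ∷ v)))

  module _ {A : Set a} (M : A → A → Carrier) where

    walk : A → List A → A → Carrier
    walk x []      z = M x z
    walk x (y ∷ u) z = M x y * walk y u z

    walks : A → A → List A → Carrier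
    walks x z ys = ∑perm ys (λ u → walk x u z)

    walk-++ : ∀ x u y v z → walk x (u ++ y ∷ v) z ≈ walk x u y * walk y v z
    walk-++ x []       y v z = ≈-refl
    walk-++ x (x′ ∷ u) y v z = ≈-trans (*-congˡ (walk-++ x′ u y v z)) (≈-sym (*-assoc _ _ _))

    -- A walk that passes through `y` is cut there into two walks on disjoint sets; the derivative
    -- of a walk sum is thus again a convolution of walk sums.
    walks-∷ : ∀ x y z → walks x z ∘ (y ∷_) ≋ walks x y ⋆ walks y z
    walks-∷ x y z ys = ≈-trans (∑perm-∷ y ys _) (∑-cong (splits ys) λ {(us , vs)} _ →
      ≈-trans (∑perm-cong us (λ {u} _ → ∑perm-cong vs (λ {v} _ → walk-++ x u y v z)))
              (∑perm-* us vs (λ u → walk x u y) (λ v → walk y v z)))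

    walks-step : ∀ x z ys →
      walks x z ys ≈ δ ys * M x z + ∑ (picks ys) (λ (y , ys′) → M x y * walks y z ys′)
    walks-step x z ys = ≈-trans (∑perm-step ys _) (+-congˡ (∑-cong (picks ys)
      λ {(y , ys′)} _ → ∑-*ˡ (arrangements (length ys′) ys′) _))

    walks-symmetric : ∀ x z → Symmetric (walks x z)
    walks-symmetric x z = ∑perm-symmetric (λ u → walk x u z)

    -- The row of the initial vertex is read only at the first step.
    walks-row : ∀ {x x′} z ys → All (λ y → M x y ≈ M x′ y) (z ∷ ys) → walks x z ys ≈ walks x′ z ys
    walks-row {x} {x′} z ys (Mxz ∷ Mxys) = ∑perm-cong ys λ p → same (↭.All-resp-↭ p Mxys)
      where
      same : ∀ {u} → All (λ y → M x y ≈ M x′ y) u → walk x u z ≈ walk x′ u z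
      same []        = Mxz
      same (Mxy ∷ _) = *-congʳ Mxy

    -- det⁻ is the determinant of the submatrices of - M, expanded along the
    -- cycle through the first index.
    det⁻ₖ : ℕ → List A → Carrier
    det⁻ₖ zero    xs       = δ xs
    det⁻ₖ (suc k) []       = 1#
    det⁻ₖ (suc k) (x ∷ xs) = - (walks x x ⋆ det⁻ₖ k) xs

    det⁻ : List A → Carrier
    det⁻ xs = det⁻ₖ (length xs) xs

    -- The counter bounds the number of cycles, and each cycle uses up at least the index from which
    -- it is expanded.
    det⁻ₖ-stable : ∀ k k′ xs → length xs ℕ.≤ k → length xs ℕ.≤ k′ → det⁻ₖ k xs ≈ det⁻ₖ k′ xs
    det⁻ₖ-stable zero    zero     []       _ _ = ≈-refl
    det⁻ₖ-stable zero    (suc k′) []       _ _ = ≈-refl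
    det⁻ₖ-stable (suc k) zero     []       _ _ = ≈-refl
    det⁻ₖ-stable (suc k) (suc k′) []       _ _ = ≈-refl
    det⁻ₖ-stable (suc k) (suc k′) (x ∷ xs) (ℕ.s≤s l) (ℕ.s≤s l′) = -‿cong (∑-cong (splits xs)
      λ {(ys , zs)} p → *-congˡ (det⁻ₖ-stable k k′ zs (bound ys zs p l) (bound ys zs p l′)))
      where
      bound : ∀ {k} ys zs → (ys , zs) ∈ splits xs → length xs ℕ.≤ k → length zs ℕ.≤ k
      bound ys zs p = ℕ.≤-trans (≡.subst (length zs ℕ.≤_)
        (≡.sym (≡.trans (↭.↭-length (splits-↭ xs p)) (List.length-++ ys))) (ℕ.m≤n+m _ _))

    det⁻-∷ : ∀ x xs → det⁻ (x ∷ xs) ≈ - (walks x x ⋆ det⁻) xs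
    det⁻-∷ x xs = -‿cong (∑-cong (splits xs) λ {(ys , zs)} p →
      *-congˡ (det⁻ₖ-stable (length xs) (length zs) zs (≡.subst (length zs ℕ.≤_)
        (≡.sym (≡.trans (↭.↭-length (splits-↭ xs p)) (List.length-++ ys))) (ℕ.m≤n+m _ _)) ℕ.≤-refl))

    -- Either `y` lies on the cycle through `x` and cuts it into a walk to `y` and a walk back, or
    -- it is left to the other cycles.
    det⁻ₖ-∷∷ : ∀ k x y xs → det⁻ₖ (suc k) (x ∷ y ∷ xs) ≈
      - (((walks x y ⋆ walks y x) ⋆ det⁻ₖ k) xs + (walks x x ⋆ (det⁻ₖ k ∘ (y ∷_))) xs)
    det⁻ₖ-∷∷ k x y xs = -‿cong (≈-trans (⋆-∷ (walks x x) (det⁻ₖ k) y xs)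
      (+-congʳ (⋆-congʳ (walks-∷ x y x) xs)))

    -- One more expansion exhibits the two separate cycles, through `x` and through `y`, as
    -- commuting factors.
    det⁻ₖ-cross : ∀ k x y xs →
      (walks x x ⋆ (det⁻ₖ k ∘ (y ∷_))) xs ≈ (walks y y ⋆ (det⁻ₖ k ∘ (x ∷_))) xs
    det⁻ₖ-cross zero    x y xs = ≈-trans (∑-0 (splits xs) λ _ → zeroʳ _) (≈-sym (∑-0 (splits xs) λ _ → zeroʳ _))
    det⁻ₖ-cross (suc k) x y xs = begin
      (wx ⋆ (-_ ∘ (wy ⋆ D))) xs   ≈⟨ ⋆-negʳ wx (wy ⋆ D) xs ⟩
      - (wx ⋆ (wy ⋆ D)) xs        ≈⟨ -‿cong (⋆-assoc wx wy D xs) ⟨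
      - ((wx ⋆ wy) ⋆ D) xs        ≈⟨ -‿cong (⋆-congʳ (⋆-comm wx wy) xs) ⟩
      - ((wy ⋆ wx) ⋆ D) xs        ≈⟨ -‿cong (⋆-assoc wy wx D xs) ⟩
      - (wy ⋆ (wx ⋆ D)) xs        ≈⟨ ⋆-negʳ wy (wx ⋆ D) xs ⟨
      (wy ⋆ (-_ ∘ (wx ⋆ D))) xs   ∎
      where wx = walks x x
            wy = walks y y
            D  = det⁻ₖ k

    -- The expansion distinguishes the first index only, so the content lies in exchanging the first
    -- two: each of the two terms of `det⁻ₖ-∷∷` is symmetric in `x` and `y`.
    det⁻ₖ-symmetric : ∀ k → Symmetric (det⁻ₖ k)
    det⁻ₖ-symmetric zero    p           = δ-symmetric p
    det⁻ₖ-symmetric (suc k) refl        = ≈-refl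
    det⁻ₖ-symmetric (suc k) (prep x p)  =
      -‿cong (⋆-symmetric (walks-symmetric x x) (det⁻ₖ-symmetric k) p)
    det⁻ₖ-symmetric (suc k) (swap {xs} {ys} x y p) = begin
      det⁻ₖ (suc k) (x ∷ y ∷ xs)
        ≈⟨ -‿cong (⋆-symmetric (walks-symmetric x x) (det⁻ₖ-symmetric k) (prep y p)) ⟩
      det⁻ₖ (suc k) (x ∷ y ∷ ys)
        ≈⟨ det⁻ₖ-∷∷ k x y ys ⟩
      - (((walks x y ⋆ walks y x) ⋆ det⁻ₖ k) ys + (walks x x ⋆ (det⁻ₖ k ∘ (y ∷_))) ys)
        ≈⟨ -‿cong (+-cong (⋆-congʳ (⋆-comm (walks x y) (walks y x)) ys) (det⁻ₖ-cross k x y ys)) ⟩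
      - (((walks y x ⋆ walks x y) ⋆ det⁻ₖ k) ys + (walks y y ⋆ (det⁻ₖ k ∘ (x ∷_))) ys)
        ≈⟨ det⁻ₖ-∷∷ k y x ys ⟨
      det⁻ₖ (suc k) (y ∷ x ∷ ys) ∎
    det⁻ₖ-symmetric (suc k) (trans p q) =
      ≈-trans (det⁻ₖ-symmetric (suc k) p) (det⁻ₖ-symmetric (suc k) q)

    det⁻-symmetric : Symmetric det⁻
    det⁻-symmetric {xs} {ys} p = ≈-trans (det⁻ₖ-symmetric (length xs) p)
      (≈-reflexive (≡.cong (λ k → det⁻ₖ k ys) (↭.↭-length p)))

    -- Exchanging the continuations after `x` and after `y` turns one cycle through both into two
    -- separate cycles. With equal rows the weight is unchanged, while the number of cycles, and so
    -- the sign, changes.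
    det⁻-equalRows : ∀ {x y xs ys} → ys ↭ x ∷ y ∷ xs → All (λ z → M x z ≈ M y z) ys → det⁻ ys ≈ 0#
    det⁻-equalRows {x} {y} {xs} {ys} ys↭ eq = begin
      det⁻ ys
        ≈⟨ det⁻-symmetric ys↭ ⟩
      det⁻ (x ∷ y ∷ xs)
        ≈⟨ ≈-trans (det⁻-∷ x (y ∷ xs)) (-‿cong (⋆-∷ wxx det⁻ y xs)) ⟩
      - (((wxx ∘ (y ∷_)) ⋆ det⁻) xs + (wxx ⋆ (det⁻ ∘ (y ∷_))) xs)
        ≈⟨ -‿cong (+-cong (⋆-congʳ (walks-∷ x y x) xs)
             (≈-trans (⋆-congˡ (det⁻-∷ y) xs) (≈-trans (⋆-negʳ wxx (wyy ⋆ det⁻) xs)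
               (-‿cong (≈-sym (⋆-assoc wxx wyy det⁻ xs)))))) ⟩
      - (((wxy ⋆ wyx) ⋆ det⁻) xs + - ((wxx ⋆ wyy) ⋆ det⁻) xs)
        ≈⟨ -‿cong (+-congʳ (∑-cong (splits xs) λ {(us , vs)} p → *-congʳ (begin
             (wxy ⋆ wyx) us   ≈⟨ ∑-cong (splits us) (λ {(us′ , vs′)} q →
               let eqs = ↭.All-resp-↭ (splits-↭ us q) (All.++⁻ˡ us (↭.All-resp-↭ (splits-↭ xs p) eq₃))
               in *-cong (walks-row y us′ (eq₂ ∷ All.++⁻ˡ us′ eqs))
                         (≈-sym (walks-row x vs′ (eq₁ ∷ All.++⁻ʳ us′ eqs)))) ⟩
             (wyy ⋆ wxx) us   ≈⟨ ⋆-comm wyy wxx us ⟩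
             (wxx ⋆ wyy) us   ∎))) ⟩
      - (((wxx ⋆ wyy) ⋆ det⁻) xs + - ((wxx ⋆ wyy) ⋆ det⁻) xs)
        ≈⟨ ≈-trans (-‿cong (-‿inverseʳ _)) -0#≈0# ⟩
      0# ∎
      where
      wxx = walks x x
      wxy = walks x y
      wyx = walks y x
      wyy = walks y y
      eqs₀ = ↭.All-resp-↭ ys↭ eq
      eq₁ = All.head eqs₀
      eq₂ = All.head (All.tail eqs₀)
      eq₃ = All.tail (All.tail eqs₀)

-- Posets: chains, semistrict matrices and record-free rows

AllPairs-resp-↭ : ∀ {r} {_~_ : Rel A r} → (∀ {x y} → x ~ y → y ~ x) →
                  ∀ {xs ys} → xs ↭ ys → AllPairs _~_ xs → AllPairs _~_ ys
AllPairs-resp-↭ sym refl         ps                     = ps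
AllPairs-resp-↭ sym (prep x p)   (px ∷ ps)              = ↭.All-resp-↭ p px ∷ AllPairs-resp-↭ sym p ps
AllPairs-resp-↭ sym (swap x y p) ((xy ∷ px) ∷ py ∷ ps)  =
  (sym xy ∷ ↭.All-resp-↭ p py) ∷ ↭.All-resp-↭ p px ∷ AllPairs-resp-↭ sym p ps
AllPairs-resp-↭ sym (trans p q)  ps                     = AllPairs-resp-↭ sym q (AllPairs-resp-↭ sym p ps)

-- The reversed relation yields maximal elements, and a predicate that always holds yields minimal
-- elements of the whole list.
extract-minimal : ∀ {r p} {_≺_ : Rel A r} {P : Unary.Pred A p} →
  (∀ {x} → ¬ x ≺ x) → (∀ {x y z} → x ≺ y → y ≺ z → x ≺ z) → Decidable _≺_ → Unary.Decidable P →
  ∀ {xs} → Any P xs → ∃ λ y → ∃ λ ys → xs ↭ y ∷ ys × P y × All (λ z → P z → ¬ z ≺ y) ys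
extract-minimal {_≺_ = _≺_} {P} irrefl ≺-trans _≺?_ P? {x ∷ xs} any with Any.any? P? xs
... | no none with any
...   | here Px = x , xs , ↭-refl , Px , All.map (λ ¬Pz Pz → contradiction Pz ¬Pz) (All.¬Any⇒All¬ xs none)
...   | there some = contradiction some none
extract-minimal {_≺_ = _≺_} {P} irrefl ≺-trans _≺?_ P? {x ∷ xs} any | yes some
  with extract-minimal irrefl ≺-trans _≺?_ P? some
... | y , ys , p , Py , min with P? x ×-dec (x ≺? y)
...   | yes (Px , x≺y) = x , y ∷ ys , prep x p , Px , (λ _ y≺x → irrefl (≺-trans x≺y y≺x)) ∷
          All.map (λ h Pz z≺x → h Pz (≺-trans z≺x x≺y)) min
...   | no ¬x = y , x ∷ ys , trans (prep x p) (swap x y ↭-refl) , Py , (λ Px x≺y → ¬x (Px , x≺y)) ∷ min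

module Posets {c ℓ₁ ℓ₂} (R : OrderedCommutativeRing c ℓ₁ ℓ₂) where

  open Calculus R
  open PermutationSums R

  χ : ∀ {p} {P : Set p} → Dec P → Carrier
  χ P? = if does P? then 1# else 0#

  χ-yes : ∀ {p} {P : Set p} (P? : Dec P) → P → χ P? ≈ 1#
  χ-yes (yes _) Px = ≈-refl
  χ-yes (no ¬P) Px = contradiction Px ¬P

  χ-no : ∀ {p} {P : Set p} (P? : Dec P) → ¬ P → χ P? ≈ 0#
  χ-no (yes Px) ¬P = contradiction Px ¬P
  χ-no (no _)   ¬P = ≈-refl

  χ-cong : ∀ {p q} {P : Set p} {Q : Set q} (P? : Dec P) (Q? : Dec Q) → (P → Q) → (Q → P) → χ P? ≈ χ Q?
  χ-cong (yes Px) Q? f g = ≈-sym (χ-yes Q? (f Px))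
  χ-cong (no ¬P)  Q? f g = ≈-sym (χ-no Q? (¬P ∘ g))

  χ-× : ∀ {p q} {P : Set p} {Q : Set q} (P? : Dec P) (Q? : Dec Q) → χ (P? ×-dec Q?) ≈ χ P? * χ Q?
  χ-× (yes _) Q? = ≈-sym (*-identityˡ _)
  χ-× (no _)  Q? = ≈-sym (zeroˡ _)

  χ-* : ∀ {p} {P : Set p} (P? : Dec P) {x y} → (P → x ≈ y) → χ P? * x ≈ χ P? * y
  χ-* (yes Px) h = *-congˡ (h Px)
  χ-* (no _)   h = ≈-trans (zeroˡ _) (≈-sym (zeroˡ _))

  χ-absorb : ∀ {p} {P : Set p} (P? : Dec P) {x} → (¬ P → x ≈ 0#) → χ P? * x ≈ x
  χ-absorb (yes _) h = *-identityˡ _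
  χ-absorb (no ¬P) h = ≈-trans (zeroˡ _) (≈-sym (h ¬P))

  -- This is -1 to the number of elements, the factor between the determinants of M and of - M, and
  -- not the sign of an ordering.
  sgn : List A → Carrier
  sgn []       = 1#
  sgn (_ ∷ xs) = - sgn xs

  sgn-symmetric : Symmetric (sgn {A = A})
  sgn-symmetric refl         = ≈-refl
  sgn-symmetric (prep x p)   = -‿cong (sgn-symmetric p)
  sgn-symmetric (swap x y p) = -‿cong (-‿cong (sgn-symmetric p))
  sgn-symmetric (trans p q)  = ≈-trans (sgn-symmetric p) (sgn-symmetric q)

  -- The last step of a walk with intermediate vertices enters `z` from a member of `ys`, where the
  -- column of `z` vanishes.
  walks-column : ∀ (M : A → A → Carrier) x z ys → All (λ y → M y z ≈ 0#) ys →
                 walks M x z ys ≈ δ ys * M x z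
  walks-column M x z []       _  = ≈-trans (+-identityʳ _) (≈-sym (*-identityˡ _))
  walks-column M x z (y ∷ ys) h  = ≈-trans (≈-trans
    (∑perm-cong (y ∷ ys) λ p → ends x (↭.↭-length p) (↭.All-resp-↭ p h))
    (∑-0 (arrangements (suc (length ys)) (y ∷ ys)) λ _ → ≈-refl)) (≈-sym (zeroˡ _))
    where
    ends : ∀ x {k u} → suc k ≡ length u → All (λ y → M y z ≈ 0#) u → walk M x u z ≈ 0#
    ends x _ (h ∷ [])      = ≈-trans (*-congˡ h) (zeroʳ _)
    ends x _ (_ ∷ h ∷ hs)  = ≈-trans (*-congˡ (ends _ ≡.refl (h ∷ hs))) (zeroʳ _)

  module _ {A : Set a} {r} {_<_ : Rel A r} (_<?_ : Decidable _<_)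
           (<-irrefl : ∀ {x} → ¬ x < x) (<-trans : ∀ {x y z} → x < y → y < z → x < z) where

    semistrict : A → A → Carrier
    semistrict x y = χ (¬? (y <? x))

    Comparable : Rel A r
    Comparable x y = x < y ⊎ y < x

    comparable? : Decidable Comparable
    comparable? x y = (x <? y) ⊎-dec (y <? x)

    comparable-sym : ∀ {x y} → Comparable x y → Comparable y x
    comparable-sym (inj₁ x<y) = inj₂ x<y
    comparable-sym (inj₂ y<x) = inj₁ y<x

    Chain : List A → Set _
    Chain = AllPairs Comparable

    chain? : Unary.Decidable Chain
    chain? = AllPairs.allPairs? comparable?

    chain-resp-↭ : ∀ {xs ys} → xs ↭ ys → Chain xs → Chain ys
    chain-resp-↭ = AllPairs-resp-↭ comparable-sym

    χ-chain-symmetric : Symmetric (λ xs → χ (chain? xs))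
    χ-chain-symmetric {xs} {ys} p = χ-cong (chain? xs) (chain? ys) (chain-resp-↭ p) (chain-resp-↭ (↭-sym p))

    signedChain : List A → Carrier
    signedChain xs = sgn xs * χ (chain? xs)

    signedChain-symmetric : Symmetric signedChain
    signedChain-symmetric p = *-cong (sgn-symmetric p) (χ-chain-symmetric p)

    -- A unique minimal element has a trivial column, and two minimal
    -- elements have the same row.
    det⁻-semistrict : det⁻ semistrict ≋ signedChain
    det⁻-semistrict = length-induction (λ xs → det⁻ semistrict xs ≈ signedChain xs) peel
      where
      peel : ∀ xs → (∀ {ys} → length ys ℕ.< length xs → det⁻ semistrict ys ≈ signedChain ys) →
             det⁻ semistrict xs ≈ signedChain xs
      peel []       _  = ≈-sym (*-identityˡ _)
      peel (x ∷ xs) ih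
        with extract-minimal {P = λ z → z ≡ z} <-irrefl <-trans _<?_ (λ _ → yes ≡.refl) {x ∷ xs} (here ≡.refl)
      ... | m , ys , p , _ , min′ with All.all? (m <?_) ys
      ...   | yes below = begin
        det⁻ semistrict (x ∷ xs)                  ≈⟨ det⁻-symmetric semistrict p ⟩
        det⁻ semistrict (m ∷ ys)                  ≈⟨ det⁻-∷ semistrict m ys ⟩
        - (walks semistrict m m ⋆ det⁻ semistrict) ys  ≈⟨ -‿cong (∑-cong (splits ys) λ {(us , _)} q → *-congʳ
          (≈-trans (walks-column semistrict m m us (All.map (λ {y} m<y → χ-no (¬? (m <? y)) (λ ¬m<y → ¬m<y m<y))
                      (All.++⁻ˡ us (↭.All-resp-↭ (splits-↭ ys q) below))))
                   (≈-trans (*-congˡ (χ-yes (¬? (m <? m)) <-irrefl)) (*-identityʳ _)))) ⟩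
        - (δ ⋆ det⁻ semistrict) ys                ≈⟨ -‿cong (⋆-identityˡ _ ys) ⟩
        - det⁻ semistrict ys                      ≈⟨ -‿cong (ih {ys} (↭-∷⇒< p)) ⟩
        - signedChain ys                          ≈⟨ -‿distribˡ-* _ _ ⟩
        sgn (m ∷ ys) * χ (chain? ys)              ≈⟨ *-congˡ (χ-cong (chain? ys) (chain? (m ∷ ys)) (All.map inj₁ below ∷_) AllPairs.tail) ⟩
        signedChain (m ∷ ys)                      ≈⟨ signedChain-symmetric p ⟨
        signedChain (x ∷ xs)                      ∎
      -- An element minimal among those not above `m` is minimal altogether: anything below it would
      -- itself be not above `m`.
      ...   | no ¬below with extract-minimal <-irrefl <-trans _<?_ (λ z → ¬? (m <? z)) (All.¬All⇒Any¬ (m <?_) ys ¬below)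
      ...     | y , zs , q , ¬m<y , min″ = begin
        det⁻ semistrict (x ∷ xs)   ≈⟨ det⁻-equalRows semistrict p′ (↭.All-resp-↭ (↭-sym p′) rows) ⟩
        0#                         ≈⟨ zeroʳ _ ⟨
        sgn (x ∷ xs) * 0#          ≈⟨ *-congˡ (χ-no (chain? (x ∷ xs)) incomparable) ⟨
        signedChain (x ∷ xs)       ∎
        where
        p′ : x ∷ xs ↭ m ∷ y ∷ zs
        p′ = trans p (prep m q)
        ¬<m : All (λ z → ¬ z < m) (y ∷ zs)
        ¬<m = All.map (λ h → h ≡.refl) (↭.All-resp-↭ q min′)
        ¬<y : All (λ z → ¬ z < y) zs
        ¬<y = All.map (λ h z<y → h (λ m<z → ¬m<y (<-trans m<z z<y)) z<y) min″
        -- Nothing lies below `m` or below `y`, so both rows consist of ones.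
        row : ∀ {v z} → ¬ z < m → ¬ z < y → semistrict m z ≈ semistrict y z
        row {z = z} z≮m z≮y = ≈-trans (χ-yes (¬? (z <? m)) z≮m) (≈-sym (χ-yes (¬? (z <? y)) z≮y))
        rows : All (λ z → semistrict m z ≈ semistrict y z) (m ∷ y ∷ zs)
        rows = row {m} <-irrefl ¬m<y ∷ row {m} (All.head ¬<m) <-irrefl ∷
               All.zipWith (λ (z≮m , z≮y) → row {m} z≮m z≮y) (All.tail ¬<m , ¬<y)
        incomparable : ¬ Chain (x ∷ xs)
        incomparable ch with chain-resp-↭ p′ ch
        ... | (inj₁ m<y ∷ _) ∷ _ = ¬m<y m<y
        ... | (inj₂ y<m ∷ _) ∷ _ = All.head ¬<m y<m

    record? : ∀ (U : List A) y → Dec (All (_< y) U)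
    record? U y = All.all? (_<? y) U

    -- Continuations of a row whose last entry is x and whose entries are U.
    recordFreeSemistrict : A → List A → List A → Carrier
    recordFreeSemistrict x U []      = 1#
    recordFreeSemistrict x U (y ∷ u) =
      semistrict x y * χ (¬? (record? U y)) * recordFreeSemistrict y (y ∷ U) u

    -- Such a `y` cannot be the next entry of a row with entries `U` and last entry `x`: it would be
    -- a record or a descent.
    Blocked : A → List A → A → Set _
    Blocked x U y = All (_< y) U ⊎ y < x

    blocked? : ∀ x U → Unary.Decidable (Blocked x U)
    blocked? x U y = record? U y ⊎-dec (y <? x)

    blockedChain? : ∀ x U xs → Dec (Chain xs × All (Blocked x U) xs)
    blockedChain? x U xs = chain? xs ×-dec All.all? (blocked? x U) xs

    -- The closed form, proved in `recordFree-⋆`, of the continuations of a row convolved with the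
    -- determinant of the semistrict matrix.
    signedBlocked : A → List A → List A → Carrier
    signedBlocked x U xs = sgn xs * χ (blockedChain? x U xs)

    signedBlocked-symmetric : ∀ x U → Symmetric (signedBlocked x U)
    signedBlocked-symmetric x U {xs} {ys} p = *-cong (sgn-symmetric p)
      (χ-cong (blockedChain? x U xs) (blockedChain? x U ys)
        (λ (ch , bl) → chain-resp-↭ p ch , ↭.All-resp-↭ p bl)
        (λ (ch , bl) → chain-resp-↭ (↭-sym p) ch , ↭.All-resp-↭ (↭-sym p) bl))

    step : A → List A → A → List A → Carrier
    step x U y ys = semistrict x y * χ (¬? (record? U y)) * signedBlocked y (y ∷ U) ys

    step-blocked : ∀ {x U y} ys → Blocked x U y → step x U y ys ≈ 0#
    step-blocked {x} {U} {y} ys (inj₁ rec) = ≈-trans (*-congʳ (≈-trans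
      (*-congˡ (χ-no (¬? (record? U y)) (λ ¬rec → ¬rec rec))) (zeroʳ _))) (zeroˡ _)
    step-blocked {x} {U} {y} ys (inj₂ y<x) = ≈-trans (*-congʳ (≈-trans
      (*-congʳ (χ-no (¬? (y <? x)) (λ ¬y<x → ¬y<x y<x))) (zeroˡ _))) (zeroˡ _)

    -- In a chain only the topmost unblocked element can be the next letter.
    signedBlocked-recurrence : ∀ x U xs →
      signedChain xs + ∑ (picks xs) (λ (y , ys) → step x U y ys) ≈ signedBlocked x U xs
    signedBlocked-recurrence x U xs with All.all? (blocked? x U) xs
    ... | yes all = ≈-trans (+-congˡ (∑-0 (picks xs) λ {(y , ys)} p →
            step-blocked ys (All.head (↭.All-resp-↭ (picks-↭ xs p) all))))
          (≈-trans (+-identityʳ _) (*-congˡ (χ-cong (chain? xs) (chain? xs ×-dec yes all) (_, all) proj₁)))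
    ... | no ¬all with extract-minimal {_≺_ = λ y z → z < y} <-irrefl (λ p q → <-trans q p)
                         (λ y z → z <? y) (¬? ∘ blocked? x U) (All.¬All⇒Any¬ (blocked? x U) xs ¬all)
    ...   | y , ys , p , ¬bl , top = begin
      signedChain xs + ∑ (picks xs) (λ (z , zs) → step x U z zs)
        ≈⟨ +-cong (signedChain-symmetric p) (∑-picks-resp-↭ (λ z q → *-congˡ (signedBlocked-symmetric z (z ∷ U) q)) p) ⟩
      signedChain (y ∷ ys) + ∑ (picks (y ∷ ys)) (λ (z , zs) → step x U z zs)
        ≈⟨ +-cong (≈-sym (-‿distribˡ-* _ _)) (∑-picks-∷ y ys) ⟩
      - (sgn ys * χ (chain? (y ∷ ys))) + (step x U y ys + ∑ (picks ys) (λ (z , zs) → step x U z (y ∷ zs)))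
        ≈⟨ +-congˡ (+-cong (≈-trans (*-congʳ (≈-trans (*-cong (χ-yes (¬? (y <? x)) (¬bl ∘ inj₂))
              (χ-yes (¬? (record? U y)) (¬bl ∘ inj₁))) (*-identityˡ _))) (*-identityˡ _))
            (∑-0 (picks ys) λ {(z , zs)} q → others z zs (picks-↭ ys q))) ⟩
      - (sgn ys * χ (chain? (y ∷ ys))) + (signedBlocked y (y ∷ U) ys + 0#)
        ≈⟨ +-cong (-‿cong (*-congˡ (χ-cong (chain? (y ∷ ys)) (blockedChain? y (y ∷ U) ys) to from))) (+-identityʳ _) ⟩
      - signedBlocked y (y ∷ U) ys + signedBlocked y (y ∷ U) ys
        ≈⟨ -‿inverseˡ _ ⟩
      0#
        ≈⟨ zeroʳ _ ⟨
      sgn xs * 0#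
        ≈⟨ *-congˡ (χ-no (chain? xs ×-dec no ¬all) (¬all ∘ proj₂)) ⟨
      sgn xs * χ (chain? xs ×-dec no ¬all) ∎
      where
      -- If another unblocked `z` came next, `y` would stay behind unblocked: it is no record over
      -- `U` and, being topmost, does not lie below `z`.
      others : ∀ z zs → ys ↭ z ∷ zs → step x U z (y ∷ zs) ≈ 0#
      others z zs q with blocked? x U z
      ... | yes bl = step-blocked (y ∷ zs) bl
      ... | no ¬bl′ = ≈-trans (*-congˡ (≈-trans (*-congˡ (χ-no (blockedChain? z (z ∷ U) (y ∷ zs)) λ
              { (_ , inj₁ (_ ∷ rec) ∷ _) → ¬bl (inj₁ rec)
              ; (_ , inj₂ y<z ∷ _) → All.head (↭.All-resp-↭ q top) ¬bl′ y<z })) (zeroʳ _))) (zeroʳ _)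
      -- An element above the topmost unblocked `y` is blocked. It cannot be so by lying below `x`,
      -- since `y` would then lie below `x` too; hence it is a record over `U`, and also over
      -- `y ∷ U`.
      to : Chain (y ∷ ys) → Chain ys × All (Blocked y (y ∷ U)) ys
      to (cmp ∷ ch) = ch , All.zipWith (λ { {z} (inj₂ z<y , _) → inj₂ z<y ; {z} (inj₁ y<z , top) → above y<z top }) (cmp , top)
        where
        above : ∀ {z} → y < z → (¬ Blocked x U z → ¬ y < z) → Blocked y (y ∷ U) z
        above {z} y<z top with blocked? x U z
        ... | yes (inj₁ rec) = inj₁ (y<z ∷ rec)
        ... | yes (inj₂ z<x) = contradiction (inj₂ (<-trans y<z z<x)) ¬bl
        ... | no ¬bl′        = contradiction y<z (top ¬bl′)
      from : Chain ys × All (Blocked y (y ∷ U)) ys → Chain (y ∷ ys)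
      from (ch , bl) = All.map (λ { (inj₁ (y<z ∷ _)) → inj₁ y<z ; (inj₂ z<y) → inj₂ z<y }) bl ∷ ch

    recordFree-⋆ : ∀ x U →
      (λ xs → ∑perm xs (recordFreeSemistrict x U)) ⋆ det⁻ semistrict ≋ signedBlocked x U
    recordFree-⋆ x U xs = length-induction Peeled peel xs x U
      where
      Peeled : List A → Set _
      Peeled xs = ∀ x U → ((λ us → ∑perm us (recordFreeSemistrict x U)) ⋆ det⁻ semistrict) xs ≈ signedBlocked x U xs
      peel : ∀ xs → (∀ {ys} → length ys ℕ.< length xs → Peeled ys) → Peeled xs
      peel xs ih x U = begin
        ((λ us → ∑perm us (recordFreeSemistrict x U)) ⋆ det⁻ semistrict) xs
          ≈⟨ ∑perm-⋆-step (recordFreeSemistrict x U) (det⁻ semistrict) xs ⟩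
        1# * det⁻ semistrict xs + ∑ (picks xs) (λ (y , ys) →
          ((λ us → ∑perm us (λ u → semistrict x y * χ (¬? (record? U y)) * recordFreeSemistrict y (y ∷ U) u)) ⋆ det⁻ semistrict) ys)
          ≈⟨ +-cong (≈-trans (*-identityˡ _) (det⁻-semistrict xs)) (∑-cong (picks xs) λ {(y , ys)} p →
               ≈-trans (⋆-congʳ (λ us → ∑-*ˡ (arrangements (length us) us) _) ys)
               (≈-trans (⋆-scaleˡ _ (λ us → ∑perm us (recordFreeSemistrict y (y ∷ U))) (det⁻ semistrict) ys)
               (*-congˡ (ih {ys} (↭-∷⇒< (picks-↭ xs p)) y (y ∷ U))))) ⟩
        signedChain xs + ∑ (picks xs) (λ (y , ys) → step x U y ys)
          ≈⟨ signedBlocked-recurrence x U xs ⟩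
        signedBlocked x U xs ∎

    -- Convolution with the determinant gives the negative of the determinant of `x ∷ xs` on both
    -- sides. For the row consisting of `x` alone, being blocked means being comparable to `x`; for
    -- the walks this is the expansion along the cycle through `x`.
    recordFree≋walks : ∀ x → (λ xs → ∑perm xs (recordFreeSemistrict x (x ∷ []))) ≋ walks semistrict x x
    recordFree≋walks x = ⋆-cancelʳ _ _ (det⁻ semistrict) ≈-refl λ xs → begin
      ((λ us → ∑perm us (recordFreeSemistrict x (x ∷ []))) ⋆ det⁻ semistrict) xs
        ≈⟨ recordFree-⋆ x (x ∷ []) xs ⟩
      sgn xs * χ (blockedChain? x (x ∷ []) xs)
        ≈⟨ *-congˡ (χ-cong (blockedChain? x (x ∷ []) xs) (chain? (x ∷ xs)) to from) ⟩
      sgn xs * χ (chain? (x ∷ xs))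
        ≈⟨ *-congʳ (-‿involutive _) ⟨
      - - sgn xs * χ (chain? (x ∷ xs))
        ≈⟨ -‿distribˡ-* _ _ ⟨
      - signedChain (x ∷ xs)
        ≈⟨ -‿cong (det⁻-semistrict (x ∷ xs)) ⟨
      - det⁻ semistrict (x ∷ xs)
        ≈⟨ ≈-trans (-‿cong (det⁻-∷ semistrict x xs)) (-‿involutive _) ⟩
      (walks semistrict x x ⋆ det⁻ semistrict) xs ∎
      where
      to : ∀ {xs} → Chain xs × All (Blocked x (x ∷ [])) xs → Chain (x ∷ xs)
      to (ch , bl) = All.map (λ { (inj₁ (x<z ∷ _)) → inj₁ x<z ; (inj₂ z<x) → inj₂ z<x }) bl ∷ ch
      from : ∀ {xs} → Chain (x ∷ xs) → Chain xs × All (Blocked x (x ∷ [])) xs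
      from (cmp ∷ ch) = ch , All.map (λ { (inj₁ x<z) → inj₁ (x<z ∷ []) ; (inj₂ z<x) → inj₂ z<x }) cmp

-- Tableaux as convolutions over their rows

module TableauSums {c ℓ₁ ℓ₂} (R : OrderedCommutativeRing c ℓ₁ ℓ₂) where

  open Calculus R
  open PermutationSums R
  open Posets R

  -- Instead of letter by letter, a word of length `k` is obtained by choosing the set of its
  -- letters and then ordering it.
  ∑-arrangements-splits : ∀ k (xs : List A) (f : List A → List A → Carrier) →
    ∑ (arrangements k xs) (λ (u , zs) → f u zs) ≈
    ∑ (splits xs) (λ (ys , zs) → χ (length ys ℕ.≟ k) * ∑perm ys (λ u → f u zs))
  ∑-arrangements-splits zero    xs f = begin
    f [] xs + 0#        ≈⟨ +-identityʳ _ ⟩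
    f [] xs             ≈⟨ ⋆-identityˡ (f []) xs ⟨
    (δ ⋆ f []) xs       ≈⟨ ∑-cong (splits xs) (λ { {[] , zs} _ → *-congˡ (≈-sym (+-identityʳ _))
                                                 ; {_ ∷ _ , zs} _ → ≈-trans (zeroˡ _) (≈-sym (zeroˡ _)) }) ⟩
    ∑ (splits xs) (λ (ys , zs) → χ (length ys ℕ.≟ 0) * ∑perm ys (λ u → f u zs)) ∎
  ∑-arrangements-splits (suc k) xs f = begin
    ∑ (arrangements (suc k) xs) (λ (u , zs) → f u zs)
      ≈⟨ ∑-arrangements-suc k xs ⟩
    ∑ (picks xs) (λ (y , ys) → ∑ (arrangements k ys) (λ (u , zs) → f (y ∷ u) zs))
      ≈⟨ ∑-cong (picks xs) (λ {(y , ys)} _ → ∑-arrangements-splits k ys (f ∘ (y ∷_))) ⟩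
    ∑ (picks xs) (λ (y , ys) → ∑ (splits ys) (λ (us , zs) →
      χ (length us ℕ.≟ k) * ∑perm us (λ u → f (y ∷ u) zs)))
      ≈⟨ ∑-picks-splits xs ⟩
    ∑ (splits xs) (λ (ys , zs) → ∑ (picks ys) (λ (y , us) →
      χ (length us ℕ.≟ k) * ∑perm us (λ u → f (y ∷ u) zs)))
      ≈⟨ ∑-cong (splits xs) (λ {(ys , zs)} _ → regroup ys zs) ⟩
    ∑ (splits xs) (λ (ys , zs) → χ (length ys ℕ.≟ suc k) * ∑perm ys (λ u → f u zs)) ∎
    where
    regroup : ∀ ys zs →
      ∑ (picks ys) (λ (y , us) → χ (length us ℕ.≟ k) * ∑perm us (λ u → f (y ∷ u) zs)) ≈
      χ (length ys ℕ.≟ suc k) * ∑perm ys (λ u → f u zs)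
    regroup []       zs = ≈-sym (zeroˡ _)
    regroup (y ∷ ys) zs = begin
      ∑ (picks (y ∷ ys)) (λ (z , us) → χ (length us ℕ.≟ k) * ∑perm us (λ u → f (z ∷ u) zs))
        ≈⟨ ∑-cong (picks (y ∷ ys)) (λ {(z , us)} p → *-congʳ (χ-cong (length us ℕ.≟ k) (suc (length ys) ℕ.≟ suc k)
             (λ e → ≡.trans (↭.↭-length (picks-↭ (y ∷ ys) p)) (≡.cong suc e))
             (λ e → ℕ.suc-injective (≡.trans (≡.sym (↭.↭-length (picks-↭ (y ∷ ys) p))) e)))) ⟩
      ∑ (picks (y ∷ ys)) (λ (z , us) → χ (suc (length ys) ℕ.≟ suc k) * ∑perm us (λ u → f (z ∷ u) zs))
        ≈⟨ ∑-*ˡ (picks (y ∷ ys)) _ ⟩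
      χ (suc (length ys) ℕ.≟ suc k) * ∑ (picks (y ∷ ys)) (λ (z , us) → ∑perm us (λ u → f (z ∷ u) zs))
        ≈⟨ *-congˡ (≈-trans (∑perm-step (y ∷ ys) _) (≈-trans (+-congʳ (zeroˡ _)) (+-identityˡ _))) ⟨
      χ (suc (length ys) ℕ.≟ suc k) * ∑perm (y ∷ ys) (λ u → f u zs) ∎

  -- Each row takes its entries from what the preceding rows have left, and the final `δ` demands
  -- that nothing remains.
  tableauSum : (List A → Carrier) → List ℕ → List A → Carrier
  tableauSum ω []       xs = δ xs
  tableauSum ω (k ∷ ks) xs = ∑ (arrangements k xs) (λ (u , zs) → ω u * tableauSum ω ks zs)

  rowSum : (List A → Carrier) → ℕ → List A → Carrier
  rowSum ω k xs = χ (length xs ℕ.≟ k) * ∑perm xs ω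

  tableauSum-∷ : ∀ (ω : List A → Carrier) k ks →
    tableauSum ω (k ∷ ks) ≋ rowSum ω k ⋆ tableauSum ω ks
  tableauSum-∷ ω k ks xs = ≈-trans (∑-arrangements-splits k xs _) (∑-cong (splits xs)
    λ {(ys , zs)} _ → ≈-trans (*-congˡ (∑-*ʳ (arrangements (length ys) ys) _)) (≈-sym (*-assoc _ _ _)))

  tableauSum-symmetric : ∀ (ω : List A → Carrier) ks → Symmetric (tableauSum ω ks)
  tableauSum-symmetric ω []         = δ-symmetric
  tableauSum-symmetric ω (k ∷ ks) = ∑-arrangements-resp-↭ k (λ _ q → *-congˡ (tableauSum-symmetric ω ks q))

  -- Row weights matter only through their sums over the orderings of a set. This admits the
  -- exchange of record-free rows for closed walks without a bijection.
  tableauSum-cong : ∀ {ω ω′ : List A → Carrier} → (λ xs → ∑perm xs ω) ≋ (λ xs → ∑perm xs ω′) →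
                    ∀ ks → tableauSum ω ks ≋ tableauSum ω′ ks
  tableauSum-cong {ω = ω} {ω′} h []       xs = ≈-refl
  tableauSum-cong {ω = ω} {ω′} h (k ∷ ks) xs = ≈-trans (tableauSum-∷ ω k ks xs)
    (≈-trans (⋆-cong (λ ys → *-congˡ (h ys)) (tableauSum-cong h ks) xs) (≈-sym (tableauSum-∷ ω′ k ks xs)))

  module _ {A : Set a} {B : Set b} (g : A → B) where

    ∑-picks-map : ∀ xs {f : B → List B → Carrier} →
      ∑ (picks (map g xs)) (λ (y , ys) → f y ys) ≈ ∑ (picks xs) (λ (x , ys) → f (g x) (map g ys))
    ∑-picks-map []       = ≈-refl
    ∑-picks-map (x ∷ xs) = ≈-trans (∑-picks-∷ (g x) (map g xs))
      (≈-trans (+-congˡ (∑-picks-map xs)) (≈-sym (∑-picks-∷ x xs)))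

    ∑-arrangements-map : ∀ k xs {f : List B → List B → Carrier} →
      ∑ (arrangements k (map g xs)) (λ (u , zs) → f u zs) ≈
      ∑ (arrangements k xs) (λ (u , zs) → f (map g u) (map g zs))
    ∑-arrangements-map zero    xs = ≈-refl
    ∑-arrangements-map (suc k) xs = ≈-trans (∑-arrangements-suc k (map g xs)) (≈-trans
      (≈-trans (∑-picks-map xs) (∑-cong (picks xs) λ {(x , ys)} _ → ∑-arrangements-map k ys))
      (≈-sym (∑-arrangements-suc k xs)))

    tableauSum-map : ∀ (ω : List B → Carrier) ks xs →
      tableauSum (ω ∘ map g) ks xs ≈ tableauSum ω ks (map g xs)
    tableauSum-map ω []       []       = ≈-refl
    tableauSum-map ω []       (x ∷ xs) = ≈-refl
    tableauSum-map ω (k ∷ ks) xs = ≈-trans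
      (∑-cong (arrangements k xs) λ {(u , zs)} _ → *-congˡ (tableauSum-map ω ks zs))
      (≈-sym (∑-arrangements-map k xs))

  closedWalk : (A → A → Carrier) → List A → Carrier
  closedWalk M []      = 1#
  closedWalk M (x ∷ u) = walk M x u x

  ∑perm-closedWalk : ∀ (M : A → A → Carrier) xs →
    ∑perm xs (closedWalk M) ≈ δ xs + ∑ (picks xs) (λ (x , ys) → walks M x x ys)
  ∑perm-closedWalk M xs = ≈-trans (∑perm-step xs _) (+-congʳ (*-identityʳ _))

-- Summation over families and its compatibility with convolution

module Lifting {c ℓ₁ ℓ₂} (R : OrderedCommutativeRing c ℓ₁ ℓ₂) where

  open Calculus R
  open PermutationSums R
  open Posets R
  open TableauSums R

  module _ {X : Set a} {B : X → Set b} (fibre : ∀ x → List (B x)) (wt : ∀ {x} → B x → Carrier) where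

    -- Weighted sum over the choices of an element of the fibre over each
    -- member of a list.
    lift : (List (Σ X B) → Carrier) → List X → Carrier
    lift f []       = f []
    lift f (x ∷ xs) = ∑ (fibre x) (λ b → wt b * lift (λ ys → f ((x , b) ∷ ys)) xs)

    lift-cong : ∀ xs {f g} → (∀ {ys} → map proj₁ ys ≡ xs → f ys ≈ g ys) → lift f xs ≈ lift g xs
    lift-cong []       h = h {[]} ≡.refl
    lift-cong (x ∷ xs) h = ∑-cong (fibre x) λ {b} _ →
      *-congˡ (lift-cong xs λ p → h (≡.cong (x ∷_) p))

    lift-+ : ∀ xs {f g} → lift (λ ys → f ys + g ys) xs ≈ lift f xs + lift g xs
    lift-+ []       = ≈-refl
    lift-+ (x ∷ xs) = ≈-trans (∑-cong (fibre x) λ _ → ≈-trans (*-congˡ (lift-+ xs)) (distribˡ _ _ _)) (∑-+ (fibre x))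

    lift-*ˡ : ∀ xs r {f} → lift (λ ys → r * f ys) xs ≈ r * lift f xs
    lift-*ˡ []       r = ≈-refl
    lift-*ˡ (x ∷ xs) r = ≈-trans (∑-cong (fibre x) λ _ → ≈-trans (*-congˡ (lift-*ˡ xs r)) (*S.x∙yz≈y∙xz _ _ _))
                                 (∑-*ˡ (fibre x) r)

    lift-neg : ∀ xs {f} → lift (λ ys → - f ys) xs ≈ - lift f xs
    lift-neg []       = ≈-refl
    lift-neg (x ∷ xs) = ≈-trans (∑-cong (fibre x) λ _ → ≈-trans (*-congˡ (lift-neg xs)) (≈-sym (-‿distribʳ-* _ _)))
                                (∑-neg (fibre x))

    lift-0 : ∀ xs {f} → (∀ {ys} → map proj₁ ys ≡ xs → f ys ≈ 0#) → lift f xs ≈ 0#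
    lift-0 []       h = h {[]} ≡.refl
    lift-0 (x ∷ xs) h = ∑-0 (fibre x) λ _ → ≈-trans (*-congˡ (lift-0 xs λ p → h (≡.cong (x ∷_) p))) (zeroʳ _)

    lift-symmetric : ∀ {f} → Symmetric f → Symmetric (lift f)
    lift-symmetric h refl         = ≈-refl
    lift-symmetric h (prep x p)   = ∑-cong (fibre x) λ _ → *-congˡ (lift-symmetric (h ∘ prep _) p)
    lift-symmetric {f} h (swap {xs} {ys} x y p) = begin
      ∑ (fibre x) (λ b → wt b * ∑ (fibre y) (λ b′ → wt b′ * lift (λ zs → f ((x , b) ∷ (y , b′) ∷ zs)) xs))
        ≈⟨ ∑-cong (fibre x) (λ {b} _ → ≈-trans (≈-sym (∑-*ˡ (fibre y) (wt b)))
             (∑-cong (fibre y) λ {b′} _ → ≈-trans (*S.x∙yz≈y∙xz _ _ _) (*-congˡ (*-congˡ (≈-trans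
               (lift-symmetric (h ∘ prep _ ∘ prep _) p) (lift-cong ys λ _ → h (swap _ _ ↭-refl))))))) ⟩
      ∑ (fibre x) (λ b → ∑ (fibre y) (λ b′ → wt b′ * (wt b * lift (λ zs → f ((y , b′) ∷ (x , b) ∷ zs)) ys)))
        ≈⟨ ≈-trans (∑-swap (fibre x) (fibre y)) (∑-cong (fibre y) λ {b′} _ → ∑-*ˡ (fibre x) (wt b′)) ⟩
      ∑ (fibre y) (λ b′ → wt b′ * ∑ (fibre x) (λ b → wt b * lift (λ zs → f ((y , b′) ∷ (x , b) ∷ zs)) ys)) ∎
    lift-symmetric h (trans p q)  = ≈-trans (lift-symmetric h p) (lift-symmetric h q)

    -- The choices over the two parts of a splitting are independent. Formally, both sides obey the
    -- same Leibniz rule.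
    lift-⋆ : ∀ f g → lift (f ⋆ g) ≋ lift f ⋆ lift g
    lift-⋆ f g []       = ≈-refl
    lift-⋆ f g (x ∷ xs) = begin
      ∑ (fibre x) (λ b → wt b * lift (λ ys → (f ⋆ g) ((x , b) ∷ ys)) xs)
        ≈⟨ ∑-cong (fibre x) (λ {b} _ → ≈-trans (*-congˡ (≈-trans
             (lift-cong xs λ {ys} _ → ⋆-∷ f g (x , b) ys)
             (≈-trans (lift-+ xs) (+-cong (lift-⋆ (f ∘ ((x , b) ∷_)) g xs) (lift-⋆ f (g ∘ ((x , b) ∷_)) xs)))))
             (distribˡ _ _ _)) ⟩
      ∑ (fibre x) (λ b → wt b * (lift (f ∘ ((x , b) ∷_)) ⋆ lift g) xs + wt b * (lift f ⋆ lift (g ∘ ((x , b) ∷_))) xs)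
        ≈⟨ ∑-+ (fibre x) ⟩
      ∑ (fibre x) (λ b → wt b * (lift (f ∘ ((x , b) ∷_)) ⋆ lift g) xs) +
      ∑ (fibre x) (λ b → wt b * (lift f ⋆ lift (g ∘ ((x , b) ∷_))) xs)
        ≈⟨ +-cong (≈-sym (head-⋆ f (lift g))) (≈-trans
             (∑-cong (fibre x) λ _ → *-congˡ (⋆-comm (lift f) _ xs))
             (≈-trans (≈-sym (head-⋆ g (lift f))) (⋆-comm (lift g ∘ (x ∷_)) (lift f) xs))) ⟩
      ((lift f ∘ (x ∷_)) ⋆ lift g) xs + (lift f ⋆ (lift g ∘ (x ∷_))) xs
        ≈⟨ ⋆-∷ (lift f) (lift g) x xs ⟨
      (lift f ⋆ lift g) (x ∷ xs) ∎
      where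
      head-⋆ : ∀ f h → ((lift f ∘ (x ∷_)) ⋆ h) xs ≈ ∑ (fibre x) (λ b → wt b * (lift (f ∘ ((x , b) ∷_)) ⋆ h) xs)
      head-⋆ f h = ≈-trans (⋆-∑ˡ (fibre x) _ h xs) (∑-cong (fibre x) λ _ → ⋆-scaleˡ _ _ h xs)

    -- The choice over the picked index is made first; the choices over the other indices do not
    -- depend on it.
    lift-picks : ∀ xs {f : Σ X B → List (Σ X B) → Carrier} →
      lift (λ ys → ∑ (picks ys) (λ (y , zs) → f y zs)) xs ≈
      ∑ (picks xs) (λ (x , zs) → ∑ (fibre x) (λ b → wt b * lift (f (x , b)) zs))
    lift-picks []           = ≈-refl
    lift-picks (x ∷ xs) {f} = begin
      ∑ (fibre x) (λ b → wt b * lift (λ ys → ∑ (picks ((x , b) ∷ ys)) (λ (y , zs) → f y zs)) xs)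
        ≈⟨ ∑-cong (fibre x) (λ {b} _ → ≈-trans (*-congˡ (≈-trans
             (lift-cong xs λ {ys} _ → ∑-picks-∷ (x , b) ys) (≈-trans (lift-+ xs) (+-congˡ (lift-picks xs)))))
             (distribˡ _ _ _)) ⟩
      ∑ (fibre x) (λ b → wt b * lift (f (x , b)) xs + wt b * ∑ (picks xs) (λ (x′ , zs) →
        ∑ (fibre x′) (λ b′ → wt b′ * lift (λ us → f (x′ , b′) ((x , b) ∷ us)) zs)))
        ≈⟨ ≈-trans (∑-+ (fibre x)) (+-congˡ exchange) ⟩
      ∑ (fibre x) (λ b → wt b * lift (f (x , b)) xs) + ∑ (picks xs) (λ (x′ , zs) →
        ∑ (fibre x′) (λ b′ → wt b′ * lift (f (x′ , b′)) (x ∷ zs)))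
        ≈⟨ ∑-picks-∷ x xs ⟨
      ∑ (picks (x ∷ xs)) (λ (x , zs) → ∑ (fibre x) (λ b → wt b * lift (f (x , b)) zs)) ∎
      where
      exchange = begin
        ∑ (fibre x) (λ b → wt b * ∑ (picks xs) (λ (x′ , zs) →
          ∑ (fibre x′) (λ b′ → wt b′ * lift (λ us → f (x′ , b′) ((x , b) ∷ us)) zs)))
          ≈⟨ ∑-cong (fibre x) (λ {b} _ → ≈-trans (≈-sym (∑-*ˡ (picks xs) (wt b))) (∑-cong (picks xs) λ {(x′ , zs)} _ →
               ≈-trans (≈-sym (∑-*ˡ (fibre x′) (wt b))) (∑-cong (fibre x′) λ _ → *S.x∙yz≈y∙xz _ _ _))) ⟩
        ∑ (fibre x) (λ b → ∑ (picks xs) (λ (x′ , zs) →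
          ∑ (fibre x′) (λ b′ → wt b′ * (wt b * lift (λ us → f (x′ , b′) ((x , b) ∷ us)) zs))))
          ≈⟨ ∑-swap (fibre x) (picks xs) ⟩
        ∑ (picks xs) (λ (x′ , zs) → ∑ (fibre x) (λ b →
          ∑ (fibre x′) (λ b′ → wt b′ * (wt b * lift (λ us → f (x′ , b′) ((x , b) ∷ us)) zs))))
          ≈⟨ ∑-cong (picks xs) (λ {(x′ , zs)} _ → ≈-trans (∑-swap (fibre x) (fibre x′))
               (∑-cong (fibre x′) λ _ → ∑-*ˡ (fibre x) _)) ⟩
        ∑ (picks xs) (λ (x′ , zs) → ∑ (fibre x′) (λ b′ → wt b′ * lift (f (x′ , b′)) (x ∷ zs))) ∎

    lift-δ : lift δ ≋ δ
    lift-δ []       = ≈-refl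
    lift-δ (x ∷ xs) = ∑-0 (fibre x) λ _ → ≈-trans (*-congˡ (lift-0 xs λ _ → ≈-refl)) (zeroʳ _)

    lift-tableauSum : ∀ {ω : List (Σ X B) → Carrier} {ω′ : List X → Carrier} →
      lift (λ ys → ∑perm ys ω) ≋ (λ xs → ∑perm xs ω′) →
      ∀ ks → lift (tableauSum ω ks) ≋ tableauSum ω′ ks
    lift-tableauSum h []       xs = lift-δ xs
    lift-tableauSum {ω} {ω′} h (k ∷ ks) xs = begin
      lift (tableauSum ω (k ∷ ks)) xs                 ≈⟨ lift-cong xs (λ {ys} _ → tableauSum-∷ ω k ks ys) ⟩
      lift (rowSum ω k ⋆ tableauSum ω ks) xs          ≈⟨ lift-⋆ _ _ xs ⟩
      (lift (rowSum ω k) ⋆ lift (tableauSum ω ks)) xs ≈⟨ ⋆-cong row (lift-tableauSum h ks) xs ⟩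
      (rowSum ω′ k ⋆ tableauSum ω′ ks) xs             ≈⟨ tableauSum-∷ ω′ k ks xs ⟨
      tableauSum ω′ (k ∷ ks) xs                       ∎
      where
      row : lift (rowSum ω k) ≋ rowSum ω′ k
      row xs = ≈-trans (lift-cong xs λ {ys} p → *-congʳ (≈-reflexive (≡.cong (λ l → χ (l ℕ.≟ k))
        (≡.trans (≡.sym (List.length-map proj₁ ys)) (≡.cong length p)))))
        (≈-trans (lift-*ˡ xs _) (*-congˡ (h xs)))

    module _ (M : X → X → Carrier) (N : Σ X B → Σ X B → Carrier) where

      -- The base point `x` of a closed walk is not among the intermediate indices `xs`, so its own
      -- choice is summed separately.
      LiftedWalks : Set _
      LiftedWalks = ∀ x → (λ xs → ∑ (fibre x) (λ b → wt b * lift (walks N (x , b) (x , b)) xs)) ≋ walks M x x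

      lift-closedWalk : LiftedWalks → lift (λ ys → ∑perm ys (closedWalk N)) ≋ (λ xs → ∑perm xs (closedWalk M))
      lift-closedWalk h xs = begin
        lift (λ ys → ∑perm ys (closedWalk N)) xs
          ≈⟨ lift-cong xs (λ {ys} _ → ∑perm-closedWalk N ys) ⟩
        lift (λ ys → δ ys + ∑ (picks ys) (λ (y , zs) → walks N y y zs)) xs
          ≈⟨ ≈-trans (lift-+ xs) (+-cong (lift-δ xs) (lift-picks xs)) ⟩
        δ xs + ∑ (picks xs) (λ (x , zs) → ∑ (fibre x) (λ b → wt b * lift (walks N (x , b) (x , b)) zs))
          ≈⟨ +-congˡ (∑-cong (picks xs) λ {(x , zs)} _ → h x zs) ⟩
        δ xs + ∑ (picks xs) (λ (x , zs) → walks M x x zs)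
          ≈⟨ ∑perm-closedWalk M xs ⟨
        ∑perm xs (closedWalk M) ∎

      -- Lifting the expansion along the cycle through `x` gives a convolution with `det⁻ M` on both
      -- sides; its value at the empty list is 1, so it can be cancelled.
      det⁻⇒LiftedWalks : lift (det⁻ N) ≋ det⁻ M → LiftedWalks
      det⁻⇒LiftedWalks h x = ⋆-cancelʳ W (walks M x x) (det⁻ M) ≈-refl λ xs →
        -‿injective (begin
          - (W ⋆ det⁻ M) xs
            ≈⟨ -‿cong (≈-trans (⋆-∑ˡ (fibre x) _ (det⁻ M) xs) (∑-cong (fibre x) λ _ → ⋆-scaleˡ _ _ (det⁻ M) xs)) ⟩
          - ∑ (fibre x) (λ b → wt b * (lift (walks N (x , b) (x , b)) ⋆ det⁻ M) xs)
            ≈⟨ ∑-neg (fibre x) ⟨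
          ∑ (fibre x) (λ b → - (wt b * (lift (walks N (x , b) (x , b)) ⋆ det⁻ M) xs))
            ≈⟨ ∑-cong (fibre x) (λ {b} _ → ≈-trans (-‿distribʳ-* _ _) (*-congˡ (-‿cong (≈-trans
                 (⋆-congˡ (λ ys → ≈-sym (h ys)) xs) (≈-sym (lift-⋆ _ _ xs)))))) ⟩
          ∑ (fibre x) (λ b → wt b * - lift (walks N (x , b) (x , b) ⋆ det⁻ N) xs)
            ≈⟨ ∑-cong (fibre x) (λ {b} _ → *-congˡ (≈-trans (≈-sym (lift-neg xs))
                 (lift-cong xs λ {ys} _ → ≈-sym (det⁻-∷ N (x , b) ys)))) ⟩
          lift (det⁻ N) (x ∷ xs)
            ≈⟨ h (x ∷ xs) ⟩
          det⁻ M (x ∷ xs)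
            ≈⟨ det⁻-∷ M x xs ⟩
          - (walks M x x ⋆ det⁻ M) xs ∎)
        where
        W = λ xs → ∑ (fibre x) (λ b → wt b * lift (walks N (x , b) (x , b)) xs)

-- Parities and spanning forests

parity : List A → (A → Bool) → Bool
parity []       f = false
parity (x ∷ xs) f = f x xor parity xs f

open CommutativeSemigroupProperties (CommutativeRing.+-commutativeSemigroup Bool.xor-∧-commutativeRing)
  using () renaming (interchange to xor-interchange)

parity-cong : ∀ (xs : List A) {f g : A → Bool} → (∀ {x} → x ∈ xs → f x ≡ g x) → parity xs f ≡ parity xs g
parity-cong []       h = ≡.refl
parity-cong (x ∷ xs) h = ≡.cong₂ _xor_ (h (here ≡.refl)) (parity-cong xs (h ∘ there))

parity-false : ∀ (xs : List A) {f : A → Bool} → (∀ {x} → x ∈ xs → f x ≡ false) → parity xs f ≡ false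
parity-false []       h = ≡.refl
parity-false (x ∷ xs) h = ≡.cong₂ _xor_ (h (here ≡.refl)) (parity-false xs (h ∘ there))

parity-xor : ∀ (xs : List A) {f g : A → Bool} → parity xs (λ x → f x xor g x) ≡ parity xs f xor parity xs g
parity-xor []               = ≡.refl
parity-xor (x ∷ xs) {f} {g} = ≡.trans (≡.cong ((f x xor g x) xor_) (parity-xor xs))
  (xor-interchange (f x) (g x) _ _)

parity-++ : ∀ (xs ys : List A) {f : A → Bool} → parity (xs ++ ys) f ≡ parity xs f xor parity ys f
parity-++ []       ys     = ≡.refl
parity-++ (x ∷ xs) ys {f} = ≡.trans (≡.cong (f x xor_) (parity-++ xs ys)) (≡.sym (Bool.xor-assoc (f x) _ _))

parity-map : ∀ (xs : List A) {g : A → B} {f : B → Bool} → parity (map g xs) f ≡ parity xs (f ∘ g)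
parity-map []               = ≡.refl
parity-map (x ∷ xs) {g} {f} = ≡.cong (f (g x) xor_) (parity-map xs)

parity-↭ : ∀ {xs ys : List A} {f : A → Bool} → xs ↭ ys → parity xs f ≡ parity ys f
parity-↭ refl                 = ≡.refl
parity-↭ {f = f} (prep x p)   = ≡.cong (f x xor_) (parity-↭ p)
parity-↭ {f = f} (swap {xs} {ys} x y p) = ≡.trans (≡.cong (λ b → f x xor (f y xor b)) (parity-↭ p))
  (xor-interchange false (f x) (f y) (parity ys f))
parity-↭ (trans p q)          = ≡.trans (parity-↭ p) (parity-↭ q)

parity-swap : ∀ (xs : List A) (ys : List B) {f : A → B → Bool} →
              parity xs (λ x → parity ys (f x)) ≡ parity ys (λ y → parity xs (λ x → f x y))
parity-swap []       ys     = ≡.sym (parity-false ys (λ _ → ≡.refl))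
parity-swap (x ∷ xs) ys {f} = ≡.trans (≡.cong (parity ys (f x) xor_) (parity-swap xs ys)) (≡.sym (parity-xor ys))

parity-∧ : ∀ (xs : List A) {f : A → Bool} b → parity xs (λ x → f x ∧ b) ≡ parity xs f ∧ b
parity-∧ []           b = ≡.refl
parity-∧ (x ∷ xs) {f} b = ≡.trans (≡.cong ((f x ∧ b) xor_) (parity-∧ xs b)) (≡.sym (Bool.∧-distribʳ-xor b (f x) _))

module _ {k} (i j : Fin (suc k)) (j≢i : j ≢ i) where

  merge : Fin (suc k) → Fin k
  merge y with j Fin.≟ y
  ... | yes _   = punchOut j≢i
  ... | no  j≢y = punchOut j≢y

  merge-punchIn : ∀ c → merge (punchIn j c) ≡ c
  merge-punchIn c with j Fin.≟ punchIn j c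
  ... | yes j≡ = contradiction (≡.sym j≡) (Fin.punchInᵢ≢i j c)
  ... | no  j≢ = ≡.trans (Fin.punchOut-cong j ≡.refl) (Fin.punchOut-punchIn j)

  merge-glues : merge i ≡ merge j
  merge-glues with j Fin.≟ i | j Fin.≟ j
  ... | yes j≡i | _       = contradiction j≡i j≢i
  ... | no  _   | yes _   = Fin.punchOut-cong j ≡.refl
  ... | no  _   | no  j≢j = contradiction ≡.refl j≢j

-- Greedy spanning forests, in the linear algebra of the field with two
-- elements: cuts are free on the tree edges, and cycles are determined by
-- the other edges.
module Forests {X : Set} {v : ℕ} (source target : X → Fin v) where

  cut : (Fin v → Bool) → X → Bool
  cut h x = h (source x) xor h (target x)

  record SpanningForest (xs : List X) : Set where
    field
      #classes    : ℕ
      class       : Fin v → Fin #classes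
      surjective  : ∀ c → ∃ λ y → class y ≡ c
      tree rest   : List X
      partition   : xs ↭ tree ++ rest
      count       : #classes ℕ.+ length tree ≡ v
      constant    : All (λ x → class (source x) ≡ class (target x)) xs
      cuts        : ∀ (g : X → Bool) → ∃ λ h → All (λ x → cut h x ≡ g x) tree
      independent : ∀ (c : X → Bool) → (∀ h → parity tree (λ x → c x ∧ cut h x) ≡ false) →
                    All (λ x → c x ≡ false) tree

  spanningForest : ∀ xs → SpanningForest xs
  spanningForest [] = record
    { #classes    = v
    ; class       = id
    ; surjective  = λ c → c , ≡.refl
    ; tree        = []
    ; rest        = []
    ; partition   = ↭-refl
    ; count       = ℕ.+-identityʳ v
    ; constant    = []
    ; cuts        = λ _ → (λ _ → false) , []
    ; independent = λ _ _ → []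
    }
  spanningForest (x ∷ xs) with spanningForest xs
  ... | forest with SpanningForest.class forest (source x) Fin.≟ SpanningForest.class forest (target x)
  ...   | yes same = record
    { #classes    = #classes
    ; class       = class
    ; surjective  = surjective
    ; tree        = tree
    ; rest        = x ∷ rest
    ; partition   = trans (prep x partition) (↭-sym (↭.shift x tree rest))
    ; count       = count
    ; constant    = same ∷ constant
    ; cuts        = cuts
    ; independent = independent
    }
    where open SpanningForest forest
  ...   | no distinct = join forest distinct
    where
    join : (F : SpanningForest xs) →
           SpanningForest.class F (source x) ≢ SpanningForest.class F (target x) → SpanningForest (x ∷ xs)
    join record { #classes = zero ; class = class } _ with () ← class (source x)
    join record { #classes = suc k ; class = class ; surjective = surjective ; tree = tree ; rest = rest
                ; partition = partition ; count = count ; constant = constant ; cuts = cuts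
                ; independent = independent } i≢j = record
      { #classes    = k
      ; class       = m ∘ class
      ; surjective  = λ c → let (y , eq) = surjective (punchIn j c) in
                              y , ≡.trans (≡.cong m eq) (merge-punchIn i j j≢i c)
      ; tree        = x ∷ tree
      ; rest        = rest
      ; partition   = prep x partition
      ; count       = ≡.trans (ℕ.+-suc k (length tree)) count
      ; constant    = merge-glues i j j≢i ∷ All.map (≡.cong m) constant
      ; cuts        = λ g → let (h , eqs) = cuts g in extend g h , extend-x g h ∷
                        All.tabulate (λ {y} y∈ → ≡.trans (extend-tree g h y∈) (All.lookup eqs y∈))
      ; independent = λ c cycle → c-x c cycle ∷ independent c λ h →
                        ≡.trans (≡.cong (λ b → (b ∧ cut h x) xor parity tree (λ y → c y ∧ cut h y))
                          (≡.sym (c-x c cycle))) (cycle h)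
      }
      where
      i = class (source x)
      j = class (target x)
      j≢i : j ≢ i
      j≢i = i≢j ∘ ≡.sym
      m = merge i j j≢i
      -- The cut around the class `j` contains the new edge `x` and no earlier tree edge. Adding it
      -- to a cut corrects the value on `x` and changes nothing on the earlier tree.
      side : Fin v → Bool
      side y = does (class y Fin.≟ j)
      side-x : cut side x ≡ true
      side-x rewrite dec-false (i Fin.≟ j) i≢j | dec-true (j Fin.≟ j) ≡.refl = ≡.refl
      side-tree : ∀ {y} → y ∈ tree → cut side y ≡ false
      side-tree {y} y∈ = ≡.trans (≡.cong (λ c → does (c Fin.≟ j) xor side (target y))
        (All.lookup constant (↭.∈-resp-↭ (↭-sym partition) (∈.∈-++⁺ˡ y∈)))) (Bool.xor-same (side (target y)))
      module _ (g : X → Bool) (h : Fin v → Bool) where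
        flip = cut h x xor g x
        extend : Fin v → Bool
        extend y = h y xor (flip ∧ side y)
        extend-cut : ∀ y → cut extend y ≡ cut h y xor (flip ∧ cut side y)
        extend-cut y = ≡.trans (xor-interchange (h (source y)) _ (h (target y)) _)
          (≡.cong (cut h y xor_) (≡.sym (Bool.∧-distribˡ-xor flip _ _)))
        extend-x : cut extend x ≡ g x
        extend-x = ≡.trans (extend-cut x) (≡.trans
          (≡.cong (λ b → cut h x xor (flip ∧ b)) side-x) (≡.trans
          (≡.cong (cut h x xor_) (Bool.∧-identityʳ flip))
          (≡.trans (≡.sym (Bool.xor-assoc (cut h x) (cut h x) (g x))) (≡.cong (_xor g x) (Bool.xor-same (cut h x))))))
        extend-tree : ∀ {y} → y ∈ tree → cut extend y ≡ cut h y
        extend-tree {y} y∈ = ≡.trans (extend-cut y) (≡.trans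
          (≡.cong (λ b → cut h y xor (flip ∧ b)) (side-tree y∈)) (≡.trans
          (≡.cong (cut h y xor_) (Bool.∧-zeroʳ flip)) (Bool.xor-identityʳ _)))
      -- The cut `side` meets the new tree in `x` alone, so its even intersection with `c` forces
      -- `c x` to vanish.
      c-x : ∀ c → (∀ h → parity (x ∷ tree) (λ y → c y ∧ cut h y) ≡ false) → c x ≡ false
      c-x c cycle = ≡.trans (≡.sym (≡.trans (≡.cong₂ _xor_
        (≡.trans (≡.cong (c x ∧_) side-x) (Bool.∧-identityʳ _))
        (parity-false tree λ {y} y∈ → ≡.trans (≡.cong (c y ∧_) (side-tree y∈)) (Bool.∧-zeroʳ _)))
        (Bool.xor-identityʳ _))) (cycle side)

-- Planar embeddings: cycles bound sets of faces

unique-resp-↭ : ∀ {xs ys : List A} → xs ↭ ys → Unique xs → Unique ys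
unique-resp-↭ = AllPairs-resp-↭ (λ x≢y → x≢y ∘ ≡.sym)

length-allFin : ∀ m → length (allFin m) ≡ m
length-allFin m = List.length-tabulate id

unique-⊆⇒↭ : ∀ {xs ys : List A} → Unique ys → (∀ {y} → y ∈ ys → y ∈ xs) →
              length xs ℕ.≤ length ys → xs ↭ ys
unique-⊆⇒↭ {xs = []}     {[]}     _            _  _ = ↭-refl
unique-⊆⇒↭ {xs = x ∷ xs} {[]}     _            _  ()
unique-⊆⇒↭ {xs = xs}     {y ∷ ys} (y∉ ∷ ys!) ys⊆ l with ∈.∈-∃++ (ys⊆ (here ≡.refl))
... | us , vs , ≡.refl = trans (↭.shift y us vs) (prep y (unique-⊆⇒↭ ys! sub
  (ℕ.s≤s⁻¹ (≡.subst (ℕ._≤ _) (↭.↭-length (↭.shift y us vs)) l))))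
  where
  sub : ∀ {z} → z ∈ ys → z ∈ us ++ vs
  sub z∈ with ↭.∈-resp-↭ (↭.shift y us vs) (ys⊆ (there z∈))
  ... | here ≡.refl = contradiction ≡.refl (All.lookup y∉ z∈)
  ... | there z∈′   = z∈′

parity-allFin : ∀ {m} (f : Fin m → Bool) i → parity (allFin m) (λ j → does (j Fin.≟ i) ∧ f j) ≡ f i
parity-allFin {m} f i = ≡.trans (parity-↭ (unique-⊆⇒↭ {ys = i ∷ us ++ vs} unique
    (λ { (here ≡.refl) → ∈.∈-allFin i ; (there j∈) → ∈.∈-allFin _ })
    (ℕ.≤-reflexive (↭.↭-length p))))
  (≡.trans (≡.cong₂ _xor_ (≡.cong (_∧ f i) (dec-true (i Fin.≟ i) ≡.refl))
    (parity-false (us ++ vs) λ {j} j∈ → ≡.cong (_∧ f j) (dec-false (j Fin.≟ i)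
      λ j≡i → All.lookup (AllPairs.head unique) j∈ (≡.sym j≡i)))) (Bool.xor-identityʳ _))
  where
  decomposition = ∈.∈-∃++ (∈.∈-allFin i)
  us = proj₁ decomposition
  vs = proj₁ (proj₂ decomposition)
  p : allFin m ↭ i ∷ us ++ vs
  p = trans (↭-reflexive (proj₂ (proj₂ decomposition))) (↭.shift i us vs)
  unique : Unique (i ∷ us ++ vs)
  unique = unique-resp-↭ p (Unique.allFin⁺ m)

surjection⇒≤ : ∀ {A : Set a} {m k} (f : A → Fin m) (g : A → Fin k) → (∀ c → ∃ λ x → f x ≡ c) →
               (∀ {x y} → g x ≡ g y → f x ≡ f y) → m ℕ.≤ k
surjection⇒≤ f g surj g⇒f = Fin.injective⇒≤ {f = λ c → g (proj₁ (surj c))} λ {c} {d} eq →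
  ≡.trans (≡.sym (proj₂ (surj c))) (≡.trans (g⇒f eq) (proj₂ (surj d)))

-- In a sphere, every cycle is the boundary of a set of faces.  A path p
-- between two boundary vertices becomes a cycle through the hub, hence there
-- is a two-colouring of the faces which changes exactly across this cycle.
-- The colour is constant along a path q disjoint from p, but around the hub
-- it changes between the ends of q as soon as these are separated by the ends of p.
module Planarity (G : Digraph) {n : ℕ} (terminal : Boundary n → Digraph.Vertex G)
                 (embedding : DiscEmbedding G terminal) where

  open Digraph G
  open DiscEmbedding embedding

  private
    D = Dart G terminal
    opp = opposite G terminal
    orig = origin G terminal

  X : Set
  X = Edge ⊎ Boundary n

  dart⁺ dart⁻ : X → D
  dart⁺ (inj₁ e) = tailEnd e
  dart⁺ (inj₂ b) = hubEnd b
  dart⁻ (inj₁ e) = headEnd e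
  dart⁻ (inj₂ b) = rimEnd b

  edgeOf : D → X
  edgeOf (tailEnd e) = inj₁ e
  edgeOf (headEnd e) = inj₁ e
  edgeOf (hubEnd b)  = inj₂ b
  edgeOf (rimEnd b)  = inj₂ b

  boundary : List (Boundary n)
  boundary = map s (allFin n) ++ map t (allFin n)

  edges : List X
  edges = map inj₁ (allFin size) ++ map inj₂ boundary

  ∈-edges : ∀ x → x ∈ edges
  ∈-edges (inj₁ e)              = ∈.∈-++⁺ˡ (∈.∈-map⁺ inj₁ (∈.∈-allFin e))
  ∈-edges (inj₂ (s i)) = ∈.∈-++⁺ʳ (map inj₁ (allFin size))
    (∈.∈-map⁺ inj₂ (∈.∈-++⁺ˡ (∈.∈-map⁺ s (∈.∈-allFin i))))
  ∈-edges (inj₂ (t i)) = ∈.∈-++⁺ʳ (map inj₁ (allFin size))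
    (∈.∈-map⁺ inj₂ (∈.∈-++⁺ʳ (map s (allFin n)) (∈.∈-map⁺ t (∈.∈-allFin i))))

  length-edges : length edges ≡ size ℕ.+ (n ℕ.+ n)
  length-edges = ≡.trans (List.length-++ (map inj₁ (allFin size))) (≡.cong₂ ℕ._+_
    (≡.trans (List.length-map inj₁ (allFin size)) (length-allFin size))
    (≡.trans (List.length-map inj₂ boundary) (≡.trans (List.length-++ (map s (allFin n))) (≡.cong₂ ℕ._+_
      (≡.trans (List.length-map s (allFin n)) (length-allFin n))
      (≡.trans (List.length-map t (allFin n)) (length-allFin n))))))

  unique-edges : Unique edges
  unique-edges = Unique.++⁺ (Unique.map⁺ (λ { ≡.refl → ≡.refl }) (Unique.allFin⁺ size))
    (Unique.map⁺ (λ { ≡.refl → ≡.refl }) (Unique.++⁺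
      (Unique.map⁺ (λ { ≡.refl → ≡.refl }) (Unique.allFin⁺ n))
      (Unique.map⁺ (λ { ≡.refl → ≡.refl }) (Unique.allFin⁺ n))
      λ (p , q) → case (∈.∈-map⁻ s p , ∈.∈-map⁻ t q) of λ { ((_ , _ , ≡.refl) , (_ , _ , ())) }))
    λ (p , q) → case (∈.∈-map⁻ inj₁ p , ∈.∈-map⁻ inj₂ q) of λ { ((_ , _ , ≡.refl) , (_ , _ , ())) }

  darts : List D
  darts = map dart⁺ edges ++ map dart⁻ edges

  ∈-darts : ∀ d → d ∈ darts
  ∈-darts (tailEnd e) = ∈.∈-++⁺ˡ (∈.∈-map⁺ dart⁺ (∈-edges (inj₁ e)))
  ∈-darts (hubEnd b)  = ∈.∈-++⁺ˡ (∈.∈-map⁺ dart⁺ (∈-edges (inj₂ b)))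
  ∈-darts (headEnd e) = ∈.∈-++⁺ʳ (map dart⁺ edges) (∈.∈-map⁺ dart⁻ (∈-edges (inj₁ e)))
  ∈-darts (rimEnd b)  = ∈.∈-++⁺ʳ (map dart⁺ edges) (∈.∈-map⁺ dart⁻ (∈-edges (inj₂ b)))

  unique-darts : Unique darts
  unique-darts = Unique.++⁺ (Unique.map⁺ dart⁺-injective unique-edges) (Unique.map⁺ dart⁻-injective unique-edges)
    λ (p , q) → case (∈.∈-map⁻ dart⁺ p , ∈.∈-map⁻ dart⁻ q) of λ { ((x , _ , eq) , (y , _ , eq′)) →
      dart⁺≢dart⁻ x y (≡.trans (≡.sym eq) eq′) }
    where
    dart⁺-injective : ∀ {x y} → dart⁺ x ≡ dart⁺ y → x ≡ y
    dart⁺-injective {inj₁ _} {inj₁ _} ≡.refl = ≡.refl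
    dart⁺-injective {inj₂ _} {inj₂ _} ≡.refl = ≡.refl
    dart⁻-injective : ∀ {x y} → dart⁻ x ≡ dart⁻ y → x ≡ y
    dart⁻-injective {inj₁ _} {inj₁ _} ≡.refl = ≡.refl
    dart⁻-injective {inj₂ _} {inj₂ _} ≡.refl = ≡.refl
    dart⁺≢dart⁻ : ∀ x y → dart⁺ x ≢ dart⁻ y
    dart⁺≢dart⁻ (inj₁ _) (inj₁ _) ()
    dart⁺≢dart⁻ (inj₁ _) (inj₂ _) ()
    dart⁺≢dart⁻ (inj₂ _) (inj₁ _) ()
    dart⁺≢dart⁻ (inj₂ _) (inj₂ _) ()

  opp-involutive : ∀ d → opp (opp d) ≡ d
  opp-involutive (tailEnd _) = ≡.refl
  opp-involutive (headEnd _) = ≡.refl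
  opp-involutive (hubEnd _)  = ≡.refl
  opp-involutive (rimEnd _)  = ≡.refl

  opp-dart⁺ : ∀ x → opp (dart⁺ x) ≡ dart⁻ x
  opp-dart⁺ (inj₁ _) = ≡.refl
  opp-dart⁺ (inj₂ _) = ≡.refl

  opp-dart⁻ : ∀ x → opp (dart⁻ x) ≡ dart⁺ x
  opp-dart⁻ (inj₁ _) = ≡.refl
  opp-dart⁻ (inj₂ _) = ≡.refl

  -- Since `rotation d` and `d` have the same origin, the orbit of the former leads back to `d`, and
  -- its last step is the preimage.
  rotation-surjective : ∀ d → ∃ λ d′ → rotation d′ ≡ d
  rotation-surjective d = last-step d (Equivalence.to (rotation-orbit (rotation d) d)
      (≡.sym (Equivalence.from (rotation-orbit d (rotation d)) (≡.refl ◅ ε)))) ≡.refl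
    where
    last-step : ∀ d₀ {d′} → Star (λ x y → rotation x ≡ y) d′ d → rotation d₀ ≡ d′ → ∃ λ d″ → rotation d″ ≡ d
    last-step d₀ ε         eq = d₀ , eq
    last-step d₀ (eq′ ◅ r) eq = last-step _ r eq′

  parity-darts : ∀ (f : D → Bool) → parity darts (f ∘ rotation ∘ opp) ≡ parity darts f
  parity-darts f = ≡.trans (≡.sym (parity-map darts)) (parity-↭ (unique-⊆⇒↭ unique-darts
    (λ {d} _ → let (d′ , eq) = rotation-surjective d in
      ≡.subst (_∈ map (rotation ∘ opp) darts) (≡.trans (≡.cong rotation (opp-involutive d′)) eq)
        (∈.∈-map⁺ (rotation ∘ opp) (∈-darts (opp d′))))
    (ℕ.≤-reflexive (List.length-map _ darts))))

  private
    vertexOf = Classes.class vertices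
    faceOf = Classes.class faces
    componentOf = Classes.class components

  vertexOf-cong : ∀ {d d′} → orig d ≡ orig d′ → vertexOf d ≡ vertexOf d′
  vertexOf-cong {d} {d′} = Equivalence.from (Classes.kernel vertices d d′)

  vertexOf-rotation : ∀ d → vertexOf (rotation d) ≡ vertexOf d
  vertexOf-rotation d = vertexOf-cong (≡.sym (Equivalence.from (rotation-orbit d (rotation d)) (≡.refl ◅ ε)))

  faceOf-next : ∀ d → faceOf (rotation (opp d)) ≡ faceOf d
  faceOf-next d = ≡.sym (Equivalence.from (Classes.kernel faces d (rotation (opp d))) (≡.refl ◅ ε))

  faceOf-rotation : ∀ d → faceOf (rotation d) ≡ faceOf (opp d)
  faceOf-rotation d = ≡.trans (≡.cong (faceOf ∘ rotation) (≡.sym (opp-involutive d))) (faceOf-next (opp d))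

  componentwise : ∀ {k} (f : D → Fin k) → (∀ d → f (rotation d) ≡ f d) → (∀ d → f (opp d) ≡ f d) →
                  ∀ {d d′} → componentOf d ≡ componentOf d′ → f d ≡ f d′
  componentwise f f-rot f-opp {d} {d′} eq = go (Equivalence.to (Classes.kernel components d d′) eq)
    where
    step : ∀ {x y} → Incident x y → f x ≡ f y
    step (inj₁ ≡.refl) = ≡.sym (f-rot _)
    step (inj₂ ≡.refl) = ≡.sym (f-opp _)
    go : ∀ {x y} → Star (SymClosure Incident) x y → f x ≡ f y
    go ε           = ≡.refl
    go (fwd p ◅ r) = ≡.trans (step p) (go r)
    go (bwd p ◅ r) = ≡.trans (≡.sym (step p)) (go r)

  surjective⁻¹ : ∀ {m} {f : D → Fin m} → (∀ y → ∃ λ x → ∀ {z} → z ≡ x → f z ≡ y) → ∀ c → ∃ λ d → f d ≡ c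
  surjective⁻¹ surj c = let (d , eq) = surj c in d , eq ≡.refl

  onEdges : ∀ {k} (f : D → Fin k) → (∀ x → f (dart⁺ x) ≡ f (dart⁻ x)) → ∀ d → f (opp d) ≡ f d
  onEdges f h (tailEnd e) = ≡.sym (h (inj₁ e))
  onEdges f h (headEnd e) = h (inj₁ e)
  onEdges f h (hubEnd b)  = ≡.sym (h (inj₂ b))
  onEdges f h (rimEnd b)  = h (inj₂ b)

  open module Primal = Forests (vertexOf ∘ dart⁺) (vertexOf ∘ dart⁻) using () renaming (cut to vertexCut)
  open module Dual   = Forests (faceOf ∘ dart⁺) (faceOf ∘ dart⁻) using () renaming (cut to faceCut)

  -- Orthogonality to all cuts; for `h` the indicator of a single vertex it says that the degree of
  -- that vertex in `c` is even.
  IsCycle : (X → Bool) → Set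
  IsCycle c = ∀ h → parity edges (λ x → c x ∧ vertexCut h x) ≡ false

  -- The pairing of a face cut with a vertex cut expands into the sum over darts of colour times
  -- height at the same dart, plus that of colour at a dart times height at its opposite. The face
  -- permutation `rotation ∘ opp` carries the second sum to the first.
  faceCut-isCycle : ∀ g → IsCycle (faceCut g)
  faceCut-isCycle g h = ≡.trans (parity-cong edges λ {x} _ → expand (γ (dart⁺ x)) (γ (dart⁻ x)) (η (dart⁺ x)) (η (dart⁻ x)))
    (≡.trans (parity-xor edges) (≡.trans (≡.cong₂ _xor_ same crossed) (Bool.xor-same (parity darts (λ d → γ d ∧ η d)))))
    where
    γ η : D → Bool
    γ = g ∘ faceOf
    η = h ∘ vertexOf
    expand : ∀ a b c d → (a xor b) ∧ (c xor d) ≡ ((a ∧ c) xor (b ∧ d)) xor ((a ∧ d) xor (b ∧ c))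
    expand false false c d = ≡.refl
    expand false true  c d = Bool.xor-comm c d
    expand true  false c d = ≡.cong₂ _xor_ (≡.sym (Bool.xor-identityʳ c)) (≡.sym (Bool.xor-identityʳ d))
    expand true  true  c d = ≡.sym (≡.trans (≡.cong ((c xor d) xor_) (Bool.xor-comm d c)) (Bool.xor-same (c xor d)))
    both : ∀ (f : D → Bool) → parity darts f ≡ parity edges (λ x → f (dart⁺ x) xor f (dart⁻ x))
    both f = ≡.trans (parity-++ (map dart⁺ edges) (map dart⁻ edges))
      (≡.trans (≡.cong₂ _xor_ (parity-map edges) (parity-map edges)) (≡.sym (parity-xor edges)))
    same : parity edges (λ x → (γ (dart⁺ x) ∧ η (dart⁺ x)) xor (γ (dart⁻ x) ∧ η (dart⁻ x))) ≡ parity darts (λ d → γ d ∧ η d)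
    same = ≡.sym (both (λ d → γ d ∧ η d))
    crossed : parity edges (λ x → (γ (dart⁺ x) ∧ η (dart⁻ x)) xor (γ (dart⁻ x) ∧ η (dart⁺ x))) ≡ parity darts (λ d → γ d ∧ η d)
    crossed = ≡.trans (parity-cong edges λ {x} _ → ≡.cong₂ (λ d d′ → (γ (dart⁺ x) ∧ η d) xor (γ (dart⁻ x) ∧ η d′))
        (≡.sym (opp-dart⁺ x)) (≡.sym (opp-dart⁻ x)))
      (≡.trans (≡.sym (both (λ d → γ d ∧ η (opp d))))
      (≡.trans (parity-cong darts λ {d} _ → ≡.cong₂ (λ f v → g f ∧ h v)
        (≡.sym (faceOf-next d)) (≡.sym (vertexOf-rotation (opp d))))
      (parity-darts (λ d → γ d ∧ η d))))

  primal : Primal.SpanningForest edges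
  primal = Primal.spanningForest edges
  module P = Primal.SpanningForest primal

  dual : Dual.SpanningForest P.rest
  dual = Dual.spanningForest P.rest
  module Q = Dual.SpanningForest dual

  cycle-vanishes : ∀ c → IsCycle c → All (λ x → c x ≡ false) P.rest → ∀ x → c x ≡ false
  cycle-vanishes c cycle rest≡ x = All.lookup (↭.All-resp-↭ (↭-sym P.partition)
      (All.++⁺ (P.independent c onTree) rest≡)) (∈-edges x)
    where
    onTree : ∀ h → parity P.tree (λ x → c x ∧ vertexCut h x) ≡ false
    onTree h = ≡.trans (≡.sym (≡.trans (parity-↭ P.partition) (≡.trans (parity-++ P.tree P.rest)
      (≡.trans (≡.cong (parity P.tree (λ x → c x ∧ vertexCut h x) xor_) (parity-false P.rest λ {x} x∈ →
        ≡.cong (_∧ vertexCut h x) (All.lookup rest≡ x∈))) (Bool.xor-identityʳ _))))) (cycle h)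

  -- The class of the origin of a dart is unchanged by rotation and, along every edge, by passing to
  -- the opposite dart; so it is a function of the component. Only this inequality is needed for
  -- Euler's formula to be exhausted.
  primal-classes : P.#classes ℕ.≤ #components
  primal-classes = surjection⇒≤ (P.class ∘ vertexOf) componentOf
    (λ c → let (v , eq) = P.surjective c
               (d , eq′) = surjective⁻¹ (Classes.surjective vertices) v in d , ≡.trans (≡.cong P.class eq′) eq)
    (componentwise (P.class ∘ vertexOf) (≡.cong P.class ∘ vertexOf-rotation)
      (onEdges _ λ x → All.lookup P.constant (∈-edges x)))

  -- The face cut around a dual class is a cycle that vanishes outside of the primal tree, hence
  -- vanishes everywhere. So primal tree edges do not separate dual classes either.
  dual-constant : ∀ x → Q.class (faceOf (dart⁺ x)) ≡ Q.class (faceOf (dart⁻ x))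
  dual-constant x with Q.class (faceOf (dart⁻ x)) Fin.≟ Q.class (faceOf (dart⁺ x))
  ... | yes eq = ≡.sym eq
  ... | no ¬eq = contradiction (≡.trans (≡.sym (≡.cong₂ _xor_ (dec-true (j Fin.≟ j) ≡.refl)
                   (dec-false (Q.class (faceOf (dart⁻ x)) Fin.≟ j) ¬eq)))
                   (cycle-vanishes (faceCut g) (faceCut-isCycle g) onRest x)) λ ()
    where
    j = Q.class (faceOf (dart⁺ x))
    g : Fin #faces → Bool
    g y = does (Q.class y Fin.≟ j)
    onRest : All (λ y → faceCut g y ≡ false) P.rest
    onRest = All.map (λ {y} eq → ≡.trans (≡.cong (λ c → does (c Fin.≟ j) xor g (faceOf (dart⁻ y))) eq)
      (Bool.xor-same (g (faceOf (dart⁻ y))))) Q.constant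

  dual-classes : Q.#classes ℕ.≤ #components
  dual-classes = surjection⇒≤ (Q.class ∘ faceOf) componentOf
    (λ c → let (v , eq) = Q.surjective c
               (d , eq′) = surjective⁻¹ (Classes.surjective faces) v in d , ≡.trans (≡.cong Q.class eq′) eq)
    (componentwise (Q.class ∘ faceOf)
      (λ d → ≡.trans (≡.cong Q.class (faceOf-rotation d)) (onEdges _ dual-constant d))
      (onEdges _ dual-constant))

  -- By Euler's formula, the edges outside of the forest form a forest of the dual graph.
  dual-rest : Q.rest ≡ []
  dual-rest = empty Q.rest (ℕ.+-cancelˡ-≤ (p ℕ.+ q ℕ.+ (r ℕ.+ u)) w 0 (begin
      p ℕ.+ q ℕ.+ (r ℕ.+ u) ℕ.+ w      ≡⟨ solve 5 (λ p q r u w → p :+ q :+ (r :+ u) :+ w := (r :+ (u :+ w)) :+ (p :+ q)) ≡.refl p q r u w ⟩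
      (r ℕ.+ (u ℕ.+ w)) ℕ.+ (p ℕ.+ q)  ≤⟨ ℕ.+-monoʳ-≤ (r ℕ.+ (u ℕ.+ w)) (ℕ.+-mono-≤ primal-classes dual-classes) ⟩
      (r ℕ.+ (u ℕ.+ w)) ℕ.+ (C ℕ.+ C)  ≡⟨ ≡.cong₂ ℕ._+_ (≡.sym edge-count) (≡.cong (C ℕ.+_) (≡.sym (ℕ.+-identityʳ C))) ⟩
      size ℕ.+ (n ℕ.+ n) ℕ.+ 2 ℕ.* C   ≡⟨ euler ⟨
      #vertices ℕ.+ #faces              ≡⟨ ≡.cong₂ ℕ._+_ P.count Q.count ⟨
      p ℕ.+ r ℕ.+ (q ℕ.+ u)             ≡⟨ solve 4 (λ p q r u → p :+ r :+ (q :+ u) := p :+ q :+ (r :+ u) :+ con 0) ≡.refl p q r u ⟩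
      p ℕ.+ q ℕ.+ (r ℕ.+ u) ℕ.+ 0       ∎))
    where
    open ℕ.≤-Reasoning
    open import Data.Nat.Solver using (module +-*-Solver)
    open +-*-Solver
    C = #components
    p = P.#classes
    q = Q.#classes
    r = length P.tree
    u = length Q.tree
    w = length Q.rest
    edge-count : size ℕ.+ (n ℕ.+ n) ≡ r ℕ.+ (u ℕ.+ w)
    edge-count = ≡.trans (≡.sym length-edges) (≡.trans (↭.↭-length P.partition) (≡.trans (List.length-++ P.tree)
      (≡.cong (r ℕ.+_) (≡.trans (↭.↭-length Q.partition) (List.length-++ Q.tree)))))
    empty : ∀ (xs : List X) → length xs ℕ.≤ 0 → xs ≡ []
    empty [] _ = ≡.refl

  -- Since the dual tree consists of all edges outside of the primal tree, a face cut can be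
  -- prescribed to agree with `c` on these; the difference is a cycle supported on the primal tree.
  cycle⇒faceCut : ∀ c → IsCycle c → ∃ λ f → ∀ x → faceCut f x ≡ c x
  cycle⇒faceCut c cycle = f , λ x → xor-cancel (cycle-vanishes (λ x → faceCut f x xor c x) difference onRest x)
    where
    f = proj₁ (Q.cuts c)
    xor-cancel : ∀ {a b} → a xor b ≡ false → a ≡ b
    xor-cancel {false} eq = ≡.sym eq
    xor-cancel {true} {true} eq = ≡.refl
    difference : IsCycle (λ x → faceCut f x xor c x)
    difference h = ≡.trans (parity-cong edges λ {x} _ → Bool.∧-distribʳ-xor (vertexCut h x) (faceCut f x) (c x))
      (≡.trans (parity-xor edges) (≡.cong₂ _xor_ (faceCut-isCycle f h) (cycle h)))
    onRest : All (λ x → faceCut f x xor c x ≡ false) P.rest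
    onRest = ↭.All-resp-↭ (↭-sym Q.partition) (All.++⁺
      (All.map (λ {x} eq → ≡.trans (≡.cong (_xor c x) eq) (Bool.xor-same (c x))) (proj₂ (Q.cuts c)))
      (≡.subst (All _) (≡.sym dual-rest) []))

  pathEdges : ∀ {u v} → Path u v → List Edge
  pathEdges ε             = []
  pathEdges ((e , _) ◅ p) = e ∷ pathEdges p

  visited-start : ∀ {u v} (p : Path u v) → u ∈ visited p
  visited-start ε       = here ≡.refl
  visited-start (_ ◅ p) = here ≡.refl

  visited-end : ∀ {u v} (p : Path u v) → v ∈ visited p
  visited-end ε       = here ≡.refl
  visited-end (_ ◅ p) = there (visited-end p)

  pathEdges-tail : ∀ {u v} (p : Path u v) {e} → e ∈ pathEdges p → tail e ∈ visited p
  pathEdges-tail ((e , ≡.refl , _) ◅ p) (here ≡.refl) = here ≡.refl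
  pathEdges-tail (_ ◅ p)                (there e∈)    = there (pathEdges-tail p e∈)

  pathEdges-head : ∀ {u v} (p : Path u v) {e} → e ∈ pathEdges p → head e ∈ visited p
  pathEdges-head ((e , _ , ≡.refl) ◅ p) (here ≡.refl) = there (visited-start p)
  pathEdges-head (_ ◅ p)                (there e∈)    = there (pathEdges-head p e∈)

  module _ {i j : Fin n} (p : Path (terminal (s i)) (terminal (t j))) where

    -- The path closed up through the hub by the spokes at its two ends, with multiplicities modulo
    -- two.
    pathCycle : X → Bool
    pathCycle (inj₁ e)              = parity (pathEdges p) (λ e′ → does (e Fin.≟ e′))
    pathCycle (inj₂ (s k)) = does (k Fin.≟ i)
    pathCycle (inj₂ (t k)) = does (k Fin.≟ j)

    -- Every inner vertex of the path contributes twice; `d` and `d′` are any darts at its two ends.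
    telescope : ∀ (η : D → Bool) → (∀ {d d′} → orig d ≡ orig d′ → η d ≡ η d′) →
      ∀ {u v} (q : Path u v) {d d′} → orig d ≡ just u → orig d′ ≡ just v →
      parity (pathEdges q) (λ e → η (tailEnd e) xor η (headEnd e)) ≡ η d xor η d′
    telescope η resp ε {d} {d′} eq eq′ = ≡.sym (≡.trans (≡.cong (_xor η d′) (resp {d} {d′} (≡.trans eq (≡.sym eq′)))) (Bool.xor-same (η d′)))
    telescope η resp ((e , ≡.refl , ≡.refl) ◅ q) {d} {d′} eq eq′ = ≡.trans
      (≡.cong₂ (λ a b → (a xor η (headEnd e)) xor b) (resp {tailEnd e} {d} (≡.sym eq)) (telescope η resp q {headEnd e} {d′} ≡.refl eq′))
      (≡.trans (Bool.xor-assoc (η d) (η (headEnd e)) (η (headEnd e) xor η d′))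
      (≡.cong (η d xor_) (≡.trans (≡.sym (Bool.xor-assoc (η (headEnd e)) (η (headEnd e)) (η d′)))
        (≡.cong (_xor η d′) (Bool.xor-same (η (headEnd e)))))))

    pathCycle-isCycle : IsCycle pathCycle
    pathCycle-isCycle h = ≡.trans (parity-++ (map inj₁ (allFin size)) (map inj₂ boundary))
      (≡.trans (≡.cong₂ _xor_ onPath (≡.trans (parity-map boundary) (≡.trans (parity-++ (map s (allFin n)) _)
          (≡.cong₂ _xor_ (≡.trans (parity-map (allFin n)) (parity-allFin (φ ∘ inj₂ ∘ s) i))
                         (≡.trans (parity-map (allFin n)) (parity-allFin (φ ∘ inj₂ ∘ t) j))))))
      (cancel (η (rimEnd (s i))) (η (rimEnd (t j))) (vertexOf-cong {hubEnd (s i)} {hubEnd (t j)} ≡.refl)))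
      where
      φ = vertexCut h
      η = h ∘ vertexOf
      onPath : parity (map inj₁ (allFin size)) (λ x → pathCycle x ∧ φ x) ≡ η (rimEnd (s i)) xor η (rimEnd (t j))
      onPath = ≡.trans (parity-map (allFin size)) (≡.trans
        (parity-cong (allFin size) λ {e} _ → ≡.sym (parity-∧ (pathEdges p) (φ (inj₁ e))))
        (≡.trans (parity-swap (allFin size) (pathEdges p)) (≡.trans
        (parity-cong (pathEdges p) λ {e} _ → parity-allFin (φ ∘ inj₁) e)
        (telescope η (λ {d} {d′} eq → ≡.cong h (vertexOf-cong {d} {d′} eq)) p {rimEnd (s i)} {rimEnd (t j)} ≡.refl ≡.refl))))
      cancel : ∀ a b {c d} → c ≡ d → (a xor b) xor ((h c xor a) xor (h d xor b)) ≡ false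
      cancel a b {c} ≡.refl = ≡.trans (≡.cong ((a xor b) xor_) (≡.trans (xor-interchange (h c) a (h c) b)
        (≡.cong (_xor (a xor b)) (Bool.xor-same (h c))))) (Bool.xor-same (a xor b))

    module _ {k l : Fin n} (q : Path (terminal (s k)) (terminal (t l)))
             (disjoint : ¬ Intersect p q) where

      private
        f = proj₁ (cycle⇒faceCut pathCycle pathCycle-isCycle)
        f-cut = proj₂ (cycle⇒faceCut pathCycle pathCycle-isCycle)

      colour : D → Bool
      colour d = f (faceOf d)

      xor-move : ∀ a b {c} → a xor b ≡ c → b ≡ a xor c
      xor-move a b eq = ≡.trans (≡.trans (≡.cong (_xor b) (≡.sym (Bool.xor-same a))) (Bool.xor-assoc a a b)) (≡.cong (a xor_) eq)

      colour-opp : ∀ d → colour (opp d) ≡ colour d xor pathCycle (edgeOf d)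
      colour-opp (tailEnd e) = xor-move (colour (tailEnd e)) _ (f-cut (inj₁ e))
      colour-opp (headEnd e) = xor-move (colour (headEnd e)) _ (≡.trans (Bool.xor-comm (colour (headEnd e)) (colour (tailEnd e))) (f-cut (inj₁ e)))
      colour-opp (hubEnd b)  = xor-move (colour (hubEnd b)) _ (f-cut (inj₂ b))
      colour-opp (rimEnd b)  = xor-move (colour (rimEnd b)) _ (≡.trans (Bool.xor-comm (colour (rimEnd b)) (colour (hubEnd b))) (f-cut (inj₂ b)))

      off-path : ∀ d {v} → orig d ≡ just v → v ∈ visited q → pathCycle (edgeOf d) ≡ false
      off-path (tailEnd e) ≡.refl v∈ = parity-false (pathEdges p) λ {e′} e′∈ → dec-false (e Fin.≟ e′)
        λ { ≡.refl → disjoint (_ , pathEdges-tail p e′∈ , v∈) }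
      off-path (headEnd e) ≡.refl v∈ = parity-false (pathEdges p) λ {e′} e′∈ → dec-false (e Fin.≟ e′)
        λ { ≡.refl → disjoint (_ , pathEdges-head p e′∈ , v∈) }
      off-path (rimEnd (s b)) ≡.refl v∈ = dec-false (b Fin.≟ i) λ { ≡.refl → disjoint (_ , visited-start p , v∈) }
      off-path (rimEnd (t b)) ≡.refl v∈ = dec-false (b Fin.≟ j) λ { ≡.refl → disjoint (_ , visited-end p , v∈) }

      colour-opp-off : ∀ d {v} → orig d ≡ just v → v ∈ visited q → colour (opp d) ≡ colour d
      colour-opp-off d eq v∈ = ≡.trans (colour-opp d) (≡.trans (≡.cong (colour d xor_) (off-path d eq v∈)) (Bool.xor-identityʳ _))

      -- Turning around a vertex of `q` crosses only edges and spokes at this vertex, and none of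
      -- them belongs to the cycle of `p`.
      colour-vertex : ∀ {d d′ v} → orig d ≡ just v → orig d′ ≡ just v → v ∈ visited q → colour d ≡ colour d′
      colour-vertex {d} {d′} {v} eq eq′ v∈ = go eq (Equivalence.to (rotation-orbit d d′) (≡.trans eq (≡.sym eq′)))
        where
        go : ∀ {d} → orig d ≡ just v → Star (λ x y → rotation x ≡ y) d d′ → colour d ≡ colour d′
        go eq ε = ≡.refl
        go {d} eq (≡.refl ◅ r) = ≡.trans (≡.trans (≡.sym (colour-opp-off d eq v∈)) (≡.cong f (≡.sym (faceOf-rotation d))))
          (go (≡.trans (≡.sym (Equivalence.from (rotation-orbit d (rotation d)) (≡.refl ◅ ε))) eq) r)

      colour-path : ∀ {u v} (r : Path u v) → (∀ {x} → x ∈ visited r → x ∈ visited q) →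
        ∀ {d d′} → orig d ≡ just u → orig d′ ≡ just v → colour d ≡ colour d′
      colour-path ε sub {d} {d′} eq eq′ = colour-vertex {d} {d′} eq eq′ (sub (here ≡.refl))
      colour-path ((e , ≡.refl , ≡.refl) ◅ r) sub {d} eq eq′ = ≡.trans
        (colour-vertex {d} {tailEnd e} eq ≡.refl (sub (here ≡.refl)))
        (≡.trans (≡.sym (colour-opp-off (tailEnd e) ≡.refl (sub (here ≡.refl))))
        (colour-path r (sub ∘ there) {headEnd e} ≡.refl eq′))

      colour-hub : ∀ {b c} → b ↷ c → colour (hubEnd c) ≡ colour (hubEnd b) xor pathCycle (inj₂ b)
      colour-hub {b} b↷c = ≡.trans (≡.cong colour (≡.sym (rotation-hub b↷c)))
        (≡.trans (≡.cong f (faceOf-rotation (hubEnd b))) (colour-opp (hubEnd b)))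

      ends : colour (hubEnd (s k)) ≡ colour (hubEnd (t l))
      ends = ≡.trans (colour-opp-off (rimEnd (s k)) ≡.refl (visited-start q))
        (≡.trans (colour-path q id {rimEnd (s k)} {rimEnd (t l)} ≡.refl ≡.refl)
        (≡.sym (colour-opp-off (rimEnd (t l)) ≡.refl (visited-end q))))

      module _ (i<k : toℕ i ℕ.< toℕ k) where

        private
          base = colour (hubEnd (s k))

        -- Among the source spokes only that of `i` lies on the cycle, and it comes before `k`. The
        -- number `d` is the distance from `k`.
        colour-s : ∀ d m → toℕ m ≡ d ℕ.+ toℕ k → colour (hubEnd (s m)) ≡ base
        colour-s zero    m eq = ≡.cong (colour ∘ hubEnd ∘ s) (Fin.toℕ-injective eq)
        colour-s (suc d) m eq = ≡.trans (colour-hub (s↷s {i = m′} {m} (≡.trans eq (≡.cong suc (≡.sym eq′)))))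
          (≡.trans (≡.cong₂ _xor_ (colour-s d m′ eq′) (dec-false (m′ Fin.≟ i) λ { ≡.refl →
            ℕ.<⇒≱ i<k (≡.subst (toℕ k ℕ.≤_) (≡.sym eq′) (ℕ.m≤n+m (toℕ k) d)) })) (Bool.xor-identityʳ base))
          where
          m′<n : d ℕ.+ toℕ k ℕ.< n
          m′<n = ℕ.<-trans (ℕ.≤-reflexive (≡.sym eq)) (Fin.toℕ<n m)
          m′ = fromℕ< m′<n
          eq′ : toℕ m′ ≡ d ℕ.+ toℕ k
          eq′ = Fin.toℕ-fromℕ< m′<n

        -- Going around the hub from the last sink down to the first, the colour changes once, on
        -- passing the spoke of `j`. The number `d` is the distance from the last sink.
        colour-t : ∀ d m → suc (d ℕ.+ toℕ m) ≡ n → colour (hubEnd (t m)) ≡ base xor does (toℕ m ℕ.<? toℕ j)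
        colour-t zero m eq = ≡.trans (colour-hub (s↷t {i = m} eq))
          (≡.cong₂ _xor_ (colour-s (toℕ m ℕ.∸ toℕ k) m (≡.sym (ℕ.m∸n+n≡m k≤m)))
            (≡.trans (dec-false (m Fin.≟ i) λ { ≡.refl → ℕ.<⇒≱ i<k k≤m })
                     (≡.sym (dec-false (toℕ m ℕ.<? toℕ j) λ m<j → ℕ.<⇒≱ (Fin.toℕ<n j) (≡.subst (ℕ._≤ toℕ j) eq m<j)))))
          where
          k≤m : toℕ k ℕ.≤ toℕ m
          k≤m = ℕ.s≤s⁻¹ (≡.subst (toℕ k ℕ.<_) (≡.sym eq) (Fin.toℕ<n k))
        colour-t (suc d) m eq = ≡.trans (colour-hub (t↷t {i = m′} {m} eq′))
          (≡.trans (≡.cong (_xor does (m′ Fin.≟ j)) (colour-t d m′ (≡.trans (≡.cong (λ r → suc (d ℕ.+ r)) eq′)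
            (≡.trans (≡.cong suc (ℕ.+-suc d (toℕ m))) eq))))
          (≡.trans (Bool.xor-assoc base _ _) (≡.cong (base xor_) split)))
          where
          m′<n : suc (toℕ m) ℕ.< n
          m′<n = ≡.subst (suc (toℕ m) ℕ.<_) eq (ℕ.s≤s (ℕ.s≤s (ℕ.m≤n+m (toℕ m) d)))
          m′ = fromℕ< m′<n
          eq′ : toℕ m′ ≡ suc (toℕ m)
          eq′ = Fin.toℕ-fromℕ< m′<n
          split : does (toℕ m′ ℕ.<? toℕ j) xor does (m′ Fin.≟ j) ≡ does (toℕ m ℕ.<? toℕ j)
          split with ℕ.<-cmp (toℕ m′) (toℕ j)
          ... | tri< m′<j m′≢j _ rewrite dec-true (toℕ m′ ℕ.<? toℕ j) m′<j | dec-false (m′ Fin.≟ j) (m′≢j ∘ ≡.cong toℕ)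
                | dec-true (toℕ m ℕ.<? toℕ j) (ℕ.<-trans (ℕ.≤-reflexive (≡.sym eq′)) m′<j) = ≡.refl
          ... | tri≈ m′≮j m′≡j _ rewrite dec-false (toℕ m′ ℕ.<? toℕ j) m′≮j | dec-true (m′ Fin.≟ j) (Fin.toℕ-injective m′≡j)
                | dec-true (toℕ m ℕ.<? toℕ j) (ℕ.≤-reflexive (≡.trans (≡.sym eq′) m′≡j)) = ≡.refl
          ... | tri> m′≮j m′≢j j<m′ rewrite dec-false (toℕ m′ ℕ.<? toℕ j) m′≮j | dec-false (m′ Fin.≟ j) (m′≢j ∘ ≡.cong toℕ)
                | dec-false (toℕ m ℕ.<? toℕ j) (λ m<j → ℕ.<⇒≱ j<m′ (≡.subst (ℕ._≤ toℕ j) (≡.sym eq′) m<j)) = ≡.refl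

        l≮j : ¬ toℕ l ℕ.< toℕ j
        l≮j l<j = true≢false base (≡.trans ends (≡.trans
            (colour-t (n ℕ.∸ suc (toℕ l)) l (≡.trans (≡.sym (ℕ.+-suc _ (toℕ l))) (ℕ.m∸n+n≡m (Fin.toℕ<n l))))
            (≡.cong (base xor_) (dec-true (toℕ l ℕ.<? toℕ j) l<j))))
          where
          true≢false : ∀ b → b ≢ b xor true
          true≢false false ()
          true≢false true  ()

  -- A common sink would be an intersection, and the reverse order of the sinks would put the ends
  -- of `q` on different sides of the cycle of `p`.
  disjoint⇒< : ∀ {i j k l} (p : Path (terminal (s i)) (terminal (t j)))
    (q : Path (terminal (s k)) (terminal (t l))) →
    toℕ i ℕ.< toℕ k → ¬ Intersect p q → toℕ j ℕ.< toℕ l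
  disjoint⇒< {j = j} {l = l} p q i<k disjoint with ℕ.<-cmp (toℕ j) (toℕ l)
  ... | tri< j<l _ _ = j<l
  ... | tri≈ _ j≡l _ = contradiction (_ , visited-end p , ≡.subst (λ m → terminal (t m) ∈ visited q)
                         (≡.sym (Fin.toℕ-injective j≡l)) (visited-end q)) disjoint
  ... | tri> _ _ l<j = contradiction l<j (l≮j p q disjoint i<k)

-- Paths and ranks in acyclic digraphs

unique⇒length≤ : ∀ {m} {xs : List (Fin m)} → Unique xs → length xs ℕ.≤ m
unique⇒length≤ {m} {xs} xs! with length xs ℕ.≤? m
... | yes l = l
... | no ¬l = contradiction (ℕ.≤-reflexive (≡.trans (≡.sym (↭.↭-length (unique-⊆⇒↭ xs!
        (λ _ → ∈.∈-allFin _) (≡.subst (ℕ._≤ length xs) (≡.sym (length-allFin m)) (ℕ.≰⇒≥ ¬l))))) (length-allFin m))) ¬l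

module AcyclicDigraphs (G : Digraph) (acyclic : Digraph.Acyclic G) where

  open Digraph G

  Path⇒TransClosure : ∀ {u v w} → u ⟶ v → Path v w → TransClosure _⟶_ u w
  Path⇒TransClosure e ε        = [ e ]
  Path⇒TransClosure e (e′ ◅ p) = e ∷ Path⇒TransClosure e′ p

  prefix : ∀ {u v w} (p : Path u v) → w ∈ visited p → Path u w
  prefix ε       (here ≡.refl) = ε
  prefix (_ ◅ _) (here ≡.refl) = ε
  prefix (e ◅ p) (there w∈)    = e ◅ prefix p w∈

  unique-visited : ∀ {u v} (p : Path u v) → Unique (visited p)
  unique-visited ε             = [] ∷ []
  unique-visited {u} (e ◅ p)   = All.tabulate (λ { w∈ ≡.refl → acyclic u (Path⇒TransClosure e (prefix p w∈)) })
                                 ∷ unique-visited p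

  length-visited : ∀ {u v} (p : Path u v) → length (visited p) ℕ.≤ order
  length-visited p = unique⇒length≤ (unique-visited p)

  private
    -- The function local to `pathsOfLength` has no name of its own; unification recovers it here,
    -- so that it can be compared with `throughEdge`.
    edgewise : ∀ k u v → ∃ λ g → pathsOfLength (suc k) u v ≡ concatMap g (allFin size)
    edgewise k u v = _ , ≡.refl

  throughEdge : ∀ k {u v} e → Dec (tail e ≡ u) → List (Path u v)
  throughEdge k {v = v} e (yes p) = map ((e , p , ≡.refl) ◅_) (pathsOfLength k (head e) v)
  throughEdge k         e (no _)  = []

  pathsOfLength-suc : ∀ k u v →
    pathsOfLength (suc k) u v ≡ concatMap (λ e → throughEdge k e (tail e Fin.≟ u)) (allFin size)
  pathsOfLength-suc k u v = List.concatMap-cong same (allFin size)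
    where
    same : ∀ e → proj₁ (edgewise k u v) e ≡ throughEdge k e (tail e Fin.≟ u)
    same e with tail e Fin.≟ u
    ... | yes _ = ≡.refl
    ... | no  _ = ≡.refl

  length-pathsOfLength : ∀ k {u v} {p : Path u v} → p ∈ pathsOfLength k u v → length (visited p) ≡ suc k
  length-pathsOfLength zero {u} {v} p∈ with u Fin.≟ v | p∈
  ... | yes ≡.refl | here ≡.refl = ≡.refl
  length-pathsOfLength (suc k) {u} {v} p∈
    with find (∈.∈-concatMap⁻ _ {xs = allFin size} (≡.subst (_ ∈_) (pathsOfLength-suc k u v) p∈))
  ... | e , _ , q∈ with tail e Fin.≟ u
  ...   | yes _ with ∈.∈-map⁻ _ q∈
  ...     | q , q∈′ , ≡.refl = ≡.cong suc (length-pathsOfLength k q∈′)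

  pathsOfLength-order : ∀ {u v} {p : Path u v} → p ∉ pathsOfLength order u v
  pathsOfLength-order {p = p} p∈ = ℕ.<⇒≱ (ℕ.≤-reflexive (≡.sym (length-pathsOfLength order p∈))) (length-visited p)

  ∑out : Vertex → (Vertex → ℕ) → ℕ
  ∑out v g = sum (map (λ e → if does (tail e Fin.≟ v) then g (head e) else 0) (allFin size))

  ∑out-cong : ∀ v {g h : Vertex → ℕ} → (∀ w → g w ≡ h w) → ∑out v g ≡ ∑out v h
  ∑out-cong v gh = ≡.cong sum (List.map-cong (λ e → ≡.cong (λ x → if does (tail e Fin.≟ v) then x else 0) (gh (head e))) (allFin size))

  ∑out-+ : ∀ v g h → ∑out v (λ w → g w ℕ.+ h w) ≡ ∑out v g ℕ.+ ∑out v h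
  ∑out-+ v g h = go (allFin size)
    where
    go : ∀ es → sum (map (λ e → if does (tail e Fin.≟ v) then g (head e) ℕ.+ h (head e) else 0) es) ≡
                sum (map (λ e → if does (tail e Fin.≟ v) then g (head e) else 0) es) ℕ.+
                sum (map (λ e → if does (tail e Fin.≟ v) then h (head e) else 0) es)
    go [] = ≡.refl
    go (e ∷ es) with does (tail e Fin.≟ v)
    ... | true  = ≡.trans (≡.cong (g (head e) ℕ.+ h (head e) ℕ.+_) (go es)) (ℕ-interchange (g (head e)) _ _ _)
      where open CommutativeSemigroupProperties ℕ.+-commutativeSemigroup using () renaming (interchange to ℕ-interchange)
    ... | false = go es

  ∑out-≤ : ∀ e g → g (head e) ℕ.≤ ∑out (tail e) g
  ∑out-≤ e g = ≡.subst (ℕ._≤ ∑out (tail e) g) (≡.cong (λ b → if b then g (head e) else 0) (dec-true (tail e Fin.≟ tail e) ≡.refl))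
    (go (∈.∈-allFin e))
    where
    f : Edge → ℕ
    f e′ = if does (tail e′ Fin.≟ tail e) then g (head e′) else 0
    go : ∀ {es} → e ∈ es → f e ℕ.≤ sum (map f es)
    go (here ≡.refl) = ℕ.m≤m+n _ _
    go (there e∈)    = ℕ.≤-trans (go e∈) (ℕ.m≤n+m _ _)

  ∑out-≢0 : ∀ v g → ∑out v g ≢ 0 → ∃ λ e → tail e ≡ v × g (head e) ≢ 0
  ∑out-≢0 v g = go (allFin size)
    where
    f : Edge → ℕ
    f e = if does (tail e Fin.≟ v) then g (head e) else 0
    go : ∀ es → sum (map f es) ≢ 0 → ∃ λ e → tail e ≡ v × g (head e) ≢ 0
    go []       ≢0 = contradiction ≡.refl ≢0
    go (e ∷ es) ≢0 with tail e Fin.≟ v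
    ... | no _    = go es ≢0
    ... | yes eq with g (head e) ℕ.≟ 0
    ...   | no g≢0  = e , eq , g≢0
    ...   | yes g≡0 = go es (≢0 ∘ ≡.trans (≡.cong (ℕ._+ sum (map f es)) g≡0))

  -- These count the paths from a vertex, to any end, with exactly `k` and with fewer than `k`
  -- edges; the successor in the latter stands for the empty path.
  #ofLength #shorter : ℕ → Vertex → ℕ
  #ofLength zero    v = 1
  #ofLength (suc k) v = ∑out v (#ofLength k)
  #shorter zero    v = 0
  #shorter (suc k) v = suc (∑out v (#shorter k))

  #shorter-suc : ∀ k v → #shorter (suc k) v ≡ #shorter k v ℕ.+ #ofLength k v
  #shorter-suc zero    v = ≡.cong suc (ℕ.n≤0⇒n≡0 (ℕ.≮⇒≥ λ 0< → case ∑out-≢0 v (λ _ → 0) (λ eq → ℕ.<-irrefl (≡.sym eq) 0<) of λ { (_ , _ , 0≢0) → 0≢0 ≡.refl }))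
  #shorter-suc (suc k) v = ≡.cong suc (≡.trans (∑out-cong v (#shorter-suc k)) (∑out-+ v (#shorter k) (#ofLength k)))

  #ofLength≢0 : ∀ k v → #ofLength k v ≢ 0 → ∃ λ w → ∃ λ (p : Path v w) → length (visited p) ≡ suc k
  #ofLength≢0 zero    v _  = v , ε , ≡.refl
  #ofLength≢0 (suc k) v ≢0 with ∑out-≢0 v (#ofLength k) ≢0
  ... | e , eq , ≢0′ with #ofLength≢0 k (head e) ≢0′
  ...   | w , p , l = w , (e , eq , ≡.refl) ◅ p , ≡.cong suc l

  -- The number of paths starting at a vertex.
  rank : Vertex → ℕ
  rank = #shorter order

  -- No path has `order` edges, so raising the bound on the length by one does not change the count.
  rank-step : ∀ v → rank v ≡ suc (∑out v rank)
  rank-step v = ≡.sym (≡.trans (#shorter-suc order v) (≡.trans (≡.cong (rank v ℕ.+_) none) (ℕ.+-identityʳ _)))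
    where
    none : #ofLength order v ≡ 0
    none with #ofLength order v ℕ.≟ 0
    ... | yes eq = eq
    ... | no ≢0 with #ofLength≢0 order v ≢0
    ...   | _ , p , l = contradiction (ℕ.≤-reflexive (≡.sym l)) (ℕ.≤⇒≯ (length-visited p))

  rank-decreases : ∀ e → rank (head e) ℕ.< rank (tail e)
  rank-decreases e = ≡.subst (rank (head e) ℕ.<_) (≡.sym (rank-step (tail e))) (ℕ.s≤s (∑out-≤ e rank))

  rank-visited : ∀ {u v} (p : Path u v) {w} → w ∈ visited p → w ≡ u ⊎ rank w ℕ.< rank u
  rank-visited ε       (here eq) = inj₁ eq
  rank-visited (_ ◅ _) (here eq) = inj₁ eq
  rank-visited ((e , ≡.refl , ≡.refl) ◅ p) (there w∈) with rank-visited p w∈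
  ... | inj₁ ≡.refl = inj₂ (rank-decreases e)
  ... | inj₂ w<     = inj₂ (ℕ.<-trans w< (rank-decreases e))

  NoExit : Vertex → Set
  NoExit v = ∀ e → tail e ≢ v

  -- The head of an exit would have a rank below 1, yet every rank counts the empty path.
  rank≤1⇒noExit : ∀ {v} → rank v ℕ.≤ 1 → NoExit v
  rank≤1⇒noExit l e ≡.refl = ℕ.n≮0 (ℕ.<-≤-trans (≡.subst (0 ℕ.<_) (≡.sym (rank-step (head e))) ℕ.z<s)
    (ℕ.s≤s⁻¹ (ℕ.<-≤-trans (rank-decreases e) l)))

  noExit-visited : ∀ {u v} (p : Path u v) → NoExit u → ∀ {w} → w ∈ visited p → w ≡ u
  noExit-visited ε                   _    (here eq) = eq
  noExit-visited ((e , eq , _) ◅ _) exit _         = contradiction eq (exit e)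

-- Sums over paths, by first edge

module PathSums {c ℓ₁ ℓ₂} (R : OrderedCommutativeRing c ℓ₁ ℓ₂)
                (G : Digraph) (acyclic : Digraph.Acyclic G) where

  open Calculus R
  open Digraph G
  open AcyclicDigraphs G acyclic

  continue : ∀ {u v} e → Dec (tail e ≡ u) → (Path u v → Carrier) → Carrier
  continue {v = v} e (yes p) f = ∑ (paths (head e) v) (λ q → f ((e , p , ≡.refl) ◅ q))
  continue         e (no _)  f = 0#

  ∑-upTo-suc : ∀ m {f : ℕ → Carrier} → ∑ (upTo (suc m)) f ≈ f 0 + ∑ (upTo m) (f ∘ suc)
  ∑-upTo-suc m {f} = +-congˡ (≈-trans (≈-reflexive (≡.cong (λ xs → ∑ xs f) (≡.sym (List.map-upTo suc m)))) (∑-map (upTo m)))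

  ∑-upTo-last : ∀ m {f : ℕ → Carrier} → ∑ (upTo (suc m)) f ≈ ∑ (upTo m) f + f m
  ∑-upTo-last m {f} = ≈-trans (≈-reflexive (≡.cong (λ xs → ∑ xs f) (≡.sym (List.upTo-∷ʳ m))))
    (≈-trans (∑-++ (upTo m) (m ∷ [])) (+-congˡ (+-identityʳ _)))

  -- Removing the first edge lowers the length by one, so the tails have at most `order - 2` edges.
  -- The missing layer may be added because no path has `order` edges.
  ∑-paths : ∀ u v (f : Path u v → Carrier) →
    ∑ (paths u v) f ≈ ∑ (pathsOfLength 0 u v) f + ∑ (allFin size) (λ e → continue e (tail e Fin.≟ u) f)
  ∑-paths u v f = go order ≡.refl
    where
    layer : ℕ → Carrier
    layer k = ∑ (pathsOfLength k u v) f
    next : ∀ k e → Dec (tail e ≡ u) → Carrier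
    next k e d = ∑ (throughEdge k e d) f
    layer-suc : ∀ k → layer (suc k) ≈ ∑ (allFin size) (λ e → next k e (tail e Fin.≟ u))
    layer-suc k = ≈-trans (≈-reflexive (≡.cong (λ xs → ∑ xs f) (pathsOfLength-suc k u v))) (∑-concatMap (allFin size))
    go : ∀ m → m ≡ order → ∑ (paths u v) f ≈ layer 0 + ∑ (allFin size) (λ e → continue e (tail e Fin.≟ u) f)
    go zero    eq = contradiction (≡.subst Fin (≡.sym eq) u) λ ()
    go (suc m) eq = begin
      ∑ (paths u v) f
        ≈⟨ ∑-concatMap (upTo order) ⟩
      ∑ (upTo order) layer
        ≈⟨ ≈-reflexive (≡.cong (λ k → ∑ (upTo k) layer) (≡.sym eq)) ⟩
      ∑ (upTo (suc m)) layer
        ≈⟨ ∑-upTo-suc m ⟩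
      layer 0 + ∑ (upTo m) (layer ∘ suc)
        ≈⟨ +-congˡ (≈-trans (+-congˡ (≈-trans (≈-reflexive (≡.cong layer eq))
             (∑-0 (pathsOfLength order u v) λ p∈ → contradiction p∈ pathsOfLength-order))) (+-identityʳ _)) ⟨
      layer 0 + (∑ (upTo m) (layer ∘ suc) + layer (suc m))
        ≈⟨ +-congˡ (≈-trans (≈-sym (∑-upTo-last m)) (≈-reflexive (≡.cong (λ k → ∑ (upTo k) (layer ∘ suc)) eq))) ⟩
      layer 0 + ∑ (upTo order) (layer ∘ suc)
        ≈⟨ +-congˡ (≈-trans (∑-cong (upTo order) λ {k} _ → layer-suc k) (∑-swap (upTo order) (allFin size))) ⟩
      layer 0 + ∑ (allFin size) (λ e → ∑ (upTo order) (λ k → next k e (tail e Fin.≟ u)))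
        ≈⟨ +-congˡ (∑-cong (allFin size) λ {e} _ → gather e (tail e Fin.≟ u)) ⟩
      layer 0 + ∑ (allFin size) (λ e → continue e (tail e Fin.≟ u) f) ∎
      where
      gather : ∀ e d → ∑ (upTo order) (λ k → next k e d) ≈ continue e d f
      gather e (yes p) = ≈-trans (∑-cong (upTo order) λ {k} _ → ∑-map (pathsOfLength k (head e) v))
                                 (≈-sym (∑-concatMap (upTo order)))
      gather e (no _)  = ∑-0 (upTo order) λ _ → ≈-refl

  ∑-paths-≢ : ∀ {u v} → u ≢ v → (f : Path u v → Carrier) →
    ∑ (paths u v) f ≈ ∑ (allFin size) (λ e → continue e (tail e Fin.≟ u) f)
  ∑-paths-≢ {u} {v} u≢v f = ≈-trans (∑-paths u v f) (≈-trans (+-congʳ none) (+-identityˡ _))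
    where
    none : ∑ (pathsOfLength 0 u v) f ≈ 0#
    none with u Fin.≟ v
    ... | yes u≡v = contradiction u≡v u≢v
    ... | no _    = ≈-refl

  module _ {u} (noExit : NoExit u) where

    private
      stuck : ∀ {v} (f : Path u v → Carrier) → ∑ (allFin size) (λ e → continue e (tail e Fin.≟ u) f) ≈ 0#
      stuck {v} f = ∑-0 (allFin size) λ {e} _ → deadEnd e (tail e Fin.≟ u)
        where
        deadEnd : ∀ e d → continue e d f ≈ 0#
        deadEnd e (yes p) = contradiction p (noExit e)
        deadEnd e (no _)  = ≈-refl

    ∑-paths-noExit-≢ : ∀ {v} → u ≢ v → (f : Path u v → Carrier) → ∑ (paths u v) f ≈ 0#
    ∑-paths-noExit-≢ u≢v f = ≈-trans (∑-paths-≢ u≢v f) (stuck f)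

    ∑-paths-noExit : ∀ (f : Path u u → Carrier) → ∑ (paths u u) f ≈ f ε
    ∑-paths-noExit f = ≈-trans (∑-paths u u f) (≈-trans (+-cong trivial (stuck f)) (+-identityʳ _))
      where
      trivial : ∑ (pathsOfLength 0 u u) f ≈ f ε
      trivial with u Fin.≟ u
      ... | yes ≡.refl = +-identityʳ _
      ... | no u≢u     = contradiction ≡.refl u≢u

-- The Lindström-Gessel-Viennot lemma

allPairs-lookup : ∀ {r} {_~_ : Rel A r} → (∀ {x y} → x ~ y → y ~ x) → ∀ {xs x y} →
                  AllPairs _~_ xs → x ∈ xs → y ∈ xs → x ≢ y → x ~ y
allPairs-lookup sym (p ∷ ps) (here ≡.refl) (here ≡.refl) x≢y = contradiction ≡.refl x≢y
allPairs-lookup sym (p ∷ ps) (here ≡.refl) (there y∈)    x≢y = All.lookup p y∈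
allPairs-lookup sym (p ∷ ps) (there x∈)    (here ≡.refl) x≢y = sym (All.lookup p x∈)
allPairs-lookup sym (p ∷ ps) (there x∈)    (there y∈)    x≢y = allPairs-lookup sym ps x∈ y∈ x≢y

extract-any : ∀ {p} {P : Unary.Pred A p} {xs} → Any P xs → ∃ λ y → ∃ λ ys → xs ↭ y ∷ ys × P y
extract-any any with find any
... | y , y∈ , Py with ∈.∈-∃++ y∈
...   | us , vs , ≡.refl = y , us ++ vs , ↭.shift y us vs , Py

allPairs-or-exception : ∀ {r} {_~_ : Rel A r} → Decidable _~_ → ∀ xs →
  AllPairs _~_ xs ⊎ ∃ λ x → ∃ λ y → ∃ λ zs → xs ↭ x ∷ y ∷ zs × ¬ x ~ y
allPairs-or-exception _~?_ [] = inj₁ []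
allPairs-or-exception _~?_ (x ∷ xs) with allPairs-or-exception _~?_ xs
... | inj₂ (y , z , zs , p , ¬y~z) = inj₂ (y , z , x ∷ zs ,
        trans (prep x p) (trans (swap x y ↭-refl) (prep y (swap x z ↭-refl))) , ¬y~z)
... | inj₁ ps with All.all? (x ~?_) xs
...   | yes px = inj₁ (px ∷ ps)
...   | no ¬px with extract-any (All.¬All⇒Any¬ (x ~?_) xs ¬px)
...     | y , ys , p , ¬x~y = inj₂ (x , y , ys , prep x p , ¬x~y)

-- The lemma of Lindström, Gessel and Viennot, by moving the starting points
-- along the edges.  The determinant is linear in each row, and vanishes, as does
-- the sum over disjoint families, when two starting points meet.
module DisjointPaths {c ℓ₁ ℓ₂} (R : OrderedCommutativeRing c ℓ₁ ℓ₂) {n : ℕ} (N : PlanarNetwork R n) where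

  open Calculus R
  open PermutationSums R
  open Posets R
  open Lifting R
  open PlanarNetwork N
  open AcyclicDigraphs digraph acyclic
  open PathSums R digraph acyclic
  open Planarity digraph terminal embedding using (visited-start; disjoint⇒<)

  source sink : Fin n → Vertex
  source i = terminal (s i)
  sink j   = terminal (t j)

  -- The path with label i leads from the current starting point to sink i.
  State : Set
  State = Fin n × Vertex

  label : State → Fin n
  label = proj₁

  start : State → Vertex
  start = proj₂

  statePaths : ∀ (x : State) → List (Path (start x) (sink (label x)))
  statePaths x = paths (start x) (sink (label x))

  StatePath : Set
  StatePath = Σ State (λ x → Path (start x) (sink (label x)))

  Disjoint : Rel StatePath _
  Disjoint (_ , p) (_ , q) = ¬ Intersect p q

  disjoint? : Decidable Disjoint
  disjoint? (_ , p) (_ , q) = ¬? (intersect? p q)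

  disjoint-sym : ∀ {x y} → Disjoint x y → Disjoint y x
  disjoint-sym disj (w , w∈p , w∈q) = disj (w , w∈q , w∈p)

  pairwiseDisjoint? : Unary.Decidable (AllPairs Disjoint)
  pairwiseDisjoint? = AllPairs.allPairs? disjoint?

  signedDisjoint : List StatePath → Carrier
  signedDisjoint ys = sgn ys * χ (pairwiseDisjoint? ys)

  signedDisjoint-symmetric : Symmetric signedDisjoint
  signedDisjoint-symmetric {xs} {ys} p = *-cong (sgn-symmetric p) (χ-cong (pairwiseDisjoint? xs) (pairwiseDisjoint? ys)
    (AllPairs-resp-↭ disjoint-sym p) (AllPairs-resp-↭ disjoint-sym (↭-sym p)))

  M : State → State → Carrier
  M x y = ∑ (paths (start x) (sink (label y))) pathWeight

  disjointSum : List State → Carrier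
  disjointSum = lift statePaths pathWeight signedDisjoint

  disjointSum-symmetric : Symmetric disjointSum
  disjointSum-symmetric = lift-symmetric statePaths pathWeight signedDisjoint-symmetric

  -- This follows from planarity for the sources, and persists under the moves.
  Planar : Rel State _
  Planar (i , u) (j , v) = toℕ i ℕ.< toℕ j → ∀ a b (p : Path u (sink a)) (q : Path v (sink b)) →
                           ¬ Intersect p q → toℕ a ℕ.< toℕ b

  BiPlanar : Rel State _
  BiPlanar x y = Planar x y × Planar y x

  biPlanar-sym : ∀ {x y} → BiPlanar x y → BiPlanar y x
  biPlanar-sym (p , q) = q , p

  _≢start_ : Rel State _
  x ≢start y = start x ≢ start y

  -- The determinant then has two equal rows, and paths beginning at a common vertex are never
  -- disjoint.
  meeting : ∀ {xs x y zs} → xs ↭ x ∷ y ∷ zs → start x ≡ start y → det⁻ M xs ≈ disjointSum xs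
  meeting {xs} {x} {y} {zs} p eq = ≈-trans
    (det⁻-equalRows M p (All.tabulate λ {z} _ →
      ≈-reflexive (≡.cong (λ u → ∑ (paths u (sink (label z))) pathWeight) eq)))
    (≈-sym (≈-trans (disjointSum-symmetric p) (∑-0 (statePaths x) λ {r} _ → ≈-trans (*-congˡ
      (∑-0 (statePaths y) λ {r′} _ → ≈-trans (*-congˡ (lift-0 statePaths pathWeight zs λ {ys} _ →
        ≈-trans (*-congˡ (χ-no (pairwiseDisjoint? ((x , r) ∷ (y , r′) ∷ ys))
          λ { ((disj ∷ _) ∷ _) → disj (start x , visited-start r , ≡.subst (_∈ visited r′) (≡.sym eq) (visited-start r′)) }))
        (zeroʳ _))) (zeroʳ _))) (zeroʳ _))))

  -- Meant for a state and its move along an edge: a column of `M` depends on the label alone, which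
  -- a move preserves.
  walk-column : ∀ {y y′} → (∀ x → M x y ≈ M x y′) → ∀ x u → walk M x u y ≈ walk M x u y′
  walk-column h x []      = h x
  walk-column h x (z ∷ u) = *-congˡ (walk-column h z u)

  move : State → Edge → State
  move (i , _) e = i , head e

  exitWeight : Vertex → Edge → Carrier
  exitWeight v e = if does (tail e Fin.≟ v) then weight e else 0#

  ∑-continue : ∀ {u v} e (d : Dec (tail e ≡ u)) {f : Path u v → Carrier} (g : Path (head e) v → Carrier) →
    (∀ p q → f ((e , p , ≡.refl) ◅ q) ≈ weight e * g q) →
    continue e d f ≈ (if does d then weight e else 0#) * ∑ (paths (head e) v) g
  ∑-continue e (yes p) g h = ≈-trans (∑-cong (paths (head e) _) λ {q} _ → h p q) (∑-*ˡ (paths (head e) _) (weight e))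
  ∑-continue e (no _)  g h = ≈-sym (zeroˡ _)

  module _ (x : State) (not-sink : ∀ j → start x ≢ sink j) where

    M-move : ∀ z → M x z ≈ ∑ (allFin size) (λ e → exitWeight (start x) e * M (move x e) z)
    M-move z = ≈-trans (∑-paths-≢ (not-sink (label z)) pathWeight)
      (∑-cong (allFin size) λ {e} _ → ∑-continue e (tail e Fin.≟ start x) pathWeight λ _ _ → ≈-refl)

    walks-move : ∀ zs → walks M x x zs ≈ ∑ (allFin size) (λ e → exitWeight (start x) e * walks M (move x e) (move x e) zs)
    walks-move zs = ≈-trans (∑perm-cong zs λ {u} _ → expand u)
      (≈-trans (∑-swap (arrangements (length zs) zs) (allFin size))
        (∑-cong (allFin size) λ _ → ∑-*ˡ (arrangements (length zs) zs) _))
      where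
      expand : ∀ u → walk M x u x ≈ ∑ (allFin size) (λ e → exitWeight (start x) e * walk M (move x e) u (move x e))
      expand []      = M-move x
      expand (z ∷ u) = ≈-trans (*-congʳ (M-move z)) (≈-trans (≈-sym (∑-*ʳ (allFin size) _))
        (∑-cong (allFin size) λ {e} _ → ≈-trans (*-assoc _ _ _)
          (*-congˡ (*-congˡ (walk-column {x} {move x e} (λ _ → ≈-refl) z u)))))

    det⁻-move : ∀ ys → det⁻ M (x ∷ ys) ≈ ∑ (allFin size) (λ e → exitWeight (start x) e * det⁻ M (move x e ∷ ys))
    det⁻-move ys = begin
      det⁻ M (x ∷ ys)
        ≈⟨ det⁻-∷ M x ys ⟩
      - (walks M x x ⋆ det⁻ M) ys
        ≈⟨ -‿cong (≈-trans (⋆-congʳ walks-move ys) (⋆-∑ˡ (allFin size) _ (det⁻ M) ys)) ⟩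
      - ∑ (allFin size) (λ e → ((λ zs → exitWeight (start x) e * walks M (move x e) (move x e) zs) ⋆ det⁻ M) ys)
        ≈⟨ ∑-neg (allFin size) ⟨
      ∑ (allFin size) (λ e → - ((λ zs → exitWeight (start x) e * walks M (move x e) (move x e) zs) ⋆ det⁻ M) ys)
        ≈⟨ ∑-cong (allFin size) (λ {e} _ → ≈-trans (-‿cong (⋆-scaleˡ _ _ (det⁻ M) ys))
             (≈-trans (-‿distribʳ-* _ _) (*-congˡ (≈-sym (det⁻-∷ M (move x e) ys))))) ⟩
      ∑ (allFin size) (λ e → exitWeight (start x) e * det⁻ M (move x e ∷ ys)) ∎

    module _ (ys : List State) (distinct : All (x ≢start_) ys)
             (topmost : All (λ y → rank (start y) ℕ.≤ rank (start x)) ys) where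

      -- The rank falls strictly along a path, so a path that begins elsewhere and no higher than
      -- `start x` cannot pass through it.
      avoids : ∀ {y} → y ∈ ys → ∀ {v} (q : Path (start y) v) → start x ∉ visited q
      avoids y∈ q x∈ with rank-visited q x∈
      ... | inj₁ eq = All.lookup distinct y∈ eq
      ... | inj₂ x< = ℕ.<⇒≱ x< (All.lookup topmost y∈)

      disjoint-move : ∀ {e v w y} (p : tail e ≡ start x) (r : Path (head e) v) → y ∈ ys → (q : Path (start y) w) →
        ¬ Intersect r q → ¬ Intersect {start x} ((e , p , ≡.refl) ◅ r) q
      disjoint-move p r y∈ q disj (_ , here ≡.refl , w∈q) = avoids y∈ q w∈q
      disjoint-move p r y∈ q disj (w , there w∈ , w∈q)    = disj (w , w∈ , w∈q)

      -- The first edge adds only the vertex `start x` to the path, and the other paths avoid it;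
      -- hence the disjointness condition is the same before and after the move.
      disjointSum-move : disjointSum (x ∷ ys) ≈ ∑ (allFin size) (λ e → exitWeight (start x) e * disjointSum (move x e ∷ ys))
      disjointSum-move = ≈-trans (∑-paths-≢ (not-sink (label x)) _)
        (∑-cong (allFin size) λ {e} _ → ∑-continue e (tail e Fin.≟ start x) _ λ p q →
          ≈-trans (*-assoc _ _ _) (*-congˡ (*-congˡ (lift-cong statePaths pathWeight ys λ {zs} over →
            *-congˡ (χ-cong (pairwiseDisjoint? ((x , (e , p , ≡.refl) ◅ q) ∷ zs)) (pairwiseDisjoint? ((move x e , q) ∷ zs))
              (λ { (disj ∷ ds) → All.map (λ d (w , w∈ , w∈′) → d (w , there w∈ , w∈′)) disj ∷ ds })
              (λ { (disj ∷ ds) → All.tabulate (λ {z} z∈ → disjoint-move p q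
                  (≡.subst (proj₁ z ∈_) over (∈.∈-map⁺ proj₁ z∈)) (proj₂ z) (All.lookup disj z∈)) ∷ ds }))))))

      biPlanar-move : ∀ {e} → tail e ≡ start x → All (BiPlanar x) ys → All (BiPlanar (move x e)) ys
      biPlanar-move {e} p bi = All.tabulate λ {y} y∈ → let (xy , yx) = All.lookup bi y∈ in
        (λ i<j a b r q disj → xy i<j a b ((e , p , ≡.refl) ◅ r) q (disjoint-move p r y∈ q disj)) ,
        (λ j<i a b q r disj → yx j<i a b q ((e , p , ≡.refl) ◅ r)
          λ (w , w∈ , w∈′) → disjoint-move p r y∈ q (λ (w , w∈r , w∈q) → disj (w , w∈q , w∈r)) (w , w∈′ , w∈))

  module _ (xs : List State) (distinct : AllPairs _≢start_ xs) (noExit : All (NoExit ∘ start) xs) where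

    M-sink : ∀ {x} y → x ∈ xs → start x ≡ sink (label y) → M x y ≈ 1#
    M-sink {_ , _} y x∈ ≡.refl = ∑-paths-noExit (All.lookup noExit x∈) pathWeight

    M-other : ∀ {x} y → x ∈ xs → start x ≢ sink (label y) → M x y ≈ 0#
    M-other y x∈ ≢sink = ∑-paths-noExit-≢ (All.lookup noExit x∈) ≢sink pathWeight

    distinct-starts : ∀ {x y} → x ∈ xs → y ∈ xs → x ≢ y → start x ≢ start y
    distinct-starts = allPairs-lookup (λ ≢s eq → ≢s (≡.sym eq)) distinct

    -- Then M is the identity matrix.
    allSinks : All (λ x → start x ≡ sink (label x)) xs → det⁻ M xs ≈ disjointSum xs
    allSinks sinks = ≈-trans (det xs id distinct) (≈-sym (≈-trans
      (lift-cong statePaths pathWeight xs λ {ys} over → ≈-trans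
        (*-cong (≈-reflexive (≡.trans (sgn-map ys) (≡.cong sgn over)))
                (χ-yes (pairwiseDisjoint? ys) (disjoint ys id over distinct)))
        (≈-sym (≈-refl {x = sgn xs * 1#})))
      (total xs id)))
      where
      sgn-map : ∀ ys → sgn ys ≡ sgn (map proj₁ ys)
      sgn-map []       = ≡.refl
      sgn-map (_ ∷ ys) = ≡.cong -_ (sgn-map ys)
      det : ∀ ys → (∀ {y} → y ∈ ys → y ∈ xs) → AllPairs _≢start_ ys → det⁻ M ys ≈ sgn ys
      det []       _  _        = ≈-refl
      det (y ∷ ys) ys⊆ (d ∷ ds) = ≈-trans (det⁻-∷ M y ys) (-‿cong (≈-trans
        (∑-cong (splits ys) λ {(us , vs)} p → *-congʳ (≈-trans
          (walks-column M y y us (All.++⁻ˡ us (↭.All-resp-↭ (splits-↭ ys p) (All.tabulate λ {z} z∈ →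
            M-other y (ys⊆ (there z∈)) λ eq → All.lookup d z∈ (≡.trans (All.lookup sinks (ys⊆ (here ≡.refl))) (≡.sym eq))))))
          (≈-trans (*-congˡ (M-sink y (ys⊆ (here ≡.refl)) (All.lookup sinks (ys⊆ (here ≡.refl))))) (*-identityʳ _))))
        (≈-trans (⋆-identityˡ (det⁻ M) ys) (det ys (ys⊆ ∘ there) ds))))
      disjoint : ∀ ys {zs} → (∀ {z} → z ∈ zs → z ∈ xs) → map proj₁ ys ≡ zs → AllPairs _≢start_ zs → AllPairs Disjoint ys
      disjoint []             _   _      _        = []
      disjoint ((y , p) ∷ ys) zs⊆ ≡.refl (d ∷ ds) = All.tabulate (λ {z} z∈ (w , w∈p , w∈q) →
          All.lookup d (∈.∈-map⁺ proj₁ z∈) (≡.trans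
            (≡.sym (noExit-visited p (All.lookup noExit (zs⊆ (here ≡.refl))) w∈p))
            (noExit-visited (proj₂ z) (All.lookup noExit (zs⊆ (there (∈.∈-map⁺ proj₁ z∈)))) w∈q)))
        ∷ disjoint ys (zs⊆ ∘ there) ≡.refl ds
      total : ∀ ys → (∀ {y} → y ∈ ys → y ∈ xs) → lift statePaths pathWeight (λ _ → sgn xs * 1#) ys ≈ sgn xs
      total []       ys⊆ = *-identityʳ _
      total (y ∷ ys) ys⊆ = ≈-trans (∑-cong (statePaths y) λ _ → *-congˡ (total ys (ys⊆ ∘ there)))
        (≈-trans (∑-*ʳ (statePaths y) _) (≈-trans (*-congʳ (M-sink y (ys⊆ (here ≡.refl)) (All.lookup sinks (ys⊆ (here ≡.refl))))) (*-identityˡ _)))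

    module _ {x : State} (x∈ : x ∈ xs) (_◁_ : Rel (Fin n) 0ℓ)
             (◁-irrefl : ∀ {i} → ¬ i ◁ i) (◁-trans : ∀ {i j k} → i ◁ j → j ◁ k → i ◁ k)
             (monotone : ∀ {u y a b} → u ∈ xs → y ∈ xs → label u ◁ label y → start u ≡ sink a → start y ≡ sink b → a ◁ b) where

      -- A walk following the starting points which are sinks has monotone
      -- labels, hence does not return.
      walks-monotone : ∀ {u y} zs → u ∈ xs → y ∈ xs → (∀ {z} → z ∈ zs → z ∈ xs) →
        label u ◁ label y → start u ≡ sink (label y) → label x ◁ label y → walks M y x zs ≈ 0#
      walks-monotone zs = length-induction NoReturn noReturn zs
        where
        NoReturn : List State → Set _
        NoReturn zs = ∀ {u y} → u ∈ xs → y ∈ xs → (∀ {z} → z ∈ zs → z ∈ xs) →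
          label u ◁ label y → start u ≡ sink (label y) → label x ◁ label y → walks M y x zs ≈ 0#
        noReturn : ∀ zs → (∀ {us} → length us ℕ.< length zs → NoReturn us) → NoReturn zs
        noReturn zs ih {u} {y} u∈ y∈ zs⊆ u◁y u↦y x◁y = ≈-trans (walks-step M y x zs)
          (≈-trans (+-cong (≈-trans (*-congˡ return) (zeroʳ _))
            (∑-0 (picks zs) λ {(z , zs′)} p → onward z zs′ (picks-↭ zs p))) (+-identityˡ 0#))
          where
          return : M y x ≈ 0#
          return = M-other x y∈ λ y↦x → ◁-irrefl (◁-trans x◁y (monotone u∈ y∈ u◁y u↦y y↦x))
          onward : ∀ z zs′ → zs ↭ z ∷ zs′ → M y z * walks M z x zs′ ≈ 0#
          onward z zs′ p with start y Fin.≟ sink (label z)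
          ... | no ≢sink = ≈-trans (*-congʳ (M-other z y∈ ≢sink)) (zeroˡ _)
          ... | yes y↦z = ≈-trans (*-congˡ (ih {zs′} (↭-∷⇒< p) y∈
                  (zs⊆ (↭.∈-resp-↭ (↭-sym p) (here ≡.refl))) (zs⊆ ∘ ↭.∈-resp-↭ (↭-sym p) ∘ there)
                  y◁z y↦z (◁-trans x◁y y◁z))) (zeroʳ _)
            where y◁z = monotone u∈ y∈ u◁y u↦y y↦z

    -- No path leads from `start x` to its sink, so the sum over families is empty. On the other
    -- side, a walk must follow the starting points that are sinks; by planarity, applied to trivial
    -- paths, its labels continue in the direction of the first step and never return to `x`.
    notAllSinks : AllPairs BiPlanar xs → ∀ {x ys} → xs ↭ x ∷ ys → start x ≢ sink (label x) → det⁻ M xs ≈ disjointSum xs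
    notAllSinks bi {x} {ys} p ≢sink = ≈-trans
      (≈-trans (det⁻-symmetric M p) (≈-trans (det⁻-∷ M x ys) (≈-trans (-‿cong
        (∑-0 (splits ys) λ {(us , vs)} q → ≈-trans (*-congʳ (closed us (λ z∈ → ∈xs (there (↭.∈-resp-↭ (↭-sym (splits-↭ ys q)) (∈.∈-++⁺ˡ z∈))))))
          (zeroˡ _))) -0#≈0#)))
      (≈-sym (≈-trans (disjointSum-symmetric p) (∑-paths-noExit-≢ (All.lookup noExit x∈) ≢sink _)))
      where
      ∈xs : ∀ {y} → y ∈ x ∷ ys → y ∈ xs
      ∈xs = ↭.∈-resp-↭ (↭-sym p)
      x∈ = ∈xs (here ≡.refl)
      planar : ∀ {u y a b} → u ∈ xs → y ∈ xs → toℕ (label u) ℕ.< toℕ (label y) → start u ≡ sink a → start y ≡ sink b → toℕ a ℕ.< toℕ b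
      planar {u} {y} {a} {b} u∈ y∈ u<y u↦a y↦b =
        proj₁ (allPairs-lookup (λ {x} {y} → biPlanar-sym {x} {y}) bi u∈ y∈ u≢y) u<y a b
          (≡.subst (Path (start u)) u↦a ε) (≡.subst (Path (start y)) y↦b ε)
          λ (w , w∈p , w∈q) → distinct-starts u∈ y∈ u≢y (≡.trans
            (≡.sym (noExit-visited _ (All.lookup noExit u∈) w∈p)) (noExit-visited _ (All.lookup noExit y∈) w∈q))
        where u≢y = λ { ≡.refl → ℕ.<-irrefl ≡.refl u<y }
      closed : ∀ us → (∀ {z} → z ∈ us → z ∈ xs) → walks M x x us ≈ 0#
      closed us us⊆ = ≈-trans (walks-step M x x us) (≈-trans
        (+-cong (≈-trans (*-congˡ (M-other x x∈ ≢sink)) (zeroʳ _)) (∑-0 (picks us) λ {(y , us′)} q → first y us′ (picks-↭ us q)))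
        (+-identityˡ 0#))
        where
        first : ∀ y us′ → us ↭ y ∷ us′ → M x y * walks M y x us′ ≈ 0#
        first y us′ q with start x Fin.≟ sink (label y)
        ... | no ≢sink′ = ≈-trans (*-congʳ (M-other y x∈ ≢sink′)) (zeroˡ _)
        ... | yes x↦y with ℕ.<-cmp (toℕ (label x)) (toℕ (label y))
        ...   | tri≈ _ eq _ = contradiction (≡.trans x↦y (≡.cong sink (≡.sym (Fin.toℕ-injective eq)))) ≢sink
        ...   | tri< x<y _ _ = ≈-trans (*-congˡ (walks-monotone x∈ _<ᶠ_ (ℕ.<-irrefl ≡.refl) ℕ.<-trans planar
                  us′ x∈ y∈ us′⊆ x<y x↦y x<y)) (zeroʳ _)
          where
          y∈ = us⊆ (↭.∈-resp-↭ (↭-sym q) (here ≡.refl))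
          us′⊆ : ∀ {z} → z ∈ us′ → z ∈ xs
          us′⊆ = us⊆ ∘ ↭.∈-resp-↭ (↭-sym q) ∘ there
        ...   | tri> _ _ y<x = ≈-trans (*-congˡ (walks-monotone x∈ (λ i j → j <ᶠ i) (ℕ.<-irrefl ≡.refl)
                  (λ p q → ℕ.<-trans q p) (λ u∈ y∈ y<u u↦ y↦ → planar y∈ u∈ y<u y↦ u↦)
                  us′ x∈ y∈ us′⊆ y<x x↦y y<x)) (zeroʳ _)
          where
          y∈ = us⊆ (↭.∈-resp-↭ (↭-sym q) (here ≡.refl))
          us′⊆ : ∀ {z} → z ∈ us′ → z ∈ xs
          us′⊆ = us⊆ ∘ ↭.∈-resp-↭ (↭-sym q) ∘ there

    stationary : AllPairs BiPlanar xs → det⁻ M xs ≈ disjointSum xs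
    stationary bi with All.all? (λ x → start x Fin.≟ sink (label x)) xs
    ... | yes sinks = allSinks sinks
    ... | no ¬sinks with extract-any (All.¬All⇒Any¬ (λ x → start x Fin.≟ sink (label x)) xs ¬sinks)
    ...   | x , ys , p , ≢sink = notAllSinks bi p ≢sink

  totalRank : List State → ℕ
  totalRank xs = sum (map (rank ∘ start) xs)

  -- Induction on the total rank: a starting point of greatest rank moves along each of its exits,
  -- until two starting points meet or none has an exit. The greatest rank is what keeps the other
  -- paths away from the vertex left behind.
  det⁻≈disjointSum : ∀ k xs → totalRank xs ℕ.≤ k → AllPairs BiPlanar xs → det⁻ M xs ≈ disjointSum xs
  det⁻≈disjointSum k [] _ _ = ≈-sym (*-identityˡ _)
  det⁻≈disjointSum k xs@(_ ∷ _) l bi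
    with allPairs-or-exception {_~_ = _≢start_} (λ x y → ¬? (start x Fin.≟ start y)) xs
  ... | inj₂ (x , y , zs , p , ¬≢) with start x Fin.≟ start y
  ...   | yes eq = meeting p eq
  ...   | no ≢s  = contradiction ≢s ¬≢
  det⁻≈disjointSum k xs@(_ ∷ _) l bi | inj₁ distinct
    with extract-minimal {_≺_ = λ x y → rank (start y) ℕ.< rank (start x)} {P = λ x → x ≡ x}
           (ℕ.<-irrefl ≡.refl) (λ p q → ℕ.<-trans q p)
           (λ x y → rank (start y) ℕ.<? rank (start x)) (λ _ → yes ≡.refl) {xs} (here ≡.refl)
  ... | x , ys , p , _ , top′ with rank (start x) ℕ.≤? 1
  -- If even the topmost starting point has rank at most 1, no starting point has an exit.
  ...   | yes rank≤1 = stationary xs distinct (↭.All-resp-↭ (↭-sym p)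
            (rank≤1⇒noExit rank≤1 ∷ All.map (λ h → rank≤1⇒noExit (ℕ.≤-trans (ℕ.≮⇒≥ (h ≡.refl)) rank≤1)) top′)) bi
  ...   | no rank>1 = begin
      det⁻ M xs
        ≈⟨ det⁻-symmetric M p ⟩
      det⁻ M (x ∷ ys)
        ≈⟨ det⁻-move x not-sink ys ⟩
      ∑ (allFin size) (λ e → exitWeight (start x) e * det⁻ M (move x e ∷ ys))
        ≈⟨ ∑-cong (allFin size) (λ {e} _ → moved k l e) ⟩
      ∑ (allFin size) (λ e → exitWeight (start x) e * disjointSum (move x e ∷ ys))
        ≈⟨ disjointSum-move x not-sink ys distinct-x top ⟨
      disjointSum (x ∷ ys)
        ≈⟨ disjointSum-symmetric p ⟨
      disjointSum xs ∎
    where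
    top : All (λ y → rank (start y) ℕ.≤ rank (start x)) ys
    top = All.map (λ h → ℕ.≮⇒≥ (h ≡.refl)) top′
    -- A sink has no exits, so its rank is 1, from the empty path.
    not-sink : ∀ j → start x ≢ sink j
    not-sink j eq = rank>1 (≡.subst (λ v → rank v ℕ.≤ 1) (≡.sym eq) (≡.subst (ℕ._≤ 1) (≡.sym (rank-step (sink j)))
      (ℕ.s≤s (ℕ.≮⇒≥ λ 0< → case ∑out-≢0 (sink j) rank (λ eq → ℕ.<-irrefl (≡.sym eq) 0<) of
        λ (e , tail≡ , _) → sink-outdegree j e tail≡))))
    distinct-x : All (x ≢start_) ys
    distinct-x = AllPairs.head (AllPairs-resp-↭ (λ ≢s eq → ≢s (≡.sym eq)) p distinct)
    bi′ : AllPairs BiPlanar (x ∷ ys)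
    bi′ = AllPairs-resp-↭ (λ {x} {y} → biPlanar-sym {x} {y}) p bi
    moved : ∀ k → totalRank xs ℕ.≤ k → ∀ e →
      exitWeight (start x) e * det⁻ M (move x e ∷ ys) ≈ exitWeight (start x) e * disjointSum (move x e ∷ ys)
    moved k l e with tail e Fin.≟ start x
    ... | no _ = ≈-trans (zeroˡ _) (≈-sym (zeroˡ _))
    ... | yes tail≡ = *-congˡ (smaller k (ℕ.<-≤-trans (≡.subst (totalRank (move x e ∷ ys) ℕ.<_)
            (≡.sym (ListAction.sum-↭ (↭.map⁺ (rank ∘ start) p)))
            (ℕ.+-monoˡ-< (totalRank ys) (≡.subst (λ v → rank (head e) ℕ.< rank v) tail≡ (rank-decreases e)))) l))
      where
      smaller : ∀ k → totalRank (move x e ∷ ys) ℕ.< k → det⁻ M (move x e ∷ ys) ≈ disjointSum (move x e ∷ ys)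
      smaller (suc k) (ℕ.s≤s l) = det⁻≈disjointSum k (move x e ∷ ys) l
        (biPlanar-move x not-sink ys distinct-x top tail≡ (AllPairs.head bi′) ∷ AllPairs.tail bi′)

  source-planar : ∀ i j → Planar (i , source i) (j , source j)
  source-planar i j i<j a b p q = disjoint⇒< p q i<j

  atSource : Fin n → State
  atSource i = i , source i

  lindström-gessel-viennot : ∀ is → det⁻ M (map atSource is) ≈ disjointSum (map atSource is)
  lindström-gessel-viennot is = det⁻≈disjointSum _ (map atSource is) ℕ.≤-refl (biPlanar is)
    where
    biPlanar : ∀ is → AllPairs BiPlanar (map atSource is)
    biPlanar []       = []
    biPlanar (i ∷ is) = All.map⁺ (All.tabulate λ {j} _ → source-planar i j , source-planar j i) ∷ biPlanar is

-- From fillings of diagrams to sums over words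

unique-++⁻ : ∀ (xs {ys} : List A) → Unique (xs ++ ys) → Unique xs × Unique ys × (∀ {x} → x ∈ xs → x ∉ ys)
unique-++⁻ []       ys!         = [] , ys! , λ ()
unique-++⁻ (x ∷ xs) (x∉ ∷ xys!) with unique-++⁻ xs xys!
... | xs! , ys! , disj = All.++⁻ˡ xs x∉ ∷ xs! , ys! ,
  λ { (here ≡.refl) y∈ → All.lookup (All.++⁻ʳ xs x∉) y∈ ≡.refl ; (there x∈) → disj x∈ }

unique-tabulate⁻ : ∀ {k} {f : Fin k → A} → Unique (tabulate f) → ∀ {i j} → f i ≡ f j → i ≡ j
unique-tabulate⁻ (p ∷ ps) {zero}  {zero}  eq = ≡.refl
unique-tabulate⁻ (p ∷ ps) {zero}  {suc j} eq = contradiction eq (All.tabulate⁻ p j)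
unique-tabulate⁻ (p ∷ ps) {suc i} {zero}  eq = contradiction (≡.sym eq) (All.tabulate⁻ p i)
unique-tabulate⁻ (p ∷ ps) {suc i} {suc j} eq = ≡.cong suc (unique-tabulate⁻ ps eq)

module Fillings (n : ℕ) where

  FillingOf : List ℕ → Set
  FillingOf ks = ∀ (i : Fin (length ks)) → Fin (List.lookup ks i) → Fin n

  rows : ∀ ks → FillingOf ks → List (List (Fin n))
  rows ks U = tabulate (λ i → tabulate (U i))

  InjectiveFilling : ∀ ks → FillingOf ks → Set
  InjectiveFilling ks U = ∀ i j i′ j′ → U i j ≡ U i′ j′ →
    _≡_ {A = Σ (Fin (length ks)) (Fin ∘ List.lookup ks)} (i , j) (i′ , j′)

  injective⇒unique : ∀ ks (U : FillingOf ks) → InjectiveFilling ks U → Unique (concat (rows ks U))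
  injective⇒unique ks U inj = Unique.concat⁺
    (All.tabulate⁺ λ i → Unique.tabulate⁺ λ {j} {j′} eq → case inj i j i j′ eq of λ { ≡.refl → ≡.refl })
    (AllPairs.tabulate⁺ λ {i} {i′} i≢i′ (p , q) → disjoint i i′ i≢i′ (∈.∈-tabulate⁻ p) (∈.∈-tabulate⁻ q))
    where
    disjoint : ∀ i i′ → i ≢ i′ → ∀ {x} → ∃ (λ j → x ≡ U i j) → ∃ (λ j → x ≡ U i′ j) → ⊥
    disjoint i i′ i≢i′ (j , eq) (j′ , eq′) = i≢i′ (≡.cong proj₁ (inj i j i′ j′ (≡.trans (≡.sym eq) eq′)))

  ∈-rows : ∀ ks (U : FillingOf ks) i j → U i j ∈ concat (rows ks U)
  ∈-rows ks U i j = ∈.∈-concat⁺′ (∈.∈-tabulate⁺ j) (∈.∈-tabulate⁺ i)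

  unique⇒injective : ∀ ks (U : FillingOf ks) → Unique (concat (rows ks U)) → InjectiveFilling ks U
  unique⇒injective (k ∷ ks) U U! with unique-++⁻ (tabulate (U zero)) U!
  ... | first , others , disj = λ where
    zero    j zero     j′ eq → ≡.cong (zero ,_) (unique-tabulate⁻ first eq)
    zero    j (suc i′) j′ eq → contradiction (∈-rows ks (U ∘ suc) i′ j′) (disj (≡.subst (_∈ tabulate (U zero)) eq (∈.∈-tabulate⁺ j)))
    (suc i) j zero     j′ eq → contradiction (∈-rows ks (U ∘ suc) i j) (disj (≡.subst (_∈ tabulate (U zero)) (≡.sym eq) (∈.∈-tabulate⁺ j′)))
    (suc i) j (suc i′) j′ eq → case unique⇒injective ks (U ∘ suc) others i j i′ j′ eq of λ { ≡.refl → ≡.refl }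

  unique? : Unary.Decidable (Unique {A = Fin n})
  unique? = AllPairs.allPairs? (λ x y → ¬? (x Fin.≟ y))

module Counting {c ℓ₁ ℓ₂} (R : OrderedCommutativeRing c ℓ₁ ℓ₂) where

  open Calculus R
  open PermutationSums R
  open Posets R
  open TableauSums R

  fromℕ-# : ∀ {p} {P : Unary.Pred A p} (P? : Unary.Decidable P) xs → fromℕ (# P? xs) ≈ ∑ xs (λ x → χ (P? x))
  fromℕ-# P? []       = ≈-refl
  fromℕ-# P? (x ∷ xs) with P? x
  ... | yes _ = +-congˡ (fromℕ-# P? xs)
  ... | no _  = ≈-trans (fromℕ-# P? xs) (≈-sym (+-identityˡ _))

  ∑-filter : ∀ {p} {P : Unary.Pred A p} (P? : Unary.Decidable P) xs {f : A → Carrier} →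
             ∑ (filter P? xs) f ≈ ∑ xs (λ x → χ (P? x) * f x)
  ∑-filter P? []       = ≈-refl
  ∑-filter P? (x ∷ xs) with P? x
  ... | yes _ = +-cong (≈-sym (*-identityˡ _)) (∑-filter P? xs)
  ... | no _  = ≈-trans (∑-filter P? xs) (≈-trans (≈-sym (+-identityˡ _)) (+-congʳ (≈-sym (zeroˡ _))))

  ∑-cartesianProductWith : ∀ {C : Set a} (g : A → B → C) xs ys {f : C → Carrier} →
    ∑ (List.cartesianProductWith g xs ys) f ≈ ∑ xs (λ x → ∑ ys (λ y → f (g x y)))
  ∑-cartesianProductWith g []       ys = ≈-refl
  ∑-cartesianProductWith g (x ∷ xs) ys = ≈-trans (∑-++ (map (g x) ys) _)
    (+-cong (∑-map ys) (∑-cartesianProductWith g xs ys))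

  ∑-choices-suc : ∀ {m} {B : Fin (suc m) → Set b} (xs : ∀ i → List (B i)) {f : (∀ i → B i) → Carrier} →
    ∑ (choices xs) f ≈ ∑ (xs zero) (λ x → ∑ (choices (xs ∘ suc)) (λ g → f (Fin.∀-cons x g)))
  ∑-choices-suc {B = B} xs = ∑-cartesianProductWith (Fin.∀-cons {P = B}) (xs zero) (choices (xs ∘ suc))

  ∑words : List A → ℕ → (List A → Carrier) → Carrier
  ∑words xs zero    f = f []
  ∑words xs (suc k) f = ∑ xs (λ x → ∑words xs k (f ∘ (x ∷_)))

  ∑words-cong : ∀ (xs : List A) k {f g : List A → Carrier} → (∀ u → f u ≈ g u) → ∑words xs k f ≈ ∑words xs k g
  ∑words-cong xs zero    h = h []
  ∑words-cong xs (suc k) h = ∑-cong xs λ {x} _ → ∑words-cong xs k (h ∘ (x ∷_))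

  ∑words-0 : ∀ (xs : List A) k {f : List A → Carrier} → (∀ u → f u ≈ 0#) → ∑words xs k f ≈ 0#
  ∑words-0 xs zero    h = h []
  ∑words-0 xs (suc k) h = ∑-0 xs λ {x} _ → ∑words-0 xs k (h ∘ (x ∷_))

  ∑-choices-words : ∀ k (xs : List A) (f : List A → Carrier) →
    ∑ (choices {n = k} (λ _ → xs)) (f ∘ tabulate) ≈ ∑words xs k f
  ∑-choices-words zero    xs f = +-identityʳ _
  ∑-choices-words (suc k) xs f = ≈-trans (∑-choices-suc (λ _ → xs))
    (∑-cong xs λ {x} _ → ∑-choices-words k xs (f ∘ (x ∷_)))

  ∏rows : (List A → Carrier) → List (List A) → Carrier
  ∏rows ω []       = 1#
  ∏rows ω (r ∷ rs) = ω r * ∏rows ω rs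

  ∑rows : List A → List ℕ → (List (List A) → Carrier) → Carrier
  ∑rows xs []       f = f []
  ∑rows xs (k ∷ ks) f = ∑words xs k (λ u → ∑rows xs ks (f ∘ (u ∷_)))

  ∑rows-0 : ∀ (xs : List A) ks {f : List (List A) → Carrier} → (∀ rs → f rs ≈ 0#) → ∑rows xs ks f ≈ 0#
  ∑rows-0 xs []       h = h []
  ∑rows-0 xs (k ∷ ks) h = ∑words-0 xs k λ u → ∑rows-0 xs ks (h ∘ (u ∷_))

  ∑rows-cong : ∀ (xs : List A) ks {f g : List (List A) → Carrier} → (∀ rs → f rs ≈ g rs) → ∑rows xs ks f ≈ ∑rows xs ks g
  ∑rows-cong xs []       h = h []
  ∑rows-cong xs (k ∷ ks) h = ∑words-cong xs k λ u → ∑rows-cong xs ks (h ∘ (u ∷_))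

  ∑arrangedRows : List ℕ → List A → (List (List A) → Carrier) → Carrier
  ∑arrangedRows []       xs f = f []
  ∑arrangedRows (k ∷ ks) xs f = ∑ (arrangements k xs) (λ (u , zs) → ∑arrangedRows ks zs (f ∘ (u ∷_)))

  ∑arrangedRows-cong : ∀ ks (xs : List A) {f g : List (List A) → Carrier} → (∀ rs → f rs ≈ g rs) →
                       ∑arrangedRows ks xs f ≈ ∑arrangedRows ks xs g
  ∑arrangedRows-cong []       xs h = h []
  ∑arrangedRows-cong (k ∷ ks) xs h = ∑-cong (arrangements k xs) λ {(u , zs)} _ → ∑arrangedRows-cong ks zs (h ∘ (u ∷_))

  ∑-picks-first : ∀ (xs : List A) {f : A → Carrier} → ∑ xs f ≈ ∑ (picks xs) (λ (x , _) → f x)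
  ∑-picks-first []       = ≈-refl
  ∑-picks-first (x ∷ xs) = ≈-trans (+-congˡ (∑-picks-first xs)) (≈-sym (∑-picks-∷ x xs))

  -- The factor `r` accumulates the weights of the rows already placed. The condition on the length
  -- ensures that nothing is left after the last row.
  ∑arrangedRows-∏ : ∀ (ω : List A → Carrier) r ks xs → length xs ≡ sum ks →
    ∑arrangedRows ks xs (λ rs → r * ∏rows ω rs) ≈ r * tableauSum ω ks xs
  ∑arrangedRows-∏ ω r []       []       _  = ≈-refl
  ∑arrangedRows-∏ ω r (k ∷ ks) xs       eq = ≈-trans
    (∑-cong (arrangements k xs) λ {(u , zs)} p → ≈-trans
      (∑arrangedRows-cong ks zs (λ rs → ≈-sym (*-assoc r (ω u) (∏rows ω rs))))
      (≈-trans (∑arrangedRows-∏ ω (r * ω u) ks zs (remaining p)) (*-assoc r (ω u) _)))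
    (∑-*ˡ (arrangements k xs) r)
    where
    remaining : ∀ {u zs} → (u , zs) ∈ arrangements k xs → length zs ≡ sum ks
    remaining {u} {zs} p = ℕ.+-cancelˡ-≡ k _ _ (≡.trans (≡.cong (ℕ._+ length zs) (≡.sym (length-arrangement k xs p)))
      (≡.trans (≡.sym (List.length-++ u)) (≡.trans (≡.sym (↭.↭-length (arrangements-↭ k xs p))) eq)))

  module _ {n : ℕ} where

    open Fillings n

    ∑-fillings : ∀ ks (f : List (List (Fin n)) → Carrier) →
      ∑ (choices {n = length ks} (λ i → choices {n = List.lookup ks i} (λ _ → allFin n))) (λ U → f (rows ks U)) ≈
      ∑rows (allFin n) ks f
    ∑-fillings []       f = +-identityʳ _
    ∑-fillings (k ∷ ks) f = ≈-trans
      (∑-choices-suc {B = λ i → Fin (List.lookup (k ∷ ks) i) → Fin n} (λ i → choices λ _ → allFin n) {f ∘ rows (k ∷ ks)}) (≈-trans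
      (∑-cong (choices {n = k} (λ _ → allFin n)) λ {u} _ → ∑-fillings ks (f ∘ (tabulate u ∷_)))
      (∑-choices-words k (allFin n) (λ u → ∑rows (allFin n) ks (f ∘ (u ∷_)))))

    -- The letters of the words u are chosen one by one, each from the complement xs of the used ones.
    ∑words-unused : ∀ k (g : List (Fin n) → List (Fin n) → Carrier) (h : List (Fin n) → List (Fin n) → Carrier) →
      (∀ {used} u → ¬ Unique used → g used u ≈ 0#) →
      (∀ {used xs} u → xs ++ used ↭ allFin n → g used u ≈ h xs u) →
      ∀ {used xs} → xs ++ used ↭ allFin n →
      ∑words (allFin n) k (λ u → g (u List.ʳ++ used) u) ≈ ∑ (arrangements k xs) (λ (u , zs) → h zs u)
    ∑words-unused zero    g h g-0 g≈h p = ≈-trans (g≈h [] p) (≈-sym (+-identityʳ _))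
    ∑words-unused (suc k) g h g-0 g≈h {used} {xs} p = begin
      ∑ (allFin n) next                                      ≈⟨ ∑-↭ p ⟨
      ∑ (xs ++ used) next                                    ≈⟨ ∑-++ xs used ⟩
      ∑ xs next + ∑ used next                                ≈⟨ +-cong (∑-picks-first xs) (∑-0 used λ y∈ → ∑words-0 (allFin n) k λ u →
                                                                  g-0 _ λ ! → repeated y∈ (suffix u !)) ⟩
      ∑ (picks xs) (λ (y , _) → next y) + 0#                 ≈⟨ +-identityʳ _ ⟩
      ∑ (picks xs) (λ (y , _) → next y)                      ≈⟨ ∑-cong (picks xs) (λ {(y , ys)} q →
                                                                  ∑words-unused k (λ us u → g us (y ∷ u)) (λ zs u → h zs (y ∷ u))
                                                                    (λ u → g-0 (y ∷ u)) (λ u → g≈h (y ∷ u)) (moved y ys q)) ⟩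
      ∑ (picks xs) (λ (y , ys) → ∑ (arrangements k ys) (λ (u , zs) → h zs (y ∷ u)))
                                                             ≈⟨ ∑-arrangements-suc k xs ⟨
      ∑ (arrangements (suc k) xs) (λ (u , zs) → h zs u)      ∎
      where
      next : Fin n → Carrier
      next y = ∑words (allFin n) k (λ u → g (u List.ʳ++ (y ∷ used)) (y ∷ u))
      suffix : ∀ u {vs : List (Fin n)} → Unique (u List.ʳ++ vs) → Unique vs
      suffix u ! = proj₁ (proj₂ (unique-++⁻ u (unique-resp-↭ (↭-sym (↭.++↭ʳ++ u _)) !)))
      repeated : ∀ {y} → y ∈ used → ¬ Unique (y ∷ used)
      repeated y∈ (y∉ ∷ _) = All.lookup y∉ y∈ ≡.refl
      moved : ∀ y ys → (y , ys) ∈ picks xs → ys ++ y ∷ used ↭ allFin n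
      moved y ys q = trans (↭.shift y ys used) (trans (↭.++⁺ʳ used (↭-sym (picks-↭ xs q))) p)

    -- A repeated letter makes the weight vanish, so each letter may be restricted to those not yet
    -- used. Reverse append puts every new letter directly in front of `used`, so that the induction
    -- meets the same form again after each letter and each row.
    ∑rows-unique : ∀ ks (f : List (List (Fin n)) → Carrier) {used xs} → xs ++ used ↭ allFin n →
      ∑rows (allFin n) ks (λ rs → χ (unique? (concat rs List.ʳ++ used)) * f rs) ≈ ∑arrangedRows ks xs f
    ∑rows-unique []       f {used} {xs} p = ≈-trans (*-congʳ (χ-yes (unique? used)
      (proj₁ (proj₂ (unique-++⁻ xs (unique-resp-↭ (↭-sym p) (Unique.allFin⁺ n))))))) (*-identityˡ _)
    ∑rows-unique (k ∷ ks) f {used} p = ≈-trans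
      (∑words-cong (allFin n) k λ u → ∑rows-cong (allFin n) ks λ rs →
        *-congʳ (≈-reflexive (≡.cong (χ ∘ unique?) (List.++-ʳ++ u))))
      (∑words-unused k (λ used u → ∑rows (allFin n) ks (λ rs → χ (unique? (concat rs List.ʳ++ used)) * f (u ∷ rs)))
        (λ xs u → ∑arrangedRows ks xs (f ∘ (u ∷_)))
        (λ {used} u ¬! → ∑rows-0 (allFin n) ks λ rs → ≈-trans (*-congʳ (χ-no (unique? _) λ ! → ¬!
          (proj₁ (proj₂ (unique-++⁻ (concat rs) (unique-resp-↭ (↭-sym (↭.++↭ʳ++ (concat rs) used)) !))))))
          (zeroˡ _))
        (λ u q → ∑rows-unique ks (f ∘ (u ∷_)) q) p)

    -- A condition imposed row by row has a product as its indicator. As the parts are positive, the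
    -- row weight `ω` has to be correct on nonempty words only.
    χ-rows : ∀ {Q : ∀ {k} → (Fin k → Fin n) → Set} (Q? : ∀ {k} (u : Fin k → Fin n) → Dec (Q u)) (ω : List (Fin n) → Carrier) →
      (∀ {k} (u : Fin (suc k) → Fin n) → χ (Q? u) ≈ ω (tabulate u)) →
      ∀ ks → All (0 ℕ.<_) ks → (U : FillingOf ks) (P? : Dec (∀ i → Q (U i))) → χ P? ≈ ∏rows ω (rows ks U)
    χ-rows         Q? ω h []           _          U P? = χ-yes P? λ ()
    χ-rows {Q = Q} Q? ω h (suc k ∷ ks) (_ ∷ pos) U P? = ≈-trans
      (χ-cong P? (Q? (U zero) ×-dec Fin.all? (λ i → Q? (U (suc i)))) (λ q → q zero , q ∘ suc) (λ (q , qs) → Fin.∀-cons q qs))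
      (≈-trans (χ-× (Q? (U zero)) (Fin.all? (λ i → Q? (U (suc i))))) (*-cong (h (U zero)) (χ-rows {Q = Q} Q? ω h ks pos (U ∘ suc) (Fin.all? (λ i → Q? (U (suc i)))))))

    #-tableaux : (lam : Partition n) → let open Partition lam in
      ∀ {Q : ∀ {k} → (Fin k → Fin n) → Set} (Q? : ∀ {k} (u : Fin k → Fin n) → Dec (Q u)) (ω : List (Fin n) → Carrier) →
      (∀ {k} (u : Fin (suc k) → Fin n) → χ (Q? u) ≈ ω (tabulate u)) →
      ∀ {P : Filling lam → Set} (P? : Unary.Decidable P) → (∀ U → P U → ∀ i → Q (U i)) → (∀ U → (∀ i → Q (U i)) → P U) →
      fromℕ (# P? (tableaux lam)) ≈ tableauSum ω parts (allFin n)
    #-tableaux lam {Q} Q? ω h P? to from = begin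
      fromℕ (# P? (tableaux lam))
        ≈⟨ fromℕ-# P? (tableaux lam) ⟩
      ∑ (tableaux lam) (λ U → χ (P? U))
        ≈⟨ ∑-filter (eachOnce? lam) fillings ⟩
      ∑ fillings (λ U → χ (eachOnce? lam U) * χ (P? U))
        -- A filling uses no index twice exactly when the concatenation of its rows has no
        -- repetition; the other condition factors over the rows.
        ≈⟨ ∑-cong fillings (λ {U} _ → *-cong
             (χ-cong (eachOnce? lam U) (unique? (concat (rows parts U))) (injective⇒unique parts U) (unique⇒injective parts U))
             (≈-trans (χ-cong (P? U) (Fin.all? (λ i → Q? (U i))) (to U) (from U)) (χ-rows {Q = Q} Q? ω h parts parts-pos U (Fin.all? (λ i → Q? (U i)))))) ⟩
      ∑ fillings (λ U → weigh (rows parts U))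
        ≈⟨ ∑-fillings parts weigh ⟩
      ∑rows (allFin n) parts weigh
        ≈⟨ ∑rows-cong (allFin n) parts (λ rs → *-congʳ (χ-cong (unique? (concat rs)) (unique? (concat rs List.ʳ++ []))
             (reversed (↭.++↭ʳ++ (concat rs) [])) (reversed′ (↭.++↭ʳ++ (concat rs) [])))) ⟩
      ∑rows (allFin n) parts (λ rs → χ (unique? (concat rs List.ʳ++ [])) * ∏rows ω rs)
        ≈⟨ ∑rows-unique parts (∏rows ω) (↭-reflexive (List.++-identityʳ (allFin n))) ⟩
      ∑arrangedRows parts (allFin n) (∏rows ω)
        ≈⟨ arranged ⟩
      tableauSum ω parts (allFin n) ∎
      where
      open Partition lam
      fillings = choices {n = length parts} (λ i → choices {n = List.lookup parts i} (λ _ → allFin n))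
      weigh : List (List (Fin n)) → Carrier
      weigh rs = χ (unique? (concat rs)) * ∏rows ω rs
      reversed : ∀ {xs ys : List (Fin n)} → xs ++ [] ↭ ys → Unique xs → Unique ys
      reversed {xs} p = unique-resp-↭ (trans (↭-reflexive (≡.sym (List.++-identityʳ xs))) p)
      reversed′ : ∀ {xs ys : List (Fin n)} → xs ++ [] ↭ ys → Unique ys → Unique xs
      reversed′ {xs} p = unique-resp-↭ (trans (↭-sym p) (↭-reflexive (List.++-identityʳ xs)))
      arranged : ∑arrangedRows parts (allFin n) (∏rows ω) ≈ tableauSum ω parts (allFin n)
      arranged = ≈-trans (∑arrangedRows-cong parts (allFin n) λ _ → ≈-sym (*-identityˡ _)) (≈-trans
        (∑arrangedRows-∏ ω 1# parts (allFin n) (≡.trans (length-allFin n) (≡.sym sum-parts))) (*-identityˡ _))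

-- Row conditions as weights of words

module RowPredicates {c ℓ₁ ℓ₂} (R : OrderedCommutativeRing c ℓ₁ ℓ₂) where

  open Calculus R
  open PermutationSums R
  open Posets R
  open TableauSums R

  module _ {A : Set} {V : Rel A 0ℓ} (V? : Decidable V) where

    Along : A → List A → A → Set
    Along x []      z = V x z
    Along x (y ∷ u) z = V x y × Along y u z

    along? : ∀ x u z → Dec (Along x u z)
    along? x []      z = V? x z
    along? x (y ∷ u) z = V? x y ×-dec along? y u z

    χ-along : ∀ x u z → χ (along? x u z) ≈ walk (λ x y → χ (V? x y)) x u z
    χ-along x []      z = ≈-refl
    χ-along x (y ∷ u) z = ≈-trans (χ-× (V? x y) (along? y u z)) (*-congˡ (χ-along y u z))

    -- With the target `z` of the last step kept as a separate argument, the cyclic condition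
    -- survives the removal of the first entry.
    Steps : ∀ {k} → (Fin k → A) → A → Set
    Steps {k} U z = (∀ j j′ → Consecutive j j′ → V (U j) (U j′)) × (∀ j → suc (toℕ j) ≡ k → V (U j) z)

    along⇒steps : ∀ k (U : Fin (suc k) → A) z → Along (U zero) (tabulate (U ∘ suc)) z → Steps U z
    along⇒steps zero    U z v       = (λ { zero zero () }) , λ { zero _ → v }
    along⇒steps (suc k) U z (v , r) with along⇒steps k (U ∘ suc) z r
    ... | inner , last =
      (λ { zero    zero          ()
         ; zero    (suc zero)    _  → v
         ; zero    (suc (suc _)) ()
         ; (suc j) zero          ()
         ; (suc j) (suc j′)      eq → inner j j′ (ℕ.suc-injective eq) }) ,
      λ { zero () ; (suc j) eq → last j (ℕ.suc-injective eq) }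

    steps⇒along : ∀ k (U : Fin (suc k) → A) z → Steps U z → Along (U zero) (tabulate (U ∘ suc)) z
    steps⇒along zero    U z (_ , last)     = last zero ≡.refl
    steps⇒along (suc k) U z (inner , last) = inner zero (suc zero) ≡.refl ,
      steps⇒along k (U ∘ suc) z ((λ j j′ eq → inner (suc j) (suc j′) (≡.cong suc eq)) , λ j eq → last (suc j) (≡.cong suc eq))

    χ-closed : ∀ {k} (U : Fin (suc k) → A) {P : Set} (P? : Dec P) → (P → Steps U (U zero)) → (Steps U (U zero) → P) →
               χ P? ≈ closedWalk (λ x y → χ (V? x y)) (tabulate U)
    χ-closed {k} U P? to from = ≈-trans
      (χ-cong P? (along? (U zero) (tabulate (U ∘ suc)) (U zero)) (steps⇒along k U (U zero) ∘ to) (from ∘ along⇒steps k U (U zero)))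
      (χ-along (U zero) (tabulate (U ∘ suc)) (U zero))

  χ-cylindrical : ∀ {n k} (w : Fin n → Fin n) (U : Fin (suc k) → Fin n) →
    χ (cylindrical? w U) ≈ closedWalk (λ x y → χ (w x Fin.≟ y)) (tabulate U)
  χ-cylindrical w U = χ-closed (λ x y → w x Fin.≟ y) U (cylindrical? w U)
    (λ cyl → (λ j j′ eq → cyl j j′ (inj₁ eq)) , λ j eq → cyl j zero (inj₂ (eq , ≡.refl)))
    (λ (inner , last) → λ { j j′ (inj₁ eq) → inner j j′ eq
                          ; j zero (inj₂ (eq , _)) → last j eq
                          ; j (suc _) (inj₂ (_ , ())) })

  module _ {A : Set} {_<_ : Rel A 0ℓ} (_<?_ : Decidable _<_) where

    open PTableaux _<?_

    χ-cyclicallyRowSemistrict : ∀ {k} (U : Fin (suc k) → A) →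
      χ (cyclicallyRowSemistrict? U) ≈ closedWalk (λ x y → χ (¬? (y <? x))) (tabulate U)
    χ-cyclicallyRowSemistrict U = χ-closed (λ x y → ¬? (y <? x)) U (cyclicallyRowSemistrict? U)
      (λ (inner , last) → inner , λ j eq → last j zero (eq , ≡.refl))
      (λ (inner , last) → inner , λ { j zero (eq , _) → last j eq ; j (suc _) (_ , ()) })

    module _ (<-irrefl : ∀ {x} → ¬ x < x) (<-trans : ∀ {x y z} → x < y → y < z → x < z) where

      RecordFreeAfter : A → List A → List A → Set
      RecordFreeAfter x us []      = ⊤
      RecordFreeAfter x us (y ∷ u) = (¬ y < x × ¬ All (_< y) us) × RecordFreeAfter y (y ∷ us) u

      recordFreeAfter? : ∀ x us u → Dec (RecordFreeAfter x us u)
      recordFreeAfter? x us []      = yes tt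
      recordFreeAfter? x us (y ∷ u) = (¬? (y <? x) ×-dec ¬? (All.all? (_<? y) us)) ×-dec recordFreeAfter? y (y ∷ us) u

      recordFreeRow : List A → Carrier
      recordFreeRow []      = 1#
      recordFreeRow (x ∷ u) = recordFreeSemistrict _<?_ <-irrefl <-trans x (x ∷ []) u

      χ-recordFreeAfter : ∀ x us u → χ (recordFreeAfter? x us u) ≈ recordFreeSemistrict _<?_ <-irrefl <-trans x us u
      χ-recordFreeAfter x us []      = ≈-refl
      χ-recordFreeAfter x us (y ∷ u) = ≈-trans
        (χ-× (¬? (y <? x) ×-dec ¬? (All.all? (_<? y) us)) (recordFreeAfter? y (y ∷ us) u))
        (*-cong (χ-× (¬? (y <? x)) (¬? (All.all? (_<? y) us))) (χ-recordFreeAfter y (y ∷ us) u))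

      -- The list `us` holds the entries already removed from the front of the row, which a record
      -- has to exceed as well.
      RecordFreeFrom : ∀ {k} → List A → (Fin k → A) → Set
      RecordFreeFrom us U = ∀ j → toℕ j ≢ 0 → ¬ (All (_< U j) us × (∀ i → i <ᶠ j → U i < U j))

      after⇒rows : ∀ k us (U : Fin (suc k) → A) → RecordFreeAfter (U zero) (U zero ∷ us) (tabulate (U ∘ suc)) →
                   RowSemistrict U × RecordFreeFrom us U
      after⇒rows zero    us U _ = (λ { zero zero () }) , λ { zero ≢0 → contradiction ≡.refl ≢0 }
      after⇒rows (suc k) us U ((semi , rec) , r) with after⇒rows k (U zero ∷ us) (U ∘ suc) r
      ... | inner , free =
        (λ { zero    zero          ()
           ; zero    (suc zero)    _  → semi
           ; zero    (suc (suc _)) ()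
           ; (suc j) zero          ()
           ; (suc j) (suc j′)      eq → inner j j′ (ℕ.suc-injective eq) }) ,
        λ { zero          ≢0 _            → ≢0 ≡.refl
          ; (suc zero)    _  (below , hd) → rec (hd zero (ℕ.s≤s ℕ.z≤n) ∷ below)
          ; (suc (suc j)) _  (below , hd) → free (suc j) (λ ()) (hd zero (ℕ.s≤s ℕ.z≤n) ∷ below , λ i i<j → hd (suc i) (ℕ.s≤s i<j)) }

      rows⇒after : ∀ k us (U : Fin (suc k) → A) → RowSemistrict U × RecordFreeFrom us U →
                   RecordFreeAfter (U zero) (U zero ∷ us) (tabulate (U ∘ suc))
      rows⇒after zero    us U _              = tt
      rows⇒after (suc k) us U (inner , free) =
        (inner zero (suc zero) ≡.refl ,
         λ { (hd ∷ below) → free (suc zero) (λ ()) (below , λ { zero _ → hd ; (suc i) (ℕ.s≤s ()) }) }) ,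
        rows⇒after k (U zero ∷ us) (U ∘ suc)
          ((λ j j′ eq → inner (suc j) (suc j′) (≡.cong suc eq)) ,
           λ j _ → λ { (hd ∷ below , rest) → free (suc j) (λ ()) (below ,
             λ { zero _ → hd ; (suc i) (ℕ.s≤s i<j) → rest i i<j }) })

      χ-recordFree : ∀ {k} (U : Fin (suc k) → A) →
        χ (recordFree? U ×-dec rowSemistrict? U) ≈ recordFreeRow (tabulate U)
      χ-recordFree {k} U = ≈-trans
        (χ-cong (recordFree? U ×-dec rowSemistrict? U) (recordFreeAfter? (U zero) (U zero ∷ []) (tabulate (U ∘ suc)))
          (λ (free , inner) → rows⇒after k [] U (inner , λ j ≢0 (_ , below) → free j ≢0 below))
          (λ r → let (inner , free) = after⇒rows k [] U r in (λ j ≢0 below → free j ≢0 ([] , below)) , inner))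
        (χ-recordFreeAfter (U zero) (U zero ∷ []) (tabulate (U ∘ suc)))

      ∑perm-recordFreeRow : ∀ xs → ∑perm xs recordFreeRow ≈ ∑perm xs (closedWalk (semistrict _<?_ <-irrefl <-trans))
      ∑perm-recordFreeRow xs = ≈-trans (∑perm-step xs recordFreeRow) (≈-trans
        (+-congˡ (∑-cong (picks xs) λ {(x , ys)} _ → recordFree≋walks _<?_ <-irrefl <-trans x ys))
        (≈-sym (∑perm-step xs _)))

-- Path families as choices, and relabelling

module FamilySums {c ℓ₁ ℓ₂} (R : OrderedCommutativeRing c ℓ₁ ℓ₂) where

  open OrderedCommutativeRing R using (∏)
  open Calculus R
  open PermutationSums R
  open TableauSums R
  open Lifting R
  open Counting R

  ∑-choices-∏ : ∀ {m} {B : Fin m → Set b} (xs : ∀ i → List (B i)) (f : ∀ i → B i → Carrier) →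
    ∑ (choices xs) (λ π → ∏ (λ i → f i (π i))) ≈ ∏ (λ i → ∑ (xs i) (f i))
  ∑-choices-∏ {m = zero}          xs f = +-identityʳ _
  ∑-choices-∏ {m = suc m} {B = B} xs f = ≈-trans (∑-choices-suc {B = B} xs) (≈-trans
    (∑-cong (xs zero) λ {x} _ → ≈-trans (∑-*ˡ (choices (xs ∘ suc)) (f zero x)) (*-congˡ (∑-choices-∏ (xs ∘ suc) (f ∘ suc))))
    (∑-*ʳ (xs zero) _))

  module _ {X : Set a} {B : X → Set b} (fibre : ∀ x → List (B x)) (wt : ∀ {x} → B x → Carrier) where

    -- Connects families given as functions with the recursive choices over a list of indices.
    ∑-choices-lift : ∀ {m} (ι : Fin m → X) (f : List (Σ X B) → Carrier) →
      ∑ (choices (λ i → fibre (ι i))) (λ π → ∏ (λ i → wt (π i)) * f (tabulate (λ i → ι i , π i))) ≈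
      lift fibre wt f (tabulate ι)
    ∑-choices-lift {zero}  ι f = ≈-trans (+-identityʳ _) (*-identityˡ _)
    ∑-choices-lift {suc m} ι f = ≈-trans (∑-choices-suc {B = B ∘ ι} (λ i → fibre (ι i))) (∑-cong (fibre (ι zero)) λ {x} _ → ≈-trans
      (∑-cong (choices (λ i → fibre (ι (suc i)))) λ _ → *-assoc _ _ _)
      (≈-trans (∑-*ˡ (choices (λ i → fibre (ι (suc i)))) (wt x))
        (*-congˡ (∑-choices-lift (ι ∘ suc) (f ∘ ((ι zero , x) ∷_))))))

    lift-map : ∀ {Y : Set a} (g : Y → X) (f : List (Σ X B) → Carrier) ys →
      lift fibre wt f (map g ys) ≈ lift (fibre ∘ g) wt (f ∘ map (λ (y , x) → g y , x)) ys
    lift-map g f []       = ≈-refl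
    lift-map g f (y ∷ ys) = ∑-cong (fibre (g y)) λ {x} _ → *-congˡ (lift-map g (f ∘ ((g y , x) ∷_)) ys)

  module _ {A : Set a} {B : Set b} (g : A → B) (M : B → B → Carrier) where

    private
      M′ : A → A → Carrier
      M′ x y = M (g x) (g y)

    walk-map : ∀ x u z → walk M′ x u z ≈ walk M (g x) (map g u) (g z)
    walk-map x []      z = ≈-refl
    walk-map x (y ∷ u) z = *-congˡ (walk-map y u z)

    closedWalk-map : ∀ u → closedWalk M′ u ≈ closedWalk M (map g u)
    closedWalk-map []      = ≈-refl
    closedWalk-map (x ∷ u) = walk-map x u x

    walks-map : ∀ x z ys → walks M′ x z ys ≈ walks M (g x) (g z) (map g ys)
    walks-map x z ys = ≈-trans (∑-cong (arrangements (length ys) ys) λ {(u , _)} _ → walk-map x u z)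
      (≈-trans (≈-sym (∑-arrangements-map g (length ys) ys {λ u _ → walk M (g x) u (g z)}))
        (≈-reflexive (≡.cong (λ k → ∑ (arrangements k (map g ys)) (λ (u , _) → walk M (g x) u (g z)))
          (≡.sym (List.length-map g ys)))))

    ⋆-map : ∀ (φ ψ : List B → Carrier) xs → ((φ ∘ map g) ⋆ (ψ ∘ map g)) xs ≈ (φ ⋆ ψ) (map g xs)
    ⋆-map φ ψ []       = ≈-refl
    ⋆-map φ ψ (x ∷ xs) = ≈-trans (⋆-∷ (φ ∘ map g) (ψ ∘ map g) x xs)
      (≈-trans (+-cong (⋆-map (φ ∘ (g x ∷_)) ψ xs) (⋆-map φ (ψ ∘ (g x ∷_)) xs)) (≈-sym (⋆-∷ φ ψ (g x) (map g xs))))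

    det⁻ₖ-map : ∀ k xs → det⁻ₖ M′ k xs ≈ det⁻ₖ M k (map g xs)
    det⁻ₖ-map zero    []       = ≈-refl
    det⁻ₖ-map zero    (x ∷ xs) = ≈-refl
    det⁻ₖ-map (suc k) []       = ≈-refl
    det⁻ₖ-map (suc k) (x ∷ xs) = -‿cong (≈-trans (⋆-cong (walks-map x x) (det⁻ₖ-map k) xs)
      (⋆-map (walks M (g x) (g x)) (det⁻ₖ M k) xs))

    det⁻-map : ∀ xs → det⁻ M′ xs ≈ det⁻ M (map g xs)
    det⁻-map xs = ≈-trans (det⁻ₖ-map (length xs) xs)
      (≈-reflexive (≡.cong (λ k → det⁻ₖ M k (map g xs)) (≡.sym (List.length-map g xs))))

-- The order on paths and the semistrict tableaux

module PathTableaux {c ℓ₁ ℓ₂} (R : OrderedCommutativeRing c ℓ₁ ℓ₂) {n : ℕ} (N : PlanarNetwork R n) where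

  open Calculus R
  open PermutationSums R
  open Posets R
  open TableauSums R
  open Lifting R
  open Counting R
  open RowPredicates R
  open FamilySums R
  open PlanarNetwork N
  open Planarity digraph terminal embedding using (visited-start; disjoint⇒<)
  open DisjointPaths R N using (source; sink; atSource; M; Disjoint; pairwiseDisjoint?; signedDisjoint; disjointSum;
    statePaths; lindström-gessel-viennot)

  IndexedPath : Set
  IndexedPath = Σ (Fin n) (λ i → Path (source i) (sink i))

  -- A single order on all indexed paths, which induces the order of P(π) for every family at once.
  -- The 0-1 matrix `S` is therefore the same for all families, as the lifting requires.
  _≺_ : Rel IndexedPath 0ℓ
  (i , p) ≺ (j , q) = i <ᶠ j × ¬ Intersect p q

  _≺?_ : Decidable _≺_
  (i , p) ≺? (j , q) = (i Fin.<? j) ×-dec ¬? (intersect? p q)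

  ≺-irrefl : ∀ {x} → ¬ x ≺ x
  ≺-irrefl (i<i , _) = ℕ.<-irrefl ≡.refl i<i

  crossover : ∀ {u v u′ v′ w} (p : Path u v) (q : Path u′ v′) → w ∈ visited p → w ∈ visited q →
              ∃ λ (r : Path u v′) → ∀ {x} → x ∈ visited r → x ∈ visited p ⊎ x ∈ visited q
  crossover {u = u} p q w∈p w∈q = go p w∈p
    where
    suffix : ∀ {u v w} (q : Path u v) → w ∈ visited q → ∃ λ (r : Path w v) → ∀ {x} → x ∈ visited r → x ∈ visited q
    suffix ε       (here ≡.refl) = ε , id
    suffix (e ◅ q) (here ≡.refl) = e ◅ q , id
    suffix (e ◅ q) (there w∈)    = let (r , sub) = suffix q w∈ in r , there ∘ sub
    go : ∀ {u v} (p : Path u v) → _ ∈ visited p → ∃ λ (r : Path u _) → ∀ {x} → x ∈ visited r → x ∈ visited p ⊎ x ∈ visited q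
    go ε       (here ≡.refl) = let (r , sub) = suffix q w∈q in r , inj₂ ∘ sub
    go (_ ◅ _) (here ≡.refl) = let (r , sub) = suffix q w∈q in r , inj₂ ∘ sub
    go (e ◅ p) (there w∈)    = let (r , sub) = go p w∈ in e ◅ r ,
      λ { (here eq) → inj₁ (here eq) ; (there x∈) → case sub x∈ of λ { (inj₁ x∈p) → inj₁ (there x∈p) ; (inj₂ x∈q) → inj₂ x∈q } }

  -- A path between p and r separates them: otherwise it would be disjoint from
  -- a path from the beginning of p to the end of r.
  ≺-trans : ∀ {x y z} → x ≺ y → y ≺ z → x ≺ z
  ≺-trans {i , p} {j , q} {k , r} (i<j , p#q) (j<k , q#r) = ℕ.<-trans i<j j<k , λ (w , w∈p , w∈r) →
    let (s′ , sub) = crossover p r w∈p w∈r in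
    ℕ.<-asym j<k (disjoint⇒< s′ q i<j λ (x , x∈s , x∈q) →
      case sub x∈s of λ { (inj₁ x∈p) → p#q (x , x∈p , x∈q) ; (inj₂ x∈r) → q#r (x , x∈q , x∈r) })

  S : IndexedPath → IndexedPath → Carrier
  S = semistrict _≺?_ ≺-irrefl ≺-trans

  toStatePath : IndexedPath → Σ (Fin n × Vertex) (λ x → Path (proj₂ x) (sink (proj₁ x)))
  toStatePath (i , p) = atSource i , p

  -- Indexed paths are comparable exactly when they are disjoint: different indices are always in
  -- some order, and paths of the same index share their source.
  signedChain≈signedDisjoint : ∀ ys → signedChain _≺?_ ≺-irrefl ≺-trans ys ≈ signedDisjoint (map toStatePath ys)
  signedChain≈signedDisjoint ys = *-cong (sgn-map ys)
    (χ-cong (chain? _≺?_ ≺-irrefl ≺-trans ys) (pairwiseDisjoint? (map toStatePath ys))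
      (AllPairs.map⁺ ∘ AllPairs.map (λ {x} {y} → disjoint x y)) (AllPairs.map (λ {x} {y} → comparable x y) ∘ AllPairs.map⁻))
    where
    sgn-map : ∀ ys → sgn ys ≈ sgn (map toStatePath ys)
    sgn-map []       = ≈-refl
    sgn-map (_ ∷ ys) = -‿cong (sgn-map ys)
    disjoint : ∀ x y → x ≺ y ⊎ y ≺ x → Disjoint (toStatePath x) (toStatePath y)
    disjoint x y (inj₁ (_ , p#q)) = p#q
    disjoint x y (inj₂ (_ , q#p)) (w , w∈p , w∈q) = q#p (w , w∈q , w∈p)
    comparable : ∀ x y → Disjoint (toStatePath x) (toStatePath y) → x ≺ y ⊎ y ≺ x
    comparable (i , p) (j , q) p#q with Fin.<-cmp i j
    ... | tri< i<j _ _      = inj₁ (i<j , p#q)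
    ... | tri> _ _ j<i      = inj₂ (j<i , λ (w , w∈q , w∈p) → p#q (w , w∈p , w∈q))
    ... | tri≈ _ ≡.refl _   = contradiction (source i , visited-start p , visited-start q) p#q

  loops : ∀ i → List (Path (source i) (sink i))
  loops i = sourceSinkPaths i i

  lift-det⁻ : ∀ is → lift loops pathWeight (det⁻ S) is ≈ det⁻ pathMatrix is
  lift-det⁻ is = begin
    lift loops pathWeight (det⁻ S) is
      ≈⟨ lift-cong loops pathWeight is (λ {ys} _ → ≈-trans (det⁻-semistrict _≺?_ ≺-irrefl ≺-trans ys) (signedChain≈signedDisjoint ys)) ⟩
    lift loops pathWeight (signedDisjoint ∘ map toStatePath) is
      ≈⟨ lift-map statePaths pathWeight atSource signedDisjoint is ⟨
    disjointSum (map atSource is)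
      ≈⟨ lindström-gessel-viennot is ⟨
    det⁻ M (map atSource is)
      ≈⟨ det⁻-map atSource M is ⟨
    det⁻ pathMatrix is ∎

  lift-tableauSum-S : ∀ ks is →
    lift loops pathWeight (tableauSum (closedWalk S) ks) is ≈ tableauSum (closedWalk pathMatrix) ks is
  lift-tableauSum-S = lift-tableauSum loops pathWeight
    (lift-closedWalk loops pathWeight pathMatrix S (det⁻⇒LiftedWalks loops pathWeight pathMatrix S lift-det⁻))

  module _ (lam : Partition n) where

    open Partition lam

    module _ (π : Family id) where

      item : Fin n → IndexedPath
      item i = i , π i

      #cyclicallyRowSemistrict≈ : fromℕ (#cyclicallyRowSemistrict lam π) ≈ tableauSum (closedWalk S) parts (map item (allFin n))
      #cyclicallyRowSemistrict≈ = ≈-trans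
        (#-tableaux lam (PTableaux.cyclicallyRowSemistrict? (order? π)) (closedWalk S ∘ map item)
          (λ u → ≈-trans (χ-cyclicallyRowSemistrict (order? π) u) (closedWalk-map item S (tabulate u)))
          _ (λ _ → id) (λ _ → id))
        (tableauSum-map item (closedWalk S) parts (allFin n))

      #recordFreeRowSemistrict≈ : fromℕ (#recordFreeRowSemistrict lam π) ≈ tableauSum (closedWalk S) parts (map item (allFin n))
      #recordFreeRowSemistrict≈ = ≈-trans
        (#-tableaux lam (λ u → PTableaux.recordFree? (order? π) u ×-dec PTableaux.rowSemistrict? (order? π) u)
          (recordFreeRow _≺?_ ≺-irrefl ≺-trans ∘ map item)
          (λ u → ≈-trans (χ-cong (PTableaux.recordFree? (order? π) u ×-dec PTableaux.rowSemistrict? (order? π) u)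
              (PTableaux.recordFree? _≺?_ (item ∘ u) ×-dec PTableaux.rowSemistrict? _≺?_ (item ∘ u)) id id)
            (≈-trans (χ-recordFree _≺?_ ≺-irrefl ≺-trans (item ∘ u))
              (≈-reflexive (≡.cong (recordFreeRow _≺?_ ≺-irrefl ≺-trans) (≡.sym (List.map-tabulate u item))))))
          _ (λ _ (free , semi) i → free i , semi i) (λ _ q → proj₁ ∘ q , proj₂ ∘ q))
        (≈-trans (tableauSum-map item (recordFreeRow _≺?_ ≺-irrefl ≺-trans) parts (allFin n))
          (tableauSum-cong (∑perm-recordFreeRow _≺?_ ≺-irrefl ≺-trans) parts (map item (allFin n))))

    ∑-families-tableauSum : ∀ (count : Family id → ℕ) →
      (∀ π → fromℕ (count π) ≈ tableauSum (closedWalk S) parts (map (item π) (allFin n))) →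
      ∑ (families id) (λ π → wgt π * fromℕ (count π)) ≈ tableauSum (closedWalk pathMatrix) parts (allFin n)
    ∑-families-tableauSum count h = begin
      ∑ (families id) (λ π → wgt π * fromℕ (count π))
        ≈⟨ ∑-cong (families id) (λ {π} _ → *-congˡ (≈-trans (h π)
             (≈-reflexive (≡.cong (tableauSum (closedWalk S) parts) (List.map-tabulate id (item π)))))) ⟩
      ∑ (families id) (λ π → wgt π * tableauSum (closedWalk S) parts (tabulate (item π)))
        ≈⟨ ∑-choices-lift loops pathWeight id (tableauSum (closedWalk S) parts) ⟩
      lift loops pathWeight (tableauSum (closedWalk S) parts) (allFin n)
        ≈⟨ lift-tableauSum-S parts (allFin n) ⟩
      tableauSum (closedWalk pathMatrix) parts (allFin n) ∎

-- Cycles of a permutation and the constant z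

module _ {w : A → A} where

  private
    _^_ : A → ℕ → A
    x ^ m = ℕ.iterate w x m

  iterate-+ : ∀ a b x → x ^ (a ℕ.+ b) ≡ (x ^ a) ^ b
  iterate-+ zero    b x = ≡.refl
  iterate-+ (suc a) b x = iterate-+ a b (w x)

  iterate-injective : (∀ {x y} → w x ≡ w y → x ≡ y) → ∀ m {x y} → x ^ m ≡ y ^ m → x ≡ y
  iterate-injective inj zero    eq = eq
  iterate-injective inj (suc m) eq = inj (iterate-injective inj m eq)

  list-iterate : ∀ x m → List.iterate w x m ≡ List.applyUpTo (x ^_) m
  list-iterate x zero    = ≡.refl
  list-iterate x (suc m) = ≡.cong (x ∷_) (list-iterate (w x) m)

least : ∀ {p} {P : Unary.Pred ℕ p} → Unary.Decidable P → ∀ m → P m → ∃ λ k → k ℕ.≤ m × P k × (∀ {j} → j ℕ.< k → ¬ P j)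
least P? zero    Pm = zero , ℕ.z≤n , Pm , λ ()
least P? (suc m) Pm with P? 0
... | yes P0 = zero , ℕ.z≤n , P0 , λ ()
... | no ¬P0 with least (P? ∘ suc) m Pm
...   | k , k≤m , Pk , below = suc k , ℕ.s≤s k≤m , Pk , λ { {zero} _ → ¬P0 ; {suc j} (ℕ.s≤s j<k) → below j<k }

unique-≐⇒↭ : ∀ {xs ys : List A} → Unique xs → Unique ys →
             (∀ {x} → x ∈ xs → x ∈ ys) → (∀ {x} → x ∈ ys → x ∈ xs) → xs ↭ ys
unique-≐⇒↭ {xs = xs} {ys} xs! ys! xs⊆ ys⊆ with ℕ.≤-total (length xs) (length ys)
... | inj₁ l = unique-⊆⇒↭ ys! ys⊆ l
... | inj₂ l = ↭-sym (unique-⊆⇒↭ xs! xs⊆ l)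

concat-↭ : ∀ {xss yss : List (List A)} → xss ↭ yss → concat xss ↭ concat yss
concat-↭ refl           = ↭-refl
concat-↭ (prep xs p)    = ↭.++⁺ˡ xs (concat-↭ p)
concat-↭ (swap {xss} xs ys p) = trans (↭.shifts xs ys) (↭.++⁺ˡ ys (↭.++⁺ˡ xs (concat-↭ p)))
concat-↭ (trans p q)    = trans (concat-↭ p) (concat-↭ q)

Trajectory : (A → A) → A → List A → A → Set _
Trajectory w x []      z = w x ≡ z
Trajectory w x (y ∷ u) z = w x ≡ y × Trajectory w y u z

-- The list `Z` gives the support in any order. A trajectory is demanded from every element, because
-- a row of a tableau may begin at any of them.
IsCycle : (A → A) → List A → Set _
IsCycle w Z = (∃ λ c → c ∈ Z) × (∀ {c} → c ∈ Z → ∃ λ Y → Z ↭ c ∷ Y × Trajectory w c Y c)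

module CycleDecomposition {n : ℕ} (w : Fin n → Fin n) (w-injective : ∀ {x y} → w x ≡ w y → x ≡ y) where

  _^_ : Fin n → ℕ → Fin n
  x ^ m = ℕ.iterate w x m

  private
    -- Two of the first n + 1 iterates coincide, and injectivity cancels the steps common to both.
    returns : ∀ x → ∃ λ m → m ℕ.< n × x ^ suc m ≡ x
    returns x with Fin.pigeonhole (ℕ.n<1+n n) (λ j → x ^ toℕ j)
    ... | a , b , a<b , eq = m , ℕ.≤-trans (ℕ.m≤m+n (suc m) (toℕ a)) (ℕ.≤-trans (ℕ.≤-reflexive b≡) (Fin.toℕ≤pred[n] b)) ,
      iterate-injective w-injective (toℕ a) (≡.trans (≡.sym (iterate-+ (suc m) (toℕ a) x)) (≡.trans (≡.cong (x ^_) b≡) (≡.sym eq)))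
      where
      m = toℕ b ℕ.∸ suc (toℕ a)
      b≡ : suc m ℕ.+ toℕ a ≡ toℕ b
      b≡ = ≡.trans (≡.sym (ℕ.+-suc m (toℕ a))) (ℕ.m∸n+n≡m a<b)

    -- The cycle has length `suc k`, so that `k` is the number of elements besides `x`.
    period : ∀ x → ∃ λ k → k ℕ.< n × x ^ suc k ≡ x × (∀ {j} → j ℕ.< k → x ^ suc j ≢ x)
    period x with returns x
    ... | m , m<n , eq with least (λ j → x ^ suc j Fin.≟ x) m eq
    ...   | k , k≤m , eq′ , below = k , ℕ.≤-<-trans k≤m m<n , eq′ , below

  module _ (x : Fin n) where

    private
      k = proj₁ (period x)
      k<n = proj₁ (proj₂ (period x))
      return = proj₁ (proj₂ (proj₂ (period x)))
      minimal = proj₂ (proj₂ (proj₂ (period x)))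

    rest : List (Fin n)
    rest = List.iterate w (w x) k

    trajectory-rest : Trajectory w x rest x
    trajectory-rest = go k x return
      where
      go : ∀ k y {z} → y ^ suc k ≡ z → Trajectory w y (List.iterate w (w y) k) z
      go zero    y eq = eq
      go (suc k) y eq = ≡.refl , go k (w y) eq

    reduce : ∀ j → ∃ λ j′ → j′ ℕ.≤ k × x ^ j ≡ x ^ j′
    reduce j = go j j ℕ.≤-refl
      where
      go : ∀ fuel j → j ℕ.≤ fuel → ∃ λ j′ → j′ ℕ.≤ k × x ^ j ≡ x ^ j′
      go fuel j j≤ with j ℕ.≤? k
      ... | yes j≤k = j , j≤k , ≡.refl
      go zero       j j≤ | no j≰k = contradiction (ℕ.≤-trans j≤ ℕ.z≤n) j≰k
      go (suc fuel) j j≤ | no j≰k with go fuel (j ℕ.∸ suc k) (ℕ.≤-trans (ℕ.∸-monoˡ-≤ (suc k) j≤) (ℕ.m∸n≤m fuel k))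
      ... | j′ , j′≤k , eq = j′ , j′≤k , ≡.trans (≡.cong (x ^_) (≡.sym (ℕ.m+[n∸m]≡n (ℕ.≰⇒> j≰k))))
              (≡.trans (iterate-+ (suc k) (j ℕ.∸ suc k) x) (≡.trans (≡.cong (_^ (j ℕ.∸ suc k)) return) eq))

    Reached : Fin n → Set
    Reached y = ∃ λ j → y ≡ x ^ j

    ∈-iterate⁻ : ∀ m {y} → y ∈ List.iterate w x m → Reached y
    ∈-iterate⁻ m y∈ with ∈.∈-applyUpTo⁻ (x ^_) (≡.subst (_ ∈_) (list-iterate x m) y∈)
    ... | j , _ , eq = j , eq

    ∈-iterate⁺ : ∀ m → suc k ℕ.≤ m → ∀ {y} → Reached y → y ∈ List.iterate w x m
    ∈-iterate⁺ m k<m (j , ≡.refl) with reduce j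
    ... | j′ , j′≤k , eq = ≡.subst (_∈ List.iterate w x m) (≡.sym eq) (≡.subst (x ^ j′ ∈_) (≡.sym (list-iterate x m))
            (∈.∈-applyUpTo⁺ (x ^_) (ℕ.≤-<-trans j′≤k k<m)))

    ∈-cycleOf⁻ : ∀ {y} → y ∈ cycleOf w x → Reached y
    ∈-cycleOf⁻ y∈ = ∈-iterate⁻ n (proj₂ (∈.∈-filter⁻ (_∈? List.iterate w x n) {xs = allFin n} y∈))
      where open import Data.List.Membership.DecPropositional (Fin._≟_ {n}) using (_∈?_)

    ∈-cycleOf⁺ : ∀ {y} → Reached y → y ∈ cycleOf w x
    ∈-cycleOf⁺ {y} r = ∈.∈-filter⁺ (_∈? List.iterate w x n) (∈.∈-allFin y) (∈-iterate⁺ n k<n r)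
      where open import Data.List.Membership.DecPropositional (Fin._≟_ {n}) using (_∈?_)

    unique-cycle : Unique (x ∷ rest)
    unique-cycle = ≡.subst Unique (≡.sym (list-iterate x (suc k))) (Unique.applyUpTo⁺₁ (x ^_) (suc k) λ {a} {b} a<b b≤k eq →
      let b≡ = ≡.trans (≡.sym (ℕ.+-suc (b ℕ.∸ suc a) a)) (ℕ.m∸n+n≡m a<b) in
      minimal {b ℕ.∸ suc a} (ℕ.<-≤-trans (ℕ.≤-trans (ℕ.m≤m+n _ a) (ℕ.≤-reflexive b≡)) (ℕ.s≤s⁻¹ b≤k))
        (iterate-injective w-injective a (≡.trans (≡.sym (iterate-+ (suc (b ℕ.∸ suc a)) a x)) (≡.trans (≡.cong (x ^_) b≡) (≡.sym eq)))))

    unique-cycleOf : Unique (cycleOf w x)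
    unique-cycleOf = Unique.filter⁺ (_∈? List.iterate w x n) (Unique.allFin⁺ n)
      where open import Data.List.Membership.DecPropositional (Fin._≟_ {n}) using (_∈?_)

    cycleOf-↭ : cycleOf w x ↭ x ∷ rest
    cycleOf-↭ = unique-≐⇒↭ unique-cycleOf unique-cycle
      (∈-iterate⁺ (suc k) ℕ.≤-refl ∘ ∈-cycleOf⁻) (∈-cycleOf⁺ ∘ ∈-iterate⁻ (suc k))

    reached-sym : ∀ {y} → Reached y → ∃ λ j → x ≡ y ^ j
    reached-sym (j , ≡.refl) with reduce j
    ... | j′ , j′≤k , eq = suc k ℕ.∸ j′ , ≡.sym (≡.trans (≡.cong (_^ (suc k ℕ.∸ j′)) eq)
            (≡.trans (≡.sym (iterate-+ j′ (suc k ℕ.∸ j′) x)) (≡.trans (≡.cong (x ^_) (ℕ.m+[n∸m]≡n (ℕ.m≤n⇒m≤1+n j′≤k))) return)))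

  reached-trans : ∀ {x y z} → Reached x y → Reached y z → Reached x z
  reached-trans (a , ≡.refl) (b , ≡.refl) = a ℕ.+ b , ≡.sym (iterate-+ a b _)

  -- Supports are listed in the order of `Fin n` and not in the order of traversal, so equal orbits
  -- give equal lists and removing duplicates leaves one list per cycle.
  cycleOf-cong : ∀ {x y} → Reached x y → cycleOf w x ≡ cycleOf w y
  cycleOf-cong {x} {y} xy = List.filter-≐ (_∈? List.iterate w x n) (_∈? List.iterate w y n)
    ( (λ z∈ → ∈-iterate⁺ y n (proj₁ (proj₂ (period y))) (reached-trans (reached-sym x xy) (∈-iterate⁻ x n z∈)))
    , (λ z∈ → ∈-iterate⁺ x n (proj₁ (proj₂ (period x))) (reached-trans xy (∈-iterate⁻ y n z∈)))) (allFin n)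
    where open import Data.List.Membership.DecPropositional (Fin._≟_ {n}) using (_∈?_)

  ∈-cycles⁻ : ∀ {Z} → Z ∈ cycles w → ∃ λ x → Z ≡ cycleOf w x
  ∈-cycles⁻ Z∈ with ∈.∈-map⁻ (cycleOf w) (∈.∈-deduplicate⁻ (List.≡-dec Fin._≟_) (map (cycleOf w) (allFin n)) Z∈)
  ... | x , _ , eq = x , eq

  cycles-areCycles : ∀ {Z} → Z ∈ cycles w → IsCycle w Z
  cycles-areCycles Z∈ with ∈-cycles⁻ Z∈
  ... | x , ≡.refl = (x , ∈-cycleOf⁺ x (0 , ≡.refl)) , λ {c} c∈ → rest c ,
    ≡.subst (_↭ c ∷ rest c) (≡.sym (cycleOf-cong (∈-cycleOf⁻ x c∈))) (cycleOf-↭ c) , trajectory-rest c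

  -- Every index lies on its own cycle, and cycles with a common element are equal.
  concat-cycles : concat (cycles w) ↭ allFin n
  concat-cycles = unique-≐⇒↭ (Unique.concat⁺
      (All.tabulate λ Z∈ → case ∈-cycles⁻ Z∈ of λ { (x , ≡.refl) → unique-cycleOf x })
      (disjoint id (deduplicate-! (List.≡-dec Fin._≟_) (map (cycleOf w) (allFin n)))))
    (Unique.allFin⁺ n) (λ _ → ∈.∈-allFin _)
    λ {x} _ → ∈.∈-concat⁺′ (∈-cycleOf⁺ x (0 , ≡.refl))
      (∈.∈-deduplicate⁺ (List.≡-dec Fin._≟_) (∈.∈-map⁺ (cycleOf w) (∈.∈-allFin x)))
    where
    open import Data.List.Relation.Unary.Unique.DecPropositional.Properties using (deduplicate-!)
    open import Data.List.Relation.Binary.Disjoint.Propositional using (Disjoint)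
    disjoint : ∀ {Zs} → (∀ {Z} → Z ∈ Zs → Z ∈ cycles w) → Unique Zs → AllPairs Disjoint Zs
    disjoint             sub []        = []
    disjoint {Z ∷ Zs} sub (Z∉ ∷ Zs!) = All.tabulate (λ {Z′} Z′∈ {c} (c∈ , c∈′) → All.lookup Z∉ Z′∈
        (≡.trans (through (sub (here ≡.refl)) c∈) (≡.sym (through (sub (there Z′∈)) c∈′))))
      ∷ disjoint (sub ∘ there) Zs!
      where
      through : ∀ {Z c} → Z ∈ cycles w → c ∈ Z → Z ≡ cycleOf w c
      through Z∈ c∈ with ∈-cycles⁻ Z∈
      ... | x , ≡.refl = cycleOf-cong (∈-cycleOf⁻ x c∈)

-- z, computed by adding the parts one by one.
centralizer : List ℕ → ℕ
centralizer []       = 1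
centralizer (k ∷ ks) = # (ℕ._≟ k) (k ∷ ks) ℕ.* (k ℕ.* centralizer ks)

#-∷-≡ : ∀ k ks → # (ℕ._≟ k) (k ∷ ks) ≡ suc (# (ℕ._≟ k) ks)
#-∷-≡ k ks = ≡.cong length (List.filter-accept (ℕ._≟ k) {k} {ks} ≡.refl)

#-∷-≢ : ∀ {k l} ks → k ≢ l → # (ℕ._≟ l) (k ∷ ks) ≡ # (ℕ._≟ l) ks
#-∷-≢ {k} {l} ks k≢l = ≡.cong length (List.filter-reject (ℕ._≟ l) {k} {ks} k≢l)

product-update : ∀ {f g : ℕ → ℕ} c i {xs} → Unique xs → i ∈ xs → f i ≡ c ℕ.* g i →
                 (∀ {j} → j ≢ i → f j ≡ g j) → product (map f xs) ≡ c ℕ.* product (map g xs)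
product-update {f} {g} c i {x ∷ xs} (x∉ ∷ xs!) (here ≡.refl) fi h = ≡.trans
  (≡.cong₂ ℕ._*_ fi (≡.cong product (same x∉)))
  (ℕ.*-assoc c (g i) (product (map g xs)))
  where
  same : ∀ {ys} → All (i ≢_) ys → map f ys ≡ map g ys
  same []        = ≡.refl
  same (i≢ ∷ is) = ≡.cong₂ _∷_ (h (i≢ ∘ ≡.sym)) (same is)
product-update {f} {g} c i {x ∷ xs} (x∉ ∷ xs!) (there i∈) fi h = ≡.trans
  (≡.cong₂ ℕ._*_ (h (λ { ≡.refl → All.lookup x∉ i∈ ≡.refl })) (product-update c i xs! i∈ fi h))
  (x*yz≡y*xz (g x) c _)
  where open CommutativeSemigroupProperties ℕ.*-commutativeSemigroup using () renaming (x∙yz≈y∙xz to x*yz≡y*xz)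

-- A new part multiplies the product of the parts by itself, and among the factorials it changes
-- only that of its own multiplicity, by the factor of the new multiplicity. The bound by `n` places
-- this factorial within the product.
centralizer≡ : ∀ n ks → All (0 ℕ.<_) ks → All (ℕ._≤ n) ks →
  product ks ℕ.* product (map (λ j → # (ℕ._≟ suc j) ks ℕ.!) (upTo n)) ≡ centralizer ks
centralizer≡ n [] _ _ = ≡.trans (ℕ.+-identityʳ _) (ones (upTo n))
  where
  ones : ∀ js → product (map (λ _ → 1) js) ≡ 1
  ones []       = ≡.refl
  ones (_ ∷ js) = ≡.trans (ℕ.+-identityʳ _) (ones js)
centralizer≡ n (suc k ∷ ks) (_ ∷ pos) (k<n ∷ le) = ≡.trans
  (≡.cong (product (suc k ∷ ks) ℕ.*_) (product-update c k (Unique.upTo⁺ n) (∈.∈-upTo⁺ k<n) at-k off-k))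
  (≡.trans (rearrange (suc k) (product ks) c _) (≡.cong (λ x → c ℕ.* (suc k ℕ.* x)) (centralizer≡ n ks pos le)))
  where
  c = # (ℕ._≟ suc k) (suc k ∷ ks)
  at-k : # (ℕ._≟ suc k) (suc k ∷ ks) ℕ.! ≡ c ℕ.* (# (ℕ._≟ suc k) ks ℕ.!)
  at-k rewrite #-∷-≡ (suc k) ks = ≡.refl
  off-k : ∀ {j} → j ≢ k → # (ℕ._≟ suc j) (suc k ∷ ks) ℕ.! ≡ # (ℕ._≟ suc j) ks ℕ.!
  off-k {j} j≢k = ≡.cong ℕ._! (#-∷-≢ {suc k} {suc j} ks λ { ≡.refl → j≢k ≡.refl })
  rearrange : ∀ a b c d → a ℕ.* b ℕ.* (c ℕ.* d) ≡ c ℕ.* (a ℕ.* (b ℕ.* d))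
  rearrange = solve 4 (λ a b c d → a :* b :* (c :* d) := c :* (a :* (b :* d))) ≡.refl
    where open import Data.Nat.Solver using (module +-*-Solver)
          open +-*-Solver

-- Cylindrical tableaux and immanants

module CycleCounting {c ℓ₁ ℓ₂} (R : OrderedCommutativeRing c ℓ₁ ℓ₂) where

  open OrderedCommutativeRing R using (∏)
  open Calculus R
  open PermutationSums R
  open Posets R
  open TableauSums R
  open Lifting R
  open Counting R
  open RowPredicates R
  open FamilySums R
  open import Algebra.Properties.Semiring.Mult semiring using (×1-homo-*)

  ∑-const : ∀ (xs : List A) r → ∑ xs (λ _ → r) ≈ fromℕ (length xs) * r
  ∑-const []       r = ≈-sym (zeroˡ r)
  ∑-const (x ∷ xs) r = ≈-trans (+-cong (≈-sym (*-identityˡ r)) (∑-const xs r)) (≈-sym (distribʳ r 1# _))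

  length-picks : ∀ (xs : List A) → length (picks xs) ≡ length xs
  length-picks []       = ≡.refl
  length-picks (x ∷ xs) = ≡.cong suc (≡.trans (List.length-map (map₂ (x ∷_)) (picks xs)) (length-picks xs))

  ∑-picks-++ : ∀ (xs ys : List A) {f : A → List A → Carrier} →
    ∑ (picks (xs ++ ys)) (λ (z , zs) → f z zs) ≈
    ∑ (picks xs) (λ (z , zs) → f z (zs ++ ys)) + ∑ (picks ys) (λ (z , zs) → f z (xs ++ zs))
  ∑-picks-++ []       ys = ≈-sym (+-identityˡ _)
  ∑-picks-++ (x ∷ xs) ys = ≈-trans (∑-picks-∷ x (xs ++ ys)) (≈-trans (+-congˡ (∑-picks-++ xs ys))
    (≈-trans (≈-sym (+-assoc _ _ _)) (+-congʳ (≈-sym (∑-picks-∷ x xs)))))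

  -- An element is picked by first picking its block; symmetry of `f` permits moving the rest of
  -- that block to the front.
  ∑-picks-concat : ∀ (xss : List (List A)) {f : A → List A → Carrier} → (∀ z → Symmetric (f z)) →
    ∑ (picks (concat xss)) (λ (z , zs) → f z zs) ≈
    ∑ (picks xss) (λ (xs , yss) → ∑ (picks xs) (λ (z , zs) → f z (zs ++ concat yss)))
  ∑-picks-concat []             h = ≈-refl
  ∑-picks-concat (xs ∷ xss) {f} h = begin
    ∑ (picks (xs ++ concat xss)) (λ (z , zs) → f z zs)
      ≈⟨ ∑-picks-++ xs (concat xss) ⟩
    ∑ (picks xs) (λ (z , zs) → f z (zs ++ concat xss)) + ∑ (picks (concat xss)) (λ (z , zs) → f z (xs ++ zs))
      ≈⟨ +-congˡ (≈-trans (∑-picks-concat xss (λ z p → h z (↭.++⁺ˡ xs p))) (∑-cong (picks xss) λ {(ys , yss)} _ →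
           ∑-cong (picks ys) λ {(z , zs)} _ → h z (↭.shifts xs zs))) ⟩
    ∑ (picks xs) (λ (z , zs) → f z (zs ++ concat xss)) +
    ∑ (picks xss) (λ (ys , yss) → ∑ (picks ys) (λ (z , zs) → f z (zs ++ concat (xs ∷ yss))))
      ≈⟨ ∑-picks-∷ xs xss ⟨
    ∑ (picks (xs ∷ xss)) (λ (xs , yss) → ∑ (picks xs) (λ (z , zs) → f z (zs ++ concat yss))) ∎

  -- Number of ways to match rows of lengths ks with cycles of lengths ls, and
  -- to choose a starting point in each.
  matchings : List ℕ → List ℕ → Carrier
  matchings []       ls = δ ls
  matchings (k ∷ ks) ls = ∑ (picks ls) (λ (l , ls′) → χ (l ℕ.≟ k) * (fromℕ k * matchings ks ls′))

  matchings-symmetric : ∀ ks → Symmetric (matchings ks)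
  matchings-symmetric []       = δ-symmetric
  matchings-symmetric (k ∷ ks) = ∑-picks-resp-↭ λ l q → *-congˡ (*-congˡ (matchings-symmetric ks q))

  matchings-≢ : ∀ ks ls → ¬ (ks ↭ ls) → matchings ks ls ≈ 0#
  matchings-≢ []       []       ¬p = contradiction ↭-refl ¬p
  matchings-≢ []       (_ ∷ _)  ¬p = ≈-refl
  matchings-≢ (k ∷ ks) ls       ¬p = ∑-0 (picks ls) λ {(l , ls′)} q → mismatch l ls′ (picks-↭ ls q)
    where
    mismatch : ∀ l ls′ → ls ↭ l ∷ ls′ → χ (l ℕ.≟ k) * (fromℕ k * matchings ks ls′) ≈ 0#
    mismatch l ls′ q = ≈-trans (χ-* (l ℕ.≟ k) λ { ≡.refl → ≈-trans (*-congˡ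
      (matchings-≢ ks ls′ λ p → ¬p (trans (prep l p) (↭-sym q)))) (zeroʳ _) }) (zeroʳ _)

  -- The first row may be matched with any cycle of length `k`, of which there are as many as `k`
  -- occurs in `k ∷ ks`. The remaining lengths are then `ks` up to order in each case.
  matchings-≡ : ∀ ks → matchings ks ks ≈ fromℕ (centralizer ks)
  matchings-≡ []       = ≈-sym (+-identityʳ 1#)
  matchings-≡ (k ∷ ks) = begin
    ∑ (picks (k ∷ ks)) (λ (l , ls) → χ (l ℕ.≟ k) * (fromℕ k * matchings ks ls))
      ≈⟨ ∑-cong (picks (k ∷ ks)) (λ {(l , ls)} p → same l ls (picks-↭ (k ∷ ks) p)) ⟩
    ∑ (picks (k ∷ ks)) (λ (l , ls) → χ (l ℕ.≟ k) * (fromℕ k * fromℕ (centralizer ks)))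
      ≈⟨ ≈-trans (≈-sym (∑-picks-first (k ∷ ks))) (∑-*ʳ (k ∷ ks) _) ⟩
    ∑ (k ∷ ks) (λ l → χ (l ℕ.≟ k)) * (fromℕ k * fromℕ (centralizer ks))
      ≈⟨ *-cong (≈-sym (fromℕ-# (ℕ._≟ k) (k ∷ ks))) (≈-sym (×1-homo-* k (centralizer ks))) ⟩
    fromℕ (# (ℕ._≟ k) (k ∷ ks)) * fromℕ (k ℕ.* centralizer ks)
      ≈⟨ ×1-homo-* (# (ℕ._≟ k) (k ∷ ks)) (k ℕ.* centralizer ks) ⟨
    fromℕ (centralizer (k ∷ ks)) ∎
    where
    same : ∀ l ls → k ∷ ks ↭ l ∷ ls →
      χ (l ℕ.≟ k) * (fromℕ k * matchings ks ls) ≈ χ (l ℕ.≟ k) * (fromℕ k * fromℕ (centralizer ks))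
    same l ls p = χ-* (l ℕ.≟ k) λ { ≡.refl →
      *-congˡ (≈-trans (matchings-symmetric ks (↭-sym (↭.drop-∷ p))) (matchings-≡ ks)) }

  module _ {n : ℕ} (w : Fin n → Fin n) where

    follow : Fin n → Fin n → Carrier
    follow x y = χ (w x Fin.≟ y)

    ∑-arrangements-chain : ∀ k x u {r zs} (g : List (Fin n) → Carrier) → Trajectory w x u r → Unique (r ∷ u ++ zs) →
      ∑ (arrangements k (u ++ zs)) (λ (v , us) → walk follow x v r * g us) ≈ χ (length u ℕ.≟ k) * g zs
    ∑-arrangements-chain zero x [] {r} g eq _ = ≈-trans (+-identityʳ _) (*-congʳ (χ-yes (w x Fin.≟ r) eq))
    ∑-arrangements-chain zero x (y ∷ u) {r} {zs} g (eq , _) (r∉ ∷ _) = ≈-trans (+-identityʳ _) (≈-trans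
      (*-congʳ (χ-no (w x Fin.≟ r) λ eq′ → All.head r∉ (≡.trans (≡.sym eq′) eq))) (≈-trans (zeroˡ _) (≈-sym (zeroˡ _))))
    ∑-arrangements-chain (suc k) x [] {r} {zs} g eq (r∉ ∷ _) = ≈-trans (∑-arrangements-suc k zs)
      (≈-trans (∑-0 (picks zs) λ {(y , ys)} p → ∑-0 (arrangements k ys) λ _ → ≈-trans (*-congʳ (≈-trans
        (*-congʳ (χ-no (w x Fin.≟ y) λ eq′ → All.head (↭.All-resp-↭ (picks-↭ zs p) r∉) (≡.trans (≡.sym eq) eq′)))
        (zeroˡ _))) (zeroˡ _)) (≈-sym (zeroˡ _)))
    ∑-arrangements-chain (suc k) x (y ∷ u) {r} {zs} g (eq , ch) ((r≢y ∷ r∉) ∷ y∉ ∷ u!) = begin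
      ∑ (arrangements (suc k) (y ∷ u ++ zs)) (λ (v , us) → walk follow x v r * g us)
        ≈⟨ ∑-arrangements-suc k (y ∷ u ++ zs) ⟩
      ∑ (picks (y ∷ u ++ zs)) (λ (z , ys) → ∑ (arrangements k ys) (λ (v , us) → follow x z * walk follow z v r * g us))
        ≈⟨ ∑-picks-∷ y (u ++ zs) ⟩
      ∑ (arrangements k (u ++ zs)) (λ (v , us) → follow x y * walk follow y v r * g us) +
      ∑ (picks (u ++ zs)) (λ (z , ys) → ∑ (arrangements k (y ∷ ys)) (λ (v , us) → follow x z * walk follow z v r * g us))
        ≈⟨ +-cong (∑-cong (arrangements k (u ++ zs)) λ _ → *-congʳ (≈-trans (*-congʳ (χ-yes (w x Fin.≟ y) eq)) (*-identityˡ _)))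
             (∑-0 (picks (u ++ zs)) λ {(z , ys)} p → ∑-0 (arrangements k (y ∷ ys)) λ _ → ≈-trans (*-congʳ (≈-trans
               (*-congʳ (χ-no (w x Fin.≟ z) λ eq′ → All.head (↭.All-resp-↭ (picks-↭ (u ++ zs) p) y∉) (≡.trans (≡.sym eq) eq′)))
               (zeroˡ _))) (zeroˡ _)) ⟩
      ∑ (arrangements k (u ++ zs)) (λ (v , us) → walk follow y v r * g us) + 0#
        ≈⟨ ≈-trans (+-identityʳ _) (∑-arrangements-chain k y u g ch (r∉ ∷ u!)) ⟩
      χ (length u ℕ.≟ k) * g zs
        ≈⟨ *-congʳ (χ-cong (length u ℕ.≟ k) (suc (length u) ℕ.≟ suc k) (≡.cong suc) ℕ.suc-injective) ⟩
      χ (length (y ∷ u) ℕ.≟ suc k) * g zs ∎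

    -- The first entry of a row determines the row, which must exhaust the cycle of that entry. All
    -- starting points of a cycle thus contribute equally, and only the lengths of the cycles
    -- remain.
    tableauSum-cycles : ∀ ks → All (0 ℕ.<_) ks → ∀ Zs → (∀ {Z} → Z ∈ Zs → IsCycle w Z) → Unique (concat Zs) →
      tableauSum (closedWalk follow) ks (concat Zs) ≈ matchings ks (map length Zs)
    tableauSum-cycles [] _ [] _ _ = ≈-refl
    tableauSum-cycles [] _ ([] ∷ Zs) cyc _ = case proj₁ (cyc (here ≡.refl)) of λ { (_ , ()) }
    tableauSum-cycles [] _ ((_ ∷ _) ∷ Zs) _ _ = ≈-refl
    tableauSum-cycles (suc k ∷ ks) (_ ∷ pos) Zs cyc Zs! = begin
      tableauSum (closedWalk follow) (suc k ∷ ks) (concat Zs)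
        ≈⟨ ∑-arrangements-suc k (concat Zs) ⟩
      ∑ (picks (concat Zs)) (λ (c , ys) → row c ys)
        ≈⟨ ∑-picks-concat Zs row-symmetric ⟩
      ∑ (picks Zs) (λ (Z , Zs′) → ∑ (picks Z) (λ (c , ys) → row c (ys ++ concat Zs′)))
        ≈⟨ ∑-cong (picks Zs) (λ {(Z , Zs′)} p → cycle Z Zs′ (picks-↭ Zs p)) ⟩
      ∑ (picks Zs) (λ (Z , Zs′) → χ (length Z ℕ.≟ suc k) * (fromℕ (suc k) * matchings ks (map length Zs′)))
        ≈⟨ ∑-picks-map length Zs ⟨
      matchings (suc k ∷ ks) (map length Zs) ∎
      where
      G : List (Fin n) → Carrier
      G = tableauSum (closedWalk follow) ks
      row : Fin n → List (Fin n) → Carrier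
      row c ys = ∑ (arrangements k ys) (λ (v , us) → walk follow c v c * G us)
      row-symmetric : ∀ c → Symmetric (row c)
      row-symmetric c = ∑-arrangements-resp-↭ k λ _ q → *-congˡ (tableauSum-symmetric (closedWalk follow) ks q)
      cycle : ∀ Z Zs′ → Zs ↭ Z ∷ Zs′ → ∑ (picks Z) (λ (c , ys) → row c (ys ++ concat Zs′)) ≈
        χ (length Z ℕ.≟ suc k) * (fromℕ (suc k) * matchings ks (map length Zs′))
      cycle Z Zs′ p = begin
        ∑ (picks Z) (λ (c , ys) → row c (ys ++ concat Zs′))
          ≈⟨ ∑-cong (picks Z) (λ {(c , ys)} q → start-at c ys (picks-↭ Z q)) ⟩
        ∑ (picks Z) (λ _ → χ (length Z ℕ.≟ suc k) * matchings ks (map length Zs′))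
          ≈⟨ ≈-trans (∑-const (picks Z) _) (*-congʳ (≈-reflexive (≡.cong fromℕ (length-picks Z)))) ⟩
        fromℕ (length Z) * (χ (length Z ℕ.≟ suc k) * matchings ks (map length Zs′))
          ≈⟨ *S.x∙yz≈y∙xz _ _ _ ⟩
        χ (length Z ℕ.≟ suc k) * (fromℕ (length Z) * matchings ks (map length Zs′))
          ≈⟨ χ-* (length Z ℕ.≟ suc k) (λ eq → *-congʳ (≈-reflexive (≡.cong fromℕ eq))) ⟩
        χ (length Z ℕ.≟ suc k) * (fromℕ (suc k) * matchings ks (map length Zs′)) ∎
        where
        unique′ : Unique (Z ++ concat Zs′)
        unique′ = unique-resp-↭ (concat-↭ p) Zs!
        start-at : ∀ c ys → Z ↭ c ∷ ys → row c (ys ++ concat Zs′) ≈ χ (length Z ℕ.≟ suc k) * matchings ks (map length Zs′)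
        start-at c ys q with proj₂ (cyc (↭.∈-resp-↭ (↭-sym p) (here ≡.refl))) (↭.∈-resp-↭ (↭-sym q) (here ≡.refl))
        ... | Y , Z↭ , ch = begin
          row c (ys ++ concat Zs′)
            ≈⟨ row-symmetric c (↭.++⁺ʳ (concat Zs′) (↭.drop-∷ (trans (↭-sym q) Z↭))) ⟩
          row c (Y ++ concat Zs′)
            ≈⟨ ∑-arrangements-chain k c Y G ch
                 (unique-resp-↭ (↭.++⁺ʳ (concat Zs′) Z↭) unique′) ⟩
          χ (length Y ℕ.≟ k) * G (concat Zs′)
            ≈⟨ *-cong (χ-cong (length Y ℕ.≟ k) (length Z ℕ.≟ suc k)
                 (λ eq → ≡.trans (↭.↭-length Z↭) (≡.cong suc eq))
                 (λ eq → ℕ.suc-injective (≡.trans (≡.sym (↭.↭-length Z↭)) eq)))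
                 (tableauSum-cycles ks pos Zs′ (cyc ∘ ↭.∈-resp-↭ (↭-sym p) ∘ there)
                   (proj₁ (proj₂ (unique-++⁻ Z unique′)))) ⟩
          χ (length Z ℕ.≟ suc k) * matchings ks (map length Zs′) ∎

    module _ (lam : Partition n) where

      open Partition lam

      parts≤ : All (ℕ._≤ n) parts
      parts≤ = All.tabulate λ k∈ → ≡.subst (_ ℕ.≤_) sum-parts (go k∈)
        where
        go : ∀ {ks k} → k ∈ ks → k ℕ.≤ sum ks
        go (here ≡.refl)         = ℕ.m≤m+n _ _
        go {k ∷ ks} (there k∈)   = ℕ.≤-trans (go k∈) (ℕ.m≤n+m _ k)

      sorted-cycleType : cycleType w ↭ map length (cycles w)
      sorted-cycleType = sort-↭ (map length (cycles w))
        where open import Data.List.Sort.InsertionSort.Properties (Flip.decTotalOrder ℕ.≤-decTotalOrder) using (sort-↭)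

      cycleType-unique : parts ↭ map length (cycles w) → cycleType w ≡ parts
      cycleType-unique p = Pointwise-≡⇒≡ (↗↭↗⇒≋ (Flip.totalOrder ℕ.≤-totalOrder) (sort-↗ (map length (cycles w))) parts-decr
        (↭⇒↭ₛ (trans sorted-cycleType (↭-sym p))))
        where
        open import Data.List.Sort.InsertionSort.Properties (Flip.decTotalOrder ℕ.≤-decTotalOrder) using (sort-↗)
        open import Data.List.Relation.Unary.Sorted.TotalOrder.Properties using (↗↭↗⇒≋)
        open import Data.List.Relation.Binary.Permutation.Propositional using (↭⇒↭ₛ)
        open import Data.List.Relation.Binary.Pointwise using (Pointwise-≡⇒≡)

      matchings≈ψ : matchings parts (map length (cycles w)) ≈ ψ R lam w
      matchings≈ψ = select (List.≡-dec ℕ._≟_ (cycleType w) parts)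
        (λ eq → ≈-trans (matchings-symmetric parts (↭-sym (trans (↭-reflexive (≡.sym eq)) sorted-cycleType)))
          (≈-trans (matchings-≡ parts) (≈-reflexive (≡.cong fromℕ (≡.sym (centralizer≡ n parts parts-pos parts≤))))))
        (λ ≢parts → matchings-≢ parts (map length (cycles w)) (≢parts ∘ cycleType-unique))
        where
        select : ∀ {P : Set} (P? : Dec P) {x y} → (P → x ≈ y) → (¬ P → x ≈ 0#) → x ≈ (if does P? then y else 0#)
        select (yes Px) f g = f Px
        select (no ¬P)  f g = g ¬P

      tableauSum≈ψ : (∀ {x y} → w x ≡ w y → x ≡ y) → tableauSum (closedWalk follow) parts (allFin n) ≈ ψ R lam w
      tableauSum≈ψ inj = begin
        tableauSum (closedWalk follow) parts (allFin n)
          ≈⟨ tableauSum-symmetric (closedWalk follow) parts concat-cycles ⟨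
        tableauSum (closedWalk follow) parts (concat (cycles w))
          ≈⟨ tableauSum-cycles parts parts-pos (cycles w) cycles-areCycles
               (unique-resp-↭ (↭-sym concat-cycles) (Unique.allFin⁺ n)) ⟩
        matchings parts (map length (cycles w))
          ≈⟨ matchings≈ψ ⟩
        ψ R lam w ∎
        where open CycleDecomposition w inj

      #-cylindrical : fromℕ (# (λ (U : Filling lam) → Fin.all? λ i → cylindrical? w (U i)) (tableaux lam)) ≈
                      tableauSum (closedWalk follow) parts (allFin n)
      #-cylindrical = #-tableaux lam (cylindrical? w) (closedWalk follow) (χ-cylindrical w) _ (λ _ → id) (λ _ → id)

  -- Some row contains `z`, and its closed walk has to step into `z`.
  tableauSum-zeroColumn : ∀ (M : A → A → Carrier) {z} → (∀ x → M x z ≈ 0#) →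
    ∀ ks xs → tableauSum (closedWalk M) ks (z ∷ xs) ≈ 0#
  tableauSum-zeroColumn M     M0 []       xs = ≈-refl
  tableauSum-zeroColumn M {z} M0 (k ∷ ks) xs = ≈-trans (tableauSum-∷ (closedWalk M) k ks (z ∷ xs))
    (≈-trans (⋆-∷ (rowSum (closedWalk M) k) (tableauSum (closedWalk M) ks) z xs)
    (≈-trans (+-cong
      (∑-0 (splits xs) λ {(ys , zs)} _ → ≈-trans (*-congʳ (≈-trans (*-congˡ (row ys)) (zeroʳ _))) (zeroˡ _))
      (∑-0 (splits xs) λ {(ys , zs)} _ → ≈-trans (*-congˡ (tableauSum-zeroColumn M M0 ks zs)) (zeroʳ _)))
    (+-identityˡ 0#)))
    where
    into-z : ∀ x us → walks M x z us ≈ 0#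
    into-z x us = ≈-trans (walks-column M x z us (All.tabulate λ {y} _ → M0 y)) (≈-trans (*-congˡ (M0 x)) (zeroʳ _))
    row : ∀ ys → ∑perm (z ∷ ys) (closedWalk M) ≈ 0#
    row ys = ≈-trans (∑perm-closedWalk M (z ∷ ys)) (≈-trans (+-identityˡ _) (≈-trans (∑-picks-∷ z ys)
      (≈-trans (+-cong (into-z z ys) (∑-0 (picks ys) λ {(x , zs)} _ → ≈-trans (walks-∷ M x z x zs)
        (∑-0 (splits zs) λ {(us , _)} _ → ≈-trans (*-congʳ (into-z x us)) (zeroˡ _)))) (+-identityˡ 0#))))

  module _ {n : ℕ} where

    injective-or-missed : ∀ (w : Fin n → Fin n) → (∀ {x y} → w x ≡ w y → x ≡ y) ⊎ ∃ λ z → ∀ x → w x ≢ z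
    injective-or-missed w with Fin.all? (λ z → Fin.any? (λ x → w x Fin.≟ z))
    ... | no ¬surj = let (z , ¬hit) = Fin.¬∀⟶∃¬ n _ (λ z → Fin.any? (λ x → w x Fin.≟ z)) ¬surj in
                     inj₂ (z , λ x eq → ¬hit (x , eq))
    ... | yes surj = inj₁ (unique-tabulate⁻ (≡.subst Unique (List.map-tabulate id w)
            (unique-resp-↭ (↭-sym image) (Unique.allFin⁺ n))))
      where
      image : map w (allFin n) ↭ allFin n
      image = unique-⊆⇒↭ (Unique.allFin⁺ n) (λ {z} _ → let (x , eq) = surj z in
          ≡.subst (_∈ map w (allFin n)) eq (∈.∈-map⁺ w (∈.∈-allFin x)))
        (ℕ.≤-reflexive (List.length-map w (allFin n)))

    -- A function on a finite set that is not injective misses a value, whose column in the matrix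
    -- of `w` is zero. This permits the sum over permutations to be extended to all functions.
    tableauSum-notInjective : ∀ (w : Fin n → Fin n) ks → ¬ (∀ {x y} → w x ≡ w y → x ≡ y) →
      tableauSum (closedWalk (follow w)) ks (allFin n) ≈ 0#
    tableauSum-notInjective w ks ¬inj with injective-or-missed w
    ... | inj₁ inj = contradiction (λ {x} {y} → inj {x} {y}) ¬inj
    ... | inj₂ (z , missed) with extract-any {P = z ≡_} (∈.∈-allFin z)
    ...   | _ , ys , p , ≡.refl = ≈-trans (tableauSum-symmetric (closedWalk (follow w)) ks p)
              (tableauSum-zeroColumn (follow w) (λ x → χ-no (w x Fin.≟ z) (missed x)) ks ys)

    ∑-allFin-χ : ∀ (f : Fin n → Carrier) i → ∑ (allFin n) (λ j → f j * χ (j Fin.≟ i)) ≈ f i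
    ∑-allFin-χ f i with extract-any {P = i ≡_} (∈.∈-allFin i)
    ... | _ , js , p , ≡.refl = ≈-trans (∑-↭ p) (≈-trans (+-cong
        (≈-trans (*-congˡ (χ-yes (i Fin.≟ i) ≡.refl)) (*-identityʳ _))
        (∑-0 js λ {j} j∈ → ≈-trans (*-congˡ (χ-no (j Fin.≟ i) λ j≡i → All.lookup (AllPairs.head unique) j∈ (≡.sym j≡i))) (zeroʳ _)))
        (+-identityʳ _))
      where
      unique : Unique (i ∷ js)
      unique = unique-resp-↭ p (Unique.allFin⁺ n)

    module _ (M : Fin n → Fin n → Carrier) where

      private
        entries : Fin n → List (Fin n)
        entries _ = allFin n

        entry : ∀ {i} → Fin n → Carrier
        entry {i} j = M i j

        -- The arrow from i to j is followed by an arrow from j.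
        match : Fin n × Fin n → Fin n × Fin n → Carrier
        match (_ , j) (i , _) = χ (j Fin.≟ i)

      -- Each step sums `M x j` over the targets `j` of the arrow from `x` and `match` selects the
      -- next vertex, which restores the matrix entry. The arrow `J j` at the end point is
      -- arbitrary: in a closed walk it is that of the start, and once the start has moved on it
      -- stays fixed, so that `J` becomes constant in the induction.
      lift-walks-match : ∀ x z (J : Fin n → Fin n) xs →
        ∑ (allFin n) (λ j → M x j * lift entries (λ {i} → entry {i}) (walks match (x , j) (z , J j)) xs) ≈ walks M x z xs
      lift-walks-match x z J xs = length-induction Lifted extend xs x J
        where
        L = lift entries (λ {i} → entry {i})
        Lifted : List (Fin n) → Set _
        Lifted xs = ∀ x (J : Fin n → Fin n) →
          ∑ (allFin n) (λ j → M x j * L (walks match (x , j) (z , J j)) xs) ≈ walks M x z xs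
        extend : ∀ xs → (∀ {ys} → length ys ℕ.< length xs → Lifted ys) → Lifted xs
        extend xs ih x J = begin
          ∑ (allFin n) (λ j → M x j * L (walks match (x , j) (z , J j)) xs)
            ≈⟨ ∑-cong (allFin n) (λ {j} _ → *-congˡ (lifted j)) ⟩
          ∑ (allFin n) (λ j → M x j * (δ xs * χ (j Fin.≟ z) + ∑ (picks xs) (λ (y , zs) → χ (j Fin.≟ y) * walks M y z zs)))
            ≈⟨ ∑-cong (allFin n) (λ {j} _ → ≈-trans (distribˡ _ _ _) (+-cong (*S.x∙yz≈y∙xz _ _ _)
                 (≈-trans (≈-sym (∑-*ˡ (picks xs) (M x j))) (∑-cong (picks xs) λ _ → ≈-sym (*-assoc _ _ _))))) ⟩
          ∑ (allFin n) (λ j → δ xs * (M x j * χ (j Fin.≟ z)) + ∑ (picks xs) (λ (y , zs) → M x j * χ (j Fin.≟ y) * walks M y z zs))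
            ≈⟨ ∑-+ (allFin n) ⟩
          ∑ (allFin n) (λ j → δ xs * (M x j * χ (j Fin.≟ z))) +
          ∑ (allFin n) (λ j → ∑ (picks xs) (λ (y , zs) → M x j * χ (j Fin.≟ y) * walks M y z zs))
            ≈⟨ +-cong (≈-trans (∑-*ˡ (allFin n) (δ xs)) (*-congˡ (∑-allFin-χ (M x) z)))
                 (≈-trans (∑-swap (allFin n) (picks xs)) (∑-cong (picks xs) λ {(y , zs)} _ →
                   ≈-trans (∑-*ʳ (allFin n) _) (*-congʳ (∑-allFin-χ (M x) y)))) ⟩
          δ xs * M x z + ∑ (picks xs) (λ (y , zs) → M x y * walks M y z zs)
            ≈⟨ walks-step M x z xs ⟨
          walks M x z xs ∎
          where
          lifted : ∀ j → L (walks match (x , j) (z , J j)) xs ≈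
            δ xs * χ (j Fin.≟ z) + ∑ (picks xs) (λ (y , zs) → χ (j Fin.≟ y) * walks M y z zs)
          lifted j = begin
            L (walks match (x , j) (z , J j)) xs
              ≈⟨ lift-cong entries (λ {i} → entry {i}) xs (λ {ys} _ → ≈-trans (walks-step match (x , j) (z , J j) ys) (+-congʳ (*-comm _ _))) ⟩
            L (λ ys → χ (j Fin.≟ z) * δ ys + ∑ (picks ys) (λ (y , zs) → match (x , j) y * walks match y (z , J j) zs)) xs
              ≈⟨ ≈-trans (lift-+ entries (λ {i} → entry {i}) xs) (+-cong
                   (≈-trans (lift-*ˡ entries (λ {i} → entry {i}) xs _) (≈-trans (*-congˡ (lift-δ entries (λ {i} → entry {i}) xs)) (*-comm _ _)))
                   (lift-picks entries (λ {i} → entry {i}) xs)) ⟩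
            δ xs * χ (j Fin.≟ z) + ∑ (picks xs) (λ (y , zs) → ∑ (allFin n) (λ j′ →
              M y j′ * L (λ us → χ (j Fin.≟ y) * walks match (y , j′) (z , J j) us) zs))
              ≈⟨ +-congˡ (∑-cong (picks xs) λ {(y , zs)} p → ≈-trans
                   (∑-cong (allFin n) λ _ → ≈-trans (*-congˡ (lift-*ˡ entries (λ {i} → entry {i}) zs _)) (*S.x∙yz≈y∙xz _ _ _))
                   (≈-trans (∑-*ˡ (allFin n) _) (*-congˡ (ih {zs} (↭-∷⇒< (picks-↭ xs p)) y (λ _ → J j))))) ⟩
            δ xs * χ (j Fin.≟ z) + ∑ (picks xs) (λ (y , zs) → χ (j Fin.≟ y) * walks M y z zs) ∎

      -- A function is a family with one arrow from each index, so the lifting applies with arrows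
      -- in place of paths and with `match` in place of the semistrict matrix.
      ∑-functions-tableauSum : ∀ ks →
        ∑ (choices λ _ → allFin n) (λ w → ∏ (λ i → M i (w i)) * tableauSum (closedWalk (follow w)) ks (allFin n)) ≈
        tableauSum (closedWalk M) ks (allFin n)
      ∑-functions-tableauSum ks = begin
        ∑ (choices λ _ → allFin n) (λ w → ∏ (λ i → M i (w i)) * tableauSum (closedWalk (follow w)) ks (allFin n))
          ≈⟨ ∑-cong (choices λ _ → allFin n) (λ {w} _ → *-congˡ (≈-trans
               (tableauSum-cong (λ ys → ∑-cong (arrangements (length ys) ys) λ {(u , _)} _ → closedWalk-map (λ i → i , w i) match u) ks (allFin n))
               (≈-trans (tableauSum-map (λ i → i , w i) (closedWalk match) ks (allFin n))
                 (≈-reflexive (≡.cong (tableauSum (closedWalk match) ks) (List.map-tabulate id (λ i → i , w i))))))) ⟩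
        ∑ (choices λ _ → allFin n) (λ w → ∏ (λ i → M i (w i)) * tableauSum (closedWalk match) ks (tabulate (λ i → i , w i)))
          ≈⟨ ∑-choices-lift entries (λ {i} → entry {i}) id (tableauSum (closedWalk match) ks) ⟩
        lift entries (λ {i} → entry {i}) (tableauSum (closedWalk match) ks) (allFin n)
          ≈⟨ lift-tableauSum entries (λ {i} → entry {i}) (lift-closedWalk entries (λ {i} → entry {i}) M match
               (λ x xs → lift-walks-match x x id xs)) ks (allFin n) ⟩
        tableauSum (closedWalk M) ks (allFin n) ∎

      ∑-permutations-tableauSum : ∀ ks →
        ∑ (𝔖 n) (λ w → ∏ (λ i → M i (w i)) * tableauSum (closedWalk (follow w)) ks (allFin n)) ≈
        tableauSum (closedWalk M) ks (allFin n)
      ∑-permutations-tableauSum ks = ≈-trans (∑-filter (injective? {n} {n}) functions)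
        (≈-trans (∑-cong functions λ {w} _ → drop w) (∑-functions-tableauSum ks))
        where
        functions = choices {n = n} (λ _ → allFin n)
        drop : ∀ w → χ (injective? w) * (∏ (λ i → M i (w i)) * tableauSum (closedWalk (follow w)) ks (allFin n)) ≈
                     ∏ (λ i → M i (w i)) * tableauSum (closedWalk (follow w)) ks (allFin n)
        drop w = χ-absorb (injective? w) λ ¬inj →
          ≈-trans (*-congˡ (tableauSum-notInjective w ks (λ inj → ¬inj inj))) (zeroʳ _)

      Imm-ψ : ∀ lam → Imm R (ψ R lam) M ≈ tableauSum (closedWalk M) (Partition.parts lam) (allFin n)
      Imm-ψ lam = ≈-trans (∑-cong (𝔖 n) λ {w} w∈ → ≈-trans (*-comm _ _) (*-congˡ (≈-sym (tableauSum≈ψ w lam (permutation w∈)))))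
        (∑-permutations-tableauSum (Partition.parts lam))
        where
        permutation : ∀ {w} → w ∈ 𝔖 n → ∀ {x y} → w x ≡ w y → x ≡ y
        permutation w∈ = proj₂ (∈.∈-filter⁻ injective? {xs = choices λ _ → allFin n} w∈)

theorem4p16 : ∀ {c ℓ₁ ℓ₂} (R : OrderedCommutativeRing c ℓ₁ ℓ₂) (n : ℕ)
    (D : PlanarNetwork R n) (lam : Partition n) →
    let open OrderedCommutativeRing R
        open PlanarNetwork D
    in (Imm R (ψ R lam) pathMatrix ≈
          ∑ (families id) (λ π → wgt π * fromℕ (#cyclicallyRowSemistrict lam π)))
       × (Imm R (ψ R lam) pathMatrix ≈
          ∑ (families id) (λ π → wgt π * fromℕ (#recordFreeRowSemistrict lam π)))
       × (Imm R (ψ R lam) pathMatrix ≈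
          ∑ (𝔖 n) (λ w → ∑ (families w) (λ π → wgt π * fromℕ (#cylindrical lam π))))
theorem4p16 R n D lam =
  ≈-trans imm (≈-sym (∑-families-tableauSum lam (#cyclicallyRowSemistrict lam) (#cyclicallyRowSemistrict≈ lam))) ,
  ≈-trans imm (≈-sym (∑-families-tableauSum lam (#recordFreeRowSemistrict lam) (#recordFreeRowSemistrict≈ lam))) ,
  ≈-trans imm (≈-sym (≈-trans (∑-cong (𝔖 n) λ {w} _ → cylindrical w)
    (∑-permutations-tableauSum pathMatrix (Partition.parts lam))))
  where
  open Calculus R
  open TableauSums R
  open FamilySums R
  open CycleCounting R
  open PlanarNetwork D
  open PathTableaux R D
  imm = Imm-ψ pathMatrix lam
  cylindrical : ∀ w → ∑ (families w) (λ π → wgt π * fromℕ (#cylindrical lam π)) ≈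
    OrderedCommutativeRing.∏ R (λ i → pathMatrix i (w i)) * tableauSum (closedWalk (follow w)) (Partition.parts lam) (allFin n)
  -- The count depends on the type `w` alone, so it factors out, and the weights of the families of
  -- this type add up to a product of path matrix entries.
  cylindrical w = ≈-trans (∑-*ʳ (families w) _) (*-cong
    (∑-choices-∏ (λ i → sourceSinkPaths i (w i)) (λ i → pathWeight)) (#-cylindrical w lam))
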